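{- Let $p$ be a prime. Then the group $C_2^5\times C_p$ is a $\mathrm{DCI}$-group if and only if $p\neq 2$.
   Context: $C_n$ denotes the cyclic group of order $n$. For a finite group $G$ and $S\subseteq G$, the Cayley digraph $\mathrm{Cay}(G,S)$ has vertex set $G$ and arc set $\{(g,sg): g\in G, s\in S\}$. Two Cayley digraphs $\mathrm{Cay}(G,S)$ and $\mathrm{Cay}(G,T)$ are Cayley isomorphic if some automorphism of the group $G$ is a digraph isomorphism between them (equivalently $T=S^\varphi$ for some $\varphi\in\mathrm{Aut}(G)$). A subset $S\subseteq G$ is a CI-subset if for every $T\subseteq G$, $\mathrm{Cay}(G,S)\cong \mathrm{Cay}(G,T)$ implies that they are Cayley isomorphic. A finite group $G$ is a $\mathrm{DCI}$-group if every subset of $G$ is a CI-subset. -}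

module Defs where

open import Data.Nat using (ℕ; zero; suc; _+_)
open import Data.Nat.DivMod using (_mod_)
open import Data.Fin using (Fin; toℕ)
open import Data.Vec using (Vec; zipWith)
open import Data.Bool using (Bool; true)
open import Data.Product using (Σ; _×_; _,_; ∃)
open import Function.Bundles using (Inverse; _↔_)
open import Relation.Binary.PropositionalEquality using (_≡_)

-- Generic notions for a group given by carrier G and operation _∙_
-- (equality is propositional equality). Subsets of G are G → Bool.

module _ {G : Set} (_∙_ : G → G → G) where

  CayArc : (G → Bool) → G → G → Set
  CayArc S g h = Σ G λ s → (S s ≡ true) × (h ≡ s ∙ g)

  CayIso : (G → Bool) → (G → Bool) → Set
  CayIso S T = Σ (G ↔ G) λ f →
    ∀ g h → (CayArc S g h → CayArc T (Inverse.to f g) (Inverse.to f h))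
          × (CayArc T (Inverse.to f g) (Inverse.to f h) → CayArc S g h)

  IsAut : (G ↔ G) → Set
  IsAut φ = ∀ a b → Inverse.to φ (a ∙ b) ≡ Inverse.to φ a ∙ Inverse.to φ b

  CayleyIsomorphic : (G → Bool) → (G → Bool) → Set
  CayleyIsomorphic S T = Σ (G ↔ G) λ φ → IsAut φ × (∀ x → T (Inverse.to φ x) ≡ S x)

  IsCISubset : (G → Bool) → Set
  IsCISubset S = ∀ (T : G → Bool) → CayIso S T → CayleyIsomorphic S T

  IsDCIGroup : Set
  IsDCIGroup = ∀ (S : G → Bool) → IsCISubset S

addC : ∀ {n} → Fin n → Fin n → Fin n
addC {suc n} i j = (toℕ i + toℕ j) mod suc n

C2⁵×C : ℕ → Set
C2⁵×C p = Vec (Fin 2) 5 × Fin p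

opC2⁵×C : (p : ℕ) → C2⁵×C p → C2⁵×C p → C2⁵×C p
opC2⁵×C p (u , a) (v , b) = zipWith addC u v , addC a b

{-# OPTIONS --safe #-}
-- Let p be odd, E = C₂⁵, and let f : Cay(E × C_p , S) → Cay(E × C_p , T) be an isomorphism; write S_e ⊆ C_p for the row
-- of S over e ∈ E.  Counting walks of length p modulo p shows that f respects the cosets of the subgroup L of E spanned by
-- the e whose row is neither empty nor full.  Rotating a single coset of L × C_p is therefore an automorphism, and a Sylow
-- argument (a p-group acting on a set of size prime to p has a fixed point) lets us compose f with an automorphism so that
-- it permutes the cosets of L × C_p and is affine on C_p in each of them.  Because E has exponent 2, f may then be replaced
-- by (e , t) ↦ (φ e , a_e t) with a_e constant on cosets of L.  The same Sylow argument for the prime 2, one coordinate at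
-- a time, makes φ triangular with respect to a flag through L.  Normalising φ on the basis leaves 2¹⁶ maps; for each of
-- them a linear map α is found such that α e is linked to e by a chain of differences φ(o) + φ(o + e), so T_{α e} = a S_e.
-- For p = 2 a quadratic and a cubic bent function give isomorphic Cayley graphs that no automorphism matches.

module Submission where

open import Defs
open import Data.Bool as Bool using (Bool; true; false; _∧_; _∨_; _xor_; not; if_then_else_)
open import Data.Bool.ListAction using (any; all)
open import Data.Bool.Properties using (∧-conicalˡ; ∧-conicalʳ; ∧-assoc; ∧-comm; ∨-identityʳ; xor-assoc; xor-comm)
open import Data.Empty using (⊥; ⊥-elim)
open import Data.Fin using (Fin; zero; suc; toℕ; fromℕ<; #_)
open import Data.Fin.Permutation using (↔⇒≡)
open import Data.Fin.Properties as Finₚ using (toℕ-fromℕ<; toℕ-injective; toℕ<n; *↔×)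
open import Data.List as List using (List; []; _∷_; length; filter; map; _++_; applyUpTo; allFin; cartesianProductWith)
open import Data.List.Membership.DecPropositional using () renaming (_∈?_ to mem?)
open import Data.List.Membership.Propositional using (_∈_; lose)
open import Data.List.Membership.Propositional.Properties using (∈-filter⁺; ∈-filter⁻; ∈-map⁺; ∈-map⁻; ∈-allFin; ∈-applyUpTo⁺; ∈-applyUpTo⁻; ∈-cartesianProductWith⁺; ∈-cartesianProductWith⁻; ∈-++⁺ˡ; ∈-++⁺ʳ)
open import Data.List.Membership.Propositional.Properties.WithK using (unique∧set⇒bag)
open import Data.List.Properties as Listₚ using (length-applyUpTo; length-++; length-map; length-tabulate; filter-all; filter-none; filter-some; filter-notAll; filter-++; map-cong; map-∘; ++-assoc; ++-identityʳ)
open import Data.List.Relation.Binary.BagAndSetEquality using (∼bag⇒↭)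
open import Data.List.Relation.Binary.Permutation.Propositional.Properties using (↭-length) renaming (map⁺ to ↭-map⁺)
open import Data.List.Relation.Unary.All as All using (All; []; _∷_)
open import Data.List.Relation.Unary.AllPairs using ([]; _∷_)
open import Data.List.Relation.Unary.Any using (here; there)
open import Data.List.Relation.Unary.Unique.Propositional using (Unique)
import Data.List.Relation.Unary.Unique.Propositional.Properties as Uniqueₚ
open import Data.Maybe using (Maybe; just; nothing)
open import Data.Nat as ℕ using (ℕ; zero; suc; pred; _+_; _*_; _^_; _∸_; _≤_; _<_; z≤n; s≤s; z<s; NonZero; >-nonZero; >-nonZero⁻¹; _≡ᵇ_)
open import Data.Nat.Coprimality using (Coprime; prime⇒coprime; coprime-Bézout)
open import Data.Nat.Divisibility using (_∣_; _∣?_; divides; ∣-refl; ∣m∣n⇒∣m+n; ∣m+n∣m⇒∣n; ∣1⇒≡1; ∣⇒≤; _∣0)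
open import Data.Nat.DivMod
open import Data.Nat.GCD using (module Bézout)
open import Data.Nat.GeneralisedArithmetic using (fold; fold-+)
open import Data.Nat.Induction using (<-wellFounded)
open import Data.Nat.ListAction using (sum)
open import Data.Nat.ListAction.Properties using (sum-↭)
open import Data.Nat.Primality using (Prime; prime[2]; ¬prime[0]; ¬prime[1]; prime⇒nonZero; prime⇒irreducible; euclidsLemma)
open import Data.Nat.Properties hiding (_≟_)
open import Data.Product using (Σ; _×_; _,_; proj₁; proj₂)
open import Data.Product.Function.NonDependent.Propositional using (_×-↔_)
open import Data.Product.Properties using () renaming (≡-dec to ×-≡-dec)
open import Data.Sum using (_⊎_; inj₁; inj₂)
open import Data.Unit using (⊤; tt)
open import Data.Vec as Vec using (Vec; []; _∷_; _∷ʳ_; lookup; tabulate; zipWith; replicate; toList; head; tail)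
open import Data.Vec.Properties as Vecₚ using (≡-dec; ∷-injective; ∷-injectiveˡ; ∷-injectiveʳ; lookup∘tabulate; tabulate∘lookup; tabulate-cong; lookup-zipWith; lookup-replicate; toList-∷ʳ)
open import Function using (_∘_; id; case_of_)
open import Function.Bundles using (Inverse; _↔_; _⇔_; mk⇔; mk↔ₛ′)
open import Function.Properties.Inverse using (↔-trans; ↔-sym; ↔-refl)
open import Induction.WellFounded using (Acc; acc)
open import Relation.Binary.Definitions using (DecidableEquality; tri<; tri≈; tri>)
open import Relation.Binary.PropositionalEquality hiding ([_])
open import Relation.Nullary using (¬_; Dec; yes; no; ¬?; _×-dec_)
open import Relation.Nullary.Decidable using (⌊_⌋; map′; decidable-stable; ¬¬-excluded-middle)

-- Orbits of maps of prime order

-- The automorphism groups are never enumerated, so no Sylow subgroup is formed. What is counted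
-- instead are the fixed-point-free self-maps `y` of a quotient that keep every point in its block.
-- Their number is prime to the given prime, so some conjugacy class of them has size prime to it,
-- and each of two commuting families of that prime order centralises a member of this class. A map
-- centralising all translations (or all rotations of single cosets) is itself a translation (or a
-- simultaneous rotation), and the conjugator between the two members carries one to the other.
-- Conjugacy is decided only up to double negation; this can be undone at the end because
-- equivalence of two subsets is a search over finitely many candidates.
--
-- The exponent 16 counts the free bits of a triangular map ψ of F₂⁵ fixing 0 and the basis: 11 in
-- the first coordinate, 4 in the second, 1 in the third. Such a ψ need not be linear. But up to
-- scalars the row of S at e equals the row of T at every difference ψ(o) + ψ(o + e), so these rows
-- of T agree with each other, and a linear map only has to choose its values inside the resulting
-- connected components.

module _ {A : Set} where

  length-≡-of-⊆⊇ : {xs ys : List A} → Unique xs → Unique ys →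
    (∀ {x} → x ∈ xs → x ∈ ys) → (∀ {x} → x ∈ ys → x ∈ xs) → length xs ≡ length ys
  length-≡-of-⊆⊇ ux uy f g = ↭-length (∼bag⇒↭ (unique∧set⇒bag ux uy (mk⇔ f g)))

  length-filter-split : {P : A → Set} (P? : ∀ x → Dec (P x)) (xs : List A) →
    length xs ≡ length (filter P? xs) + length (filter (¬? ∘ P?) xs)
  length-filter-split P? [] = refl
  length-filter-split P? (x ∷ xs) with P? x
  ... | yes _ = cong suc (length-filter-split P? xs)
  ... | no _ = trans (cong suc (length-filter-split P? xs)) (sym (+-suc _ _))

  fold-inj : (g : A → A) → (∀ {x y} → g x ≡ g y → x ≡ y) → ∀ i {x y} → fold x g i ≡ fold y g i → x ≡ y
  fold-inj g inj zero eq = eq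
  fold-inj g inj (suc i) eq = fold-inj g inj i (inj eq)

  fold-suc : (g : A → A) (x : A) → ∀ n → fold x g (suc n) ≡ fold (g x) g n
  fold-suc g x zero = refl
  fold-suc g x (suc n) = cong g (fold-suc g x n)

  fold-period : (g : A → A) {x : A} (k : ℕ) → fold x g k ≡ x → ∀ m → fold x g (m * k) ≡ x
  fold-period g k eq zero = refl
  fold-period g {x} k eq (suc m) = trans (fold-+ x g k) (trans (cong (λ z → fold z g k) (fold-period g k eq m)) eq)

module PrimeOrder {p : ℕ} (pp : Prime p) {A : Set} (_≟_ : DecidableEquality A)
                  (g : A → A) (gᵖ : ∀ x → fold x g p ≡ x) where

  private instance
    p≢0 : NonZero p
    p≢0 = prime⇒nonZero pp

  g-inj : ∀ {x y} → g x ≡ g y → x ≡ y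
  g-inj {x} {y} eq = trans (sym (to-x x)) (trans (cong (λ z → fold z g (pred p)) eq) (to-x y))
    where
    to-x : ∀ z → fold (g z) g (pred p) ≡ z
    to-x z = trans (sym (fold-suc g z (pred p))) (trans (cong (fold z g) (suc-pred p)) (gᵖ z))

  -- As k is prime to p, Bézout makes a multiple of k and a multiple of p differ by 1; iterating `g`
  -- along either multiple returns to x.
  fixed-of-period : ∀ {x} k → .{{NonZero k}} → k < p → fold x g k ≡ x → g x ≡ x
  fixed-of-period {x} k k<p eq with coprime-Bézout (prime⇒coprime pp k<p)
  ... | Bézout.+- a b e = trans (cong g (sym (fold-period g k eq b))) (trans (cong (fold x g) e) (fold-period g p (gᵖ x) a))
  ... | Bézout.-+ a b e = trans (cong g (sym (fold-period g p (gᵖ x) a))) (trans (cong (fold x g) e) (fold-period g k eq b))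

  orbit : A → List A
  orbit x = applyUpTo (fold x g) p

  orbit-unique : ∀ {x} → g x ≢ x → Unique (orbit x)
  orbit-unique {x} gx≢x = Uniqueₚ.applyUpTo⁺₁ (fold x g) p distinct
    where
    distinct : ∀ {i j} → i < j → j < p → fold x g i ≢ fold x g j
    distinct {i} {j} i<j j<p eq = gx≢x (fixed-of-period (j ∸ i) {{>-nonZero (m<n⇒0<n∸m i<j)}} (≤-<-trans (m∸n≤m j i) j<p)
      (sym (fold-inj g g-inj i (trans eq (trans (cong (fold x g) (sym (m+[n∸m]≡n (<⇒≤ i<j)))) (fold-+ x g i))))))

  -- Closure under preimages is what keeps the complement of an orbit closed under `g`. The point
  -- before x on its orbit is the iterate with index p - 1.
  orbit-g⁻ : ∀ {x y} → g y ∈ orbit x → y ∈ orbit x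
  orbit-g⁻ {x} {y} gy∈ with ∈-applyUpTo⁻ (fold x g) gy∈
  ... | suc i , i<p , eq = subst (_∈ orbit x) (sym (g-inj eq)) (∈-applyUpTo⁺ (fold x g) (<-trans (n<1+n i) i<p))
  ... | zero , _ , eq = subst (_∈ orbit x)
          (g-inj (trans (cong (fold x g) (suc-pred p)) (trans (gᵖ x) (sym eq))))
          (∈-applyUpTo⁺ (fold x g) (≤-reflexive (suc-pred p)))

  orbit⊆ : ∀ {xs x} → (∀ {y} → y ∈ xs → g y ∈ xs) → x ∈ xs → ∀ i → fold x g i ∈ xs
  orbit⊆ cl x∈ zero = x∈
  orbit⊆ cl x∈ (suc i) = cl (orbit⊆ cl x∈ i)

  private
    _∈?_ = mem? _≟_

  -- Orbits are removed one at a time; since p is prime and no point is fixed, each has exactly p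
  -- members.
  ∣-length-of-free : (xs : List A) → Unique xs → (∀ {x} → x ∈ xs → g x ∈ xs) →
    (∀ {x} → x ∈ xs → g x ≢ x) → p ∣ length xs
  ∣-length-of-free xs = go xs (<-wellFounded (length xs))
    where
    go : ∀ xs → Acc _<_ (length xs) → Unique xs → (∀ {x} → x ∈ xs → g x ∈ xs) → (∀ {x} → x ∈ xs → g x ≢ x) → p ∣ length xs
    go [] _ _ _ _ = p ∣0
    go xs@(x ∷ _) (acc rs) u cl nf =
      subst (p ∣_) (sym (length-filter-split (_∈? orbit x) xs))
        (∣m∣n⇒∣m+n (subst (p ∣_) (sym |orbit|) ∣-refl)
          (go rest (rs (filter-notAll (¬? ∘ (_∈? orbit x)) xs (here (λ ¬o → ¬o (∈-applyUpTo⁺ (fold x g) (>-nonZero⁻¹ p))))))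
            (Uniqueₚ.filter⁺ (¬? ∘ (_∈? orbit x)) u)
            (λ y∈ → let y∈xs , y∉o = ∈-filter⁻ (¬? ∘ (_∈? orbit x)) {xs = xs} y∈ in
                    ∈-filter⁺ (¬? ∘ (_∈? orbit x)) (cl y∈xs) (y∉o ∘ orbit-g⁻))
            (λ y∈ → nf (proj₁ (∈-filter⁻ (¬? ∘ (_∈? orbit x)) {xs = xs} y∈)))))
      where
      rest = filter (¬? ∘ (_∈? orbit x)) xs
      |orbit| : length (filter (_∈? orbit x) xs) ≡ p
      |orbit| = trans (length-≡-of-⊆⊇ (Uniqueₚ.filter⁺ (_∈? orbit x) u) (orbit-unique (nf (here refl)))
          (λ y∈ → proj₂ (∈-filter⁻ (_∈? orbit x) {xs = xs} y∈))
          (λ y∈ → ∈-filter⁺ (_∈? orbit x) (let i , _ , eq = ∈-applyUpTo⁻ (fold x g) y∈ in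
                    subst (_∈ xs) (sym eq) (orbit⊆ cl (here refl) i)) y∈))
        (length-applyUpTo (fold x g) p)

  fixed : List A → List A
  fixed = filter (λ x → g x ≟ x)

  ∣-nonfixed : ∀ {xs} → Unique xs → (∀ {x} → x ∈ xs → g x ∈ xs) → p ∣ length (filter (λ x → ¬? (g x ≟ x)) xs)
  ∣-nonfixed {xs} u cl = ∣-length-of-free _ (Uniqueₚ.filter⁺ _ u)
    (λ x∈ → let x∈xs , nx = ∈-filter⁻ (λ x → ¬? (g x ≟ x)) {xs = xs} x∈ in
            ∈-filter⁺ (λ x → ¬? (g x ≟ x)) (cl x∈xs) (nx ∘ g-inj))
    (λ x∈ → proj₂ (∈-filter⁻ (λ x → ¬? (g x ≟ x)) {xs = xs} x∈))

  ∣-of-∣-fixed : ∀ {xs} → Unique xs → (∀ {x} → x ∈ xs → g x ∈ xs) → p ∣ length (fixed xs) → p ∣ length xs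
  ∣-of-∣-fixed {xs} u cl d = subst (p ∣_) (sym (length-filter-split (λ x → g x ≟ x) xs)) (∣m∣n⇒∣m+n d (∣-nonfixed u cl))

  ∣-fixed-of-∣ : ∀ {xs} → Unique xs → (∀ {x} → x ∈ xs → g x ∈ xs) → p ∣ length xs → p ∣ length (fixed xs)
  ∣-fixed-of-∣ {xs} u cl d = ∣m+n∣m⇒∣n {n = length (fixed xs)}
    (subst (p ∣_) (trans (length-filter-split (λ x → g x ≟ x) xs) (+-comm (length (fixed xs)) _)) d) (∣-nonfixed u cl)

module CommonFixedPoints {p : ℕ} (pp : Prime p) {A : Set} (_≟_ : DecidableEquality A) where

  -- The fixed points of one map are congruent in number to the whole set modulo p, and the other
  -- maps permute them because everything commutes. This is the fixed point theorem for an
  -- elementary abelian p-group given by generators.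
  common-fixed-point : {I : Set} (is : List I) (g : I → A → A) → (∀ i x → fold x (g i) p ≡ x) →
    (∀ i j x → g i (g j x) ≡ g j (g i x)) →
    (xs : List A) → Unique xs → (∀ i {x} → x ∈ xs → g i x ∈ xs) → ¬ p ∣ length xs →
    Σ A λ x → x ∈ xs × (∀ {i} → i ∈ is → g i x ≡ x)
  common-fixed-point [] g gᵖ comm [] u cl ¬p∣ = ⊥-elim (¬p∣ (p ∣0))
  common-fixed-point [] g gᵖ comm (x ∷ xs) u cl ¬p∣ = x , here refl , λ ()
  common-fixed-point (i ∷ is) g gᵖ comm xs u cl ¬p∣ =
    let open PrimeOrder pp _≟_ (g i) (gᵖ i)
        x , x∈ , fx = common-fixed-point is g gᵖ comm (fixed xs) (Uniqueₚ.filter⁺ _ u)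
          (λ j {x} x∈ → let x∈xs , gx = ∈-filter⁻ (λ x → g i x ≟ x) {xs = xs} x∈ in
            ∈-filter⁺ (λ x → g i x ≟ x) (cl j x∈xs) (trans (comm i j x) (cong (g j) gx)))
          (¬p∣ ∘ ∣-of-∣-fixed u (cl i))
        x∈xs , gx = ∈-filter⁻ (λ x → g i x ≟ x) {xs = xs} x∈
    in x , x∈xs , λ { (here refl) → gx ; (there j∈) → fx j∈ }

  module _ (_~_ : A → A → Set) (~-refl : ∀ {x} → x ~ x) (~-sym : ∀ {x y} → x ~ y → y ~ x)
           (~-trans : ∀ {x y z} → x ~ y → y ~ z → x ~ z) (_~?_ : ∀ x y → Dec (x ~ y)) where

    -- If p divided the size of every class, it would divide the sum of these sizes; so classes of
    -- divisible size are discarded until another kind turns up.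
    class-of-indivisible-size : (xs : List A) → Unique xs → ¬ p ∣ length xs →
      Σ (List A) λ cs → Unique cs × ¬ p ∣ length cs × (∀ {c} → c ∈ cs → c ∈ xs) ×
        (∀ {c d} → c ∈ cs → d ∈ cs → c ~ d) × (∀ {c x} → c ∈ cs → x ∈ xs → c ~ x → x ∈ cs)
    class-of-indivisible-size xs = go xs (<-wellFounded (length xs))
      where
      go : ∀ xs → Acc _<_ (length xs) → Unique xs → ¬ p ∣ length xs →
        Σ (List A) λ cs → Unique cs × ¬ p ∣ length cs × (∀ {c} → c ∈ cs → c ∈ xs) ×
        (∀ {c d} → c ∈ cs → d ∈ cs → c ~ d) × (∀ {c x} → c ∈ cs → x ∈ xs → c ~ x → x ∈ cs)
      go [] _ u ¬p∣ = ⊥-elim (¬p∣ (p ∣0))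
      go xs@(x ∷ _) (acc rs) u ¬p∣ with p ∣? length (filter (x ~?_) xs)
      ... | no ¬d = filter (x ~?_) xs , Uniqueₚ.filter⁺ (x ~?_) u , ¬d , proj₁ ∘ ∈-filter⁻ (x ~?_) {xs = xs} ,
                    (λ c∈ d∈ → ~-trans (~-sym (proj₂ (∈-filter⁻ (x ~?_) {xs = xs} c∈))) (proj₂ (∈-filter⁻ (x ~?_) {xs = xs} d∈))) ,
                    λ c∈ y∈ c~y → ∈-filter⁺ (x ~?_) y∈ (~-trans (proj₂ (∈-filter⁻ (x ~?_) {xs = xs} c∈)) c~y)
      ... | yes d =
        let rest = filter (¬? ∘ (x ~?_)) xs
            cs , ucs , ¬pcs , sub , rel , cl = go rest (rs (filter-notAll (¬? ∘ (x ~?_)) xs (here (λ ¬x → ¬x ~-refl)))) (Uniqueₚ.filter⁺ (¬? ∘ (x ~?_)) u)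
              (λ d′ → ¬p∣ (subst (p ∣_) (sym (length-filter-split (x ~?_) xs)) (∣m∣n⇒∣m+n d d′)))
        in cs , ucs , ¬pcs , proj₁ ∘ ∈-filter⁻ (¬? ∘ (x ~?_)) {xs = xs} ∘ sub , rel ,
           λ c∈ y∈ c~y → cl c∈ (∈-filter⁺ (¬? ∘ (x ~?_)) y∈
             (λ x~y → proj₂ (∈-filter⁻ (¬? ∘ (x ~?_)) {xs = xs} (sub c∈)) (~-trans x~y (~-sym c~y)))) c~y

-- Sylow conjugacy

module _ {X : Set} where

  choices : ∀ {m} → (Fin m → List X) → List (Vec X m)
  choices {zero} C = [] ∷ []
  choices {suc m} C = cartesianProductWith _∷_ (C zero) (choices (C ∘ suc))

  choices-unique : ∀ {m} (C : Fin m → List X) → (∀ i → Unique (C i)) → Unique (choices C)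
  choices-unique {zero} C u = [] ∷ []
  choices-unique {suc m} C u = Uniqueₚ.cartesianProductWith⁺ _∷_ ∷-injective (u zero) (choices-unique (C ∘ suc) (u ∘ suc))

  ∈-choices⁺ : ∀ {m} (C : Fin m → List X) (t : Vec X m) → (∀ i → lookup t i ∈ C i) → t ∈ choices C
  ∈-choices⁺ C [] h = here refl
  ∈-choices⁺ C (x ∷ t) h = ∈-cartesianProductWith⁺ _∷_ (h zero) (∈-choices⁺ (C ∘ suc) t (h ∘ suc))

  ∈-choices⁻ : ∀ {m} (C : Fin m → List X) (t : Vec X m) → t ∈ choices C → ∀ i → lookup t i ∈ C i
  ∈-choices⁻ C (x ∷ t) t∈ i with ∈-cartesianProductWith⁻ _∷_ (C zero) (choices (C ∘ suc)) t∈
  ∈-choices⁻ C (x ∷ t) t∈ zero | _ , _ , x∈ , _ , refl = x∈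
  ∈-choices⁻ C (x ∷ t) t∈ (suc i) | _ , _ , _ , t∈′ , refl = ∈-choices⁻ (C ∘ suc) t t∈′ i

  length-cartesianProductWith : ∀ {Y Z : Set} (f : X → Y → Z) (xs : List X) (ys : List Y) →
    length (cartesianProductWith f xs ys) ≡ length xs * length ys
  length-cartesianProductWith f [] ys = refl
  length-cartesianProductWith f (x ∷ xs) ys = trans (length-++ (map (f x) ys))
    (cong₂ _+_ (length-map (f x) ys) (length-cartesianProductWith f xs ys))

  choices-indivisible : ∀ {p m} → Prime p → (C : Fin m → List X) → (∀ i → ¬ p ∣ length (C i)) → ¬ p ∣ length (choices C)
  choices-indivisible {p} {zero} pp C h d = ¬prime[1] (subst Prime (∣1⇒≡1 d) pp)
  choices-indivisible {p} {suc m} pp C h d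
    with euclidsLemma (length (C zero)) _ pp (subst (p ∣_) (length-cartesianProductWith _∷_ (C zero) _) d)
  ... | inj₁ d₁ = h zero d₁
  ... | inj₂ d₂ = choices-indivisible pp (C ∘ suc) (h ∘ suc) d₂

  -- Lets finitely many instances of excluded middle be assumed together while a negation is being
  -- proved.
  ¬¬-All : {P : X → Set} → (∀ x → ¬ ¬ P x) → ∀ xs → ¬ ¬ All P xs
  ¬¬-All h [] k = k []
  ¬¬-All h (x ∷ xs) k = h x (λ px → ¬¬-All h xs (λ pxs → k (px ∷ pxs)))

-- `Elem a b` is data rather than a mere property: in both applications it carries a symmetry of S
-- on the full space lying above `a`, so that a conjugator found on a quotient comes with its lift.
record PermGroup (X : Set) : Set₁ where
  field
    Elem   : (X → X) → (X → X) → Set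
    invˡ   : ∀ {a b} → Elem a b → ∀ x → b (a x) ≡ x
    elem-id   : Elem id id
    elem-inv  : ∀ {a b} → Elem a b → Elem b a
    elem-∘    : ∀ {a b c d} → Elem a b → Elem c d → Elem (a ∘ c) (d ∘ b)
  invʳ : ∀ {a b} → Elem a b → ∀ x → a (b x) ≡ x
  invʳ e = invˡ (elem-inv e)

-- Generators of an elementary abelian p-subgroup, the only p-groups that have to act.
record CommutingFamily {X : Set} (p : ℕ) (𝒢 : PermGroup X) : Set₁ where
  open PermGroup 𝒢
  field
    I       : Set
    indices : List I
    γ γ⁻    : I → X → X
    elem    : ∀ i → Elem (γ i) (γ⁻ i)
    order   : ∀ i x → fold x (γ i) p ≡ x
    comm    : ∀ i j x → γ i (γ j x) ≡ γ j (γ i x)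

  γ-inj : ∀ i {x y} → γ i x ≡ γ i y → x ≡ y
  γ-inj i eq = trans (sym (invˡ (elem i) _)) (trans (cong (γ⁻ i) eq) (invˡ (elem i) _))

  order⁻ : ∀ i x → fold x (γ⁻ i) p ≡ x
  order⁻ i x = trans (sym (order i _)) (cancel p x)
    where
    cancel : ∀ k y → fold (fold y (γ⁻ i) k) (γ i) k ≡ y
    cancel zero y = refl
    cancel (suc k) y = trans (fold-suc (γ i) _ k) (trans (cong (λ z → fold z (γ i) k) (invʳ (elem i) _)) (cancel k y))

  comm⁻ : ∀ i j x → γ⁻ i (γ⁻ j x) ≡ γ⁻ j (γ⁻ i x)
  comm⁻ i j x = γ-inj j (γ-inj i (begin
    γ i (γ j (γ⁻ i (γ⁻ j x)))  ≡⟨ comm i j _ ⟩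
    γ j (γ i (γ⁻ i (γ⁻ j x)))  ≡⟨ cong (γ j) (invʳ (elem i) _) ⟩
    γ j (γ⁻ j x)   ≡⟨ invʳ (elem j) x ⟩
    x   ≡⟨ sym (invʳ (elem i) x) ⟩
    γ i (γ⁻ i x)   ≡⟨ cong (γ i) (sym (invʳ (elem j) _)) ⟩
    γ i (γ j (γ⁻ j (γ⁻ i x)))  ∎))
    where open ≡-Reasoning

-- The maps y with x ≢ y x R x are permuted by the group; their number is prime to p because ρ shows that
-- every R-class has size divisible by p.
module SylowConjugacy
  {p : ℕ} (pp : Prime p) {X : Set} (_≟_ : DecidableEquality X) {n : ℕ} (X↔Fin : X ↔ Fin n)
  (_R_ : X → X → Set) (R-refl : ∀ {x} → x R x) (R-trans : ∀ {x y z} → x R y → y R z → x R z)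
  (_R?_ : ∀ x y → Dec (x R y))
  (ρ : X → X) (ρᵖ : ∀ x → fold x ρ p ≡ x) (ρ≢ : ∀ x → ρ x ≢ x) (ρR : ∀ x → ρ x R x)
  (𝒢 : PermGroup X) (R-elem : ∀ {a b} → PermGroup.Elem 𝒢 a b → ∀ {x y} → x R y → a x R a y)
  where

  open PermGroup 𝒢

  private
    to = Inverse.to X↔Fin
    from = Inverse.from X↔Fin
    from-to : ∀ x → from (to x) ≡ x
    from-to = Inverse.strictlyInverseʳ X↔Fin
    to-from : ∀ i → to (from i) ≡ i
    to-from = Inverse.strictlyInverseˡ X↔Fin

    app : Vec X n → X → X
    app t x = lookup t (to x)

    tab : (X → X) → Vec X n
    tab y = tabulate (y ∘ from)

    app-tab : ∀ y x → app (tab y) x ≡ y x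
    app-tab y x = trans (lookup∘tabulate _ (to x)) (cong y (from-to x))

    tab-app : ∀ t → tab (app t) ≡ t
    tab-app t = trans (tabulate-cong (λ i → cong (lookup t) (to-from i))) (tabulate∘lookup t)

    tab-cong : ∀ {y z : X → X} → (∀ x → y x ≡ z x) → tab y ≡ tab z
    tab-cong h = tabulate-cong (λ i → h (from i))

    points : List X
    points = map from (allFin n)

    points-unique : Unique points
    points-unique = Uniqueₚ.map⁺ (λ eq → trans (sym (to-from _)) (trans (cong to eq) (to-from _))) (Uniqueₚ.allFin⁺ n)

    ∈-points : ∀ x → x ∈ points
    ∈-points x = subst (_∈ points) (from-to x) (∈-map⁺ from (∈-allFin (to x)))

    block : X → List X
    block x = filter (_R? x) points

    block-unique : ∀ x → Unique (block x)
    block-unique x = Uniqueₚ.filter⁺ _ points-unique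

    p∣block : ∀ x → p ∣ length (block x)
    p∣block x = PrimeOrder.∣-length-of-free pp _≟_ ρ ρᵖ (block x) (block-unique x)
      (λ {y} y∈ → ∈-filter⁺ (_R? x) (∈-points (ρ y)) (R-trans (ρR y) (proj₂ (∈-filter⁻ (_R? x) {xs = points} y∈))))
      (λ _ → ρ≢ _)

    nbrs : X → List X
    nbrs x = filter (¬? ∘ (_≟ x)) (block x)

    -- A block has size 0 modulo p, and leaving out x itself makes that -1.
    nbrs-indivisible : ∀ x → ¬ p ∣ length (nbrs x)
    nbrs-indivisible x d = ¬prime[1] (subst Prime (∣1⇒≡1 (∣m+n∣m⇒∣n (subst (p ∣_) eq (p∣block x)) d)) pp)
      where
      one : length (filter (_≟ x) (block x)) ≡ 1
      one = length-≡-of-⊆⊇ {ys = x ∷ []} (Uniqueₚ.filter⁺ (_≟ x) (block-unique x)) ([] ∷ [])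
        (λ y∈ → here (proj₂ (∈-filter⁻ (_≟ x) {xs = block x} y∈)))
        (λ { (here refl) → ∈-filter⁺ (_≟ x) (∈-filter⁺ (_R? x) (∈-points x) R-refl) refl })
      eq : length (block x) ≡ length (nbrs x) + 1
      eq = trans (length-filter-split (_≟ x) (block x)) (trans (cong (_+ length (nbrs x)) one) (+-comm 1 (length (nbrs x))))

    ∈-nbrs⁺ : ∀ {x y} → y R x → y ≢ x → y ∈ nbrs x
    ∈-nbrs⁺ r ne = ∈-filter⁺ (¬? ∘ (_≟ _)) (∈-filter⁺ (_R? _) (∈-points _) r) ne

    ∈-nbrs⁻ : ∀ {x y} → y ∈ nbrs x → y R x × y ≢ x
    ∈-nbrs⁻ {x} y∈ = let y∈b , ne = ∈-filter⁻ (¬? ∘ (_≟ x)) {xs = block x} y∈ in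
                     proj₂ (∈-filter⁻ (_R? x) {xs = points} y∈b) , ne

    Ω : List (Vec X n)
    Ω = choices (nbrs ∘ from)

    Valid : (X → X) → Set
    Valid y = ∀ x → y x R x × y x ≢ x

    valid-of-∈ : ∀ {t} → t ∈ Ω → Valid (app t)
    valid-of-∈ {t} t∈ x with ∈-nbrs⁻ (∈-choices⁻ _ t t∈ (to x))
    ... | h rewrite from-to x = h

    ∈-of-valid : ∀ y → Valid y → tab y ∈ Ω
    ∈-of-valid y v = ∈-choices⁺ _ (tab y) (λ i → subst (_∈ nbrs (from i)) (sym (lookup∘tabulate _ i))
      (let r , ne = v (from i) in ∈-nbrs⁺ r ne))

    _≟ₜ_ : DecidableEquality (Vec X n)
    _≟ₜ_ = ≡-dec _≟_

    act : (X → X) → (X → X) → Vec X n → Vec X n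
    act a b t = tab (λ x → a (app t (b x)))

    app-act : ∀ a b t x → app (act a b t) x ≡ a (app t (b x))
    app-act a b t = app-tab (λ x → a (app t (b x)))

    act-∈ : ∀ {a b} → Elem a b → ∀ {t} → t ∈ Ω → act a b t ∈ Ω
    act-∈ {a} {b} e {t} t∈ = ∈-of-valid _ (λ x → let r , ne = valid-of-∈ {t} t∈ (b x) in
      subst (a (app t (b x)) R_) (invʳ e x) (R-elem e r) ,
      λ eq → ne (trans (sym (invˡ e _)) (cong b eq)))

    _~_ : Vec X n → Vec X n → Set
    s ~ t = Σ (X → X) λ a → Σ (X → X) λ b → Elem a b × (∀ x → app t (a x) ≡ a (app s x))

    ~-refl : ∀ {t} → t ~ t
    ~-refl = id , id , elem-id , λ _ → refl

    ~-sym : ∀ {s t} → s ~ t → t ~ s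
    ~-sym {s} {t} (a , b , e , h) = b , a , elem-inv e , λ x →
      trans (sym (invˡ e _)) (cong b (trans (sym (h (b x))) (cong (app t) (invʳ e x))))

    ~-trans : ∀ {r s t} → r ~ s → s ~ t → r ~ t
    ~-trans (a , b , e , h) (c , d , e′ , h′) = c ∘ a , b ∘ d , elem-∘ e′ e , λ x → trans (h′ (a x)) (cong c (h x))

    act-~ : ∀ {a b} → Elem a b → ∀ t → t ~ act a b t
    act-~ {a} {b} e t = a , b , e , λ x → trans (app-act a b t (a x)) (cong (a ∘ app t) (invˡ e x))

    -- Conjugacy is only needed between members of Ω, where its decidability is available up to ¬¬.
    _≈_ : Vec X n → Vec X n → Set
    s ≈ t = s ≡ t ⊎ (s ∈ Ω × t ∈ Ω × s ~ t)

    ≈⇒~ : ∀ {s t} → s ≈ t → s ~ t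
    ≈⇒~ {s} (inj₁ refl) = ~-refl {s}
    ≈⇒~ (inj₂ (_ , _ , h)) = h

    ≈-sym : ∀ {s t} → s ≈ t → t ≈ s
    ≈-sym (inj₁ eq) = inj₁ (sym eq)
    ≈-sym {s} {t} (inj₂ (s∈ , t∈ , h)) = inj₂ (t∈ , s∈ , ~-sym {s} {t} h)

    ≈-trans : ∀ {r s t} → r ≈ s → s ≈ t → r ≈ t
    ≈-trans (inj₁ refl) h = h
    ≈-trans h (inj₁ refl) = h
    ≈-trans {r} {s} {t} (inj₂ (r∈ , _ , h)) (inj₂ (_ , t∈ , h′)) = inj₂ (r∈ , t∈ , ~-trans {r} {s} {t} h h′)

    _∈?_ = mem? _≟ₜ_

    ≈-dec : All (λ s → All (λ t → Dec (s ~ t)) Ω) Ω → ∀ s t → Dec (s ≈ t)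
    ≈-dec D s t with s ≟ₜ t
    ... | yes eq = yes (inj₁ eq)
    ... | no ne with s ∈? Ω | t ∈? Ω
    ... | no s∉ | _ = no λ { (inj₁ eq) → ne eq ; (inj₂ (s∈ , _)) → s∉ s∈ }
    ... | yes s∈ | no t∉ = no λ { (inj₁ eq) → ne eq ; (inj₂ (_ , t∈ , _)) → t∉ t∈ }
    ... | yes s∈ | yes t∈ with All.lookup (All.lookup D s∈) t∈
    ... | yes h = yes (inj₂ (s∈ , t∈ , h))
    ... | no ¬h = no λ { (inj₁ eq) → ne eq ; (inj₂ (_ , _ , h)) → ¬h h }

  module _ (F : CommutingFamily p 𝒢) where
    open CommutingFamily F
    private
      act-fold : ∀ i k t → fold t (act (γ i) (γ⁻ i)) k ≡ tab (λ x → fold (app t (fold x (γ⁻ i) k)) (γ i) k)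
      act-fold i zero t = sym (tab-app t)
      act-fold i (suc k) t = tab-cong λ x → cong (γ i) (trans (cong (λ s → app s (γ⁻ i x)) (act-fold i k t))
        (trans (app-tab (λ x → fold (app t (fold x (γ⁻ i) k)) (γ i) k) (γ⁻ i x)) (cong (λ z → fold (app t z) (γ i) k) (sym (fold-suc (γ⁻ i) x k)))))

      act-order : ∀ i t → fold t (act (γ i) (γ⁻ i)) p ≡ t
      act-order i t = trans (act-fold i p t) (trans (tab-cong (λ x → trans (order i _) (cong (app t) (order⁻ i x)))) (tab-app t))

      act-comm : ∀ i j t → act (γ i) (γ⁻ i) (act (γ j) (γ⁻ j) t) ≡ act (γ j) (γ⁻ j) (act (γ i) (γ⁻ i) t)
      act-comm i j t = tab-cong λ x → begin
        γ i (app (act (γ j) (γ⁻ j) t) (γ⁻ i x))  ≡⟨ cong (γ i) (app-act (γ j) (γ⁻ j) t (γ⁻ i x)) ⟩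
        γ i (γ j (app t (γ⁻ j (γ⁻ i x))))   ≡⟨ comm i j _ ⟩
        γ j (γ i (app t (γ⁻ j (γ⁻ i x))))   ≡⟨ cong (γ j ∘ γ i ∘ app t) (comm⁻ j i x) ⟩
        γ j (γ i (app t (γ⁻ i (γ⁻ j x))))   ≡⟨ cong (γ j) (sym (app-act (γ i) (γ⁻ i) t (γ⁻ j x))) ⟩
        γ j (app (act (γ i) (γ⁻ i) t) (γ⁻ j x))  ∎
        where open ≡-Reasoning

    Centralizes : (X → X) → Set
    Centralizes y = ∀ {i} → i ∈ indices → ∀ x → y (γ i x) ≡ γ i (y x)

    -- To be fixed under conjugation by `γ i` is to commute with `γ i`. A conjugacy class is stable
    -- under these conjugations, so the fixed point theorem applies inside it.
    fixed-in-class : ∀ cs → Unique cs → ¬ p ∣ length cs → (∀ {c} → c ∈ cs → c ∈ Ω) →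
      (∀ {c x} → c ∈ cs → x ∈ Ω → c ≈ x → x ∈ cs) → Σ (Vec X n) λ t → t ∈ cs × Centralizes (app t)
    fixed-in-class cs u ¬p sub cl =
      let t , t∈ , fx = CommonFixedPoints.common-fixed-point pp _≟ₜ_ indices (λ i → act (γ i) (γ⁻ i)) act-order act-comm cs u
            (λ i {s} s∈ → cl s∈ (act-∈ (elem i) (sub s∈)) (inj₂ (sub s∈ , act-∈ (elem i) (sub s∈) , act-~ (elem i) s))) ¬p
      in t , t∈ , λ {i} i∈ x → trans (cong (λ s → app s (γ i x)) (sym (fx i∈)))
           (trans (app-act (γ i) (γ⁻ i) t (γ i x)) (cong (γ i ∘ app t) (invˡ (elem i) x)))

  -- Ω has size prime to p, hence so has one of its orbits; both families have a fixed point on that orbit.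
  conjugate-centralized : (F F′ : CommutingFamily p 𝒢) → ¬ ¬ (
    Σ (X → X) λ y → Σ (X → X) λ y′ → Valid y × Valid y′ × Centralizes F y × Centralizes F′ y′ ×
    Σ (X → X) λ a → Σ (X → X) λ b → Elem a b × (∀ x → y′ (a x) ≡ a (y x)))
  conjugate-centralized F F′ k =
    ¬¬-All (λ s → ¬¬-All (λ t → ¬¬-excluded-middle) Ω) Ω λ D →
    let cs , u , ¬p , sub , rel , cl = CommonFixedPoints.class-of-indivisible-size pp _≟ₜ_ _≈_ (inj₁ refl) ≈-sym ≈-trans
          (≈-dec D) Ω (choices-unique (nbrs ∘ from) (λ i → Uniqueₚ.filter⁺ _ (block-unique _)))
          (choices-indivisible pp (nbrs ∘ from) (λ i → nbrs-indivisible (from i)))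
        s , s∈ , cs-s = fixed-in-class F cs u ¬p sub cl
        t , t∈ , cs-t = fixed-in-class F′ cs u ¬p sub cl
        a , b , e , h = ≈⇒~ (rel s∈ t∈)
    in k (app s , app t , valid-of-∈ (sub s∈) , valid-of-∈ (sub t∈) , cs-s , cs-t , a , b , e , h)

-- Cyclic and elementary abelian groups

odd-prime : ∀ {p} → Prime p → p ≢ 2 → p ≡ 1 + p / 2 * 2
odd-prime {p} pp p≢2 = by-remainder (p % 2) refl
  where
  by-remainder : ∀ r → p % 2 ≡ r → p ≡ 1 + p / 2 * 2
  by-remainder zero eq with prime⇒irreducible pp {2} (divides (p / 2) (trans (m≡m%n+[m/n]*n p 2) (cong (_+ p / 2 * 2) eq)))
  ... | inj₂ 2≡p = ⊥-elim (p≢2 (sym 2≡p))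
  by-remainder (suc zero) eq = trans (m≡m%n+[m/n]*n p 2) (cong (_+ p / 2 * 2) eq)
  by-remainder (suc (suc r)) eq with s≤s (s≤s ()) ← subst (_< 2) eq (m%n<n p 2)

module CyclicGroup (n : ℕ) where

  private p = suc n

  [_] : ℕ → Fin p
  [ a ] = a mod p

  toℕ-[] : ∀ a → toℕ [ a ] ≡ a % p
  toℕ-[] a = toℕ-fromℕ< (m%n<n a p)

  []-cong : ∀ a b → a % p ≡ b % p → [ a ] ≡ [ b ]
  []-cong a b eq = toℕ-injective (trans (toℕ-[] a) (trans eq (sym (toℕ-[] b))))

  []-toℕ : ∀ t → [ toℕ t ] ≡ t
  []-toℕ t = toℕ-injective (trans (toℕ-[] (toℕ t)) (m<n⇒m%n≡m (toℕ<n t)))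

  []-+ : ∀ a b → addC [ a ] [ b ] ≡ [ a + b ]
  []-+ a b = []-cong (toℕ [ a ] + toℕ [ b ]) (a + b) (begin
    (toℕ [ a ] + toℕ [ b ]) % p  ≡⟨ cong₂ (λ u v → (u + v) % p) (toℕ-[] a) (toℕ-[] b) ⟩
    (a % p + b % p) % p   ≡⟨ sym (%-distribˡ-+ a b p) ⟩
    (a + b) % p   ∎)
    where open ≡-Reasoning

  infixr 8 _·_
  _·_ : ℕ → Fin p → Fin p
  m · t = [ m * toℕ t ]

  []-· : ∀ m a → m · [ a ] ≡ [ m * a ]
  []-· m a = []-cong (m * toℕ [ a ]) (m * a) (begin
    (m * toℕ [ a ]) % p   ≡⟨ cong (λ u → (m * u) % p) (toℕ-[] a) ⟩
    (m * (a % p)) % p   ≡⟨ %-distribˡ-* m (a % p) p ⟩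
    (m % p * (a % p % p)) % p   ≡⟨ cong (λ u → (m % p * u) % p) (m%n%n≡m%n a p) ⟩
    (m % p * (a % p)) % p   ≡⟨ sym (%-distribˡ-* m a p) ⟩
    (m * a) % p   ∎)
    where open ≡-Reasoning

  []-multiple : ∀ k → [ k * p ] ≡ zero
  []-multiple k = []-cong (k * p) 0 (m*n%n≡0 k p)

  []-pred : ∀ (t : Fin p) → [ n * toℕ t + toℕ t ] ≡ zero
  []-pred t = trans (cong [_] (trans (+-comm (n * toℕ t) (toℕ t)) (*-comm p (toℕ t)))) ([]-multiple (toℕ t))

  -- Here `n` is p - 1, which is -1 modulo p.
  negC : Fin p → Fin p
  negC t = n · t

  subC : Fin p → Fin p → Fin p
  subC s t = addC s (negC t)

  addC-comm : ∀ s t → addC s t ≡ addC t s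
  addC-comm s t = cong [_] (+-comm (toℕ s) (toℕ t))

  addC-assoc : ∀ s t u → addC (addC s t) u ≡ addC s (addC t u)
  addC-assoc s t u = begin
    addC (addC s t) u   ≡⟨ cong (addC (addC s t)) (sym ([]-toℕ u)) ⟩
    addC [ toℕ s + toℕ t ] [ toℕ u ]   ≡⟨ []-+ (toℕ s + toℕ t) (toℕ u) ⟩
    [ toℕ s + toℕ t + toℕ u ]   ≡⟨ cong [_] (+-assoc (toℕ s) (toℕ t) (toℕ u)) ⟩
    [ toℕ s + (toℕ t + toℕ u) ]   ≡⟨ sym ([]-+ (toℕ s) (toℕ t + toℕ u)) ⟩
    addC [ toℕ s ] (addC t u)   ≡⟨ cong (λ v → addC v (addC t u)) ([]-toℕ s) ⟩
    addC s (addC t u)   ∎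
    where open ≡-Reasoning

  addC-zeroʳ : ∀ t → addC t zero ≡ t
  addC-zeroʳ t = trans (cong [_] (+-identityʳ (toℕ t))) ([]-toℕ t)

  addC-zeroˡ : ∀ t → addC zero t ≡ t
  addC-zeroˡ t = trans (addC-comm zero t) (addC-zeroʳ t)

  negC-inverseˡ : ∀ t → addC (negC t) t ≡ zero
  negC-inverseˡ t = trans (cong (addC (negC t)) (sym ([]-toℕ t))) (trans ([]-+ (n * toℕ t) (toℕ t)) ([]-pred t))

  negC-inverseʳ : ∀ t → addC t (negC t) ≡ zero
  negC-inverseʳ t = trans (addC-comm t (negC t)) (negC-inverseˡ t)

  addC-subC : ∀ s t → addC (subC s t) t ≡ s
  addC-subC s t = trans (addC-assoc s (negC t) t) (trans (cong (addC s) (negC-inverseˡ t)) (addC-zeroʳ s))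

  subC-addC : ∀ s t → subC (addC s t) t ≡ s
  subC-addC s t = trans (addC-assoc s t (negC t)) (trans (cong (addC s) (negC-inverseʳ t)) (addC-zeroʳ s))

  addC-cancelʳ : ∀ {s t} u → addC s u ≡ addC t u → s ≡ t
  addC-cancelʳ {s} {t} u eq = trans (sym (subC-addC s u)) (trans (cong (λ v → subC v u) eq) (subC-addC t u))

  subC-of-addC : ∀ {s t u} → addC s t ≡ u → s ≡ subC u t
  subC-of-addC {s} {t} eq = trans (sym (subC-addC s t)) (cong (λ v → subC v t) eq)

  subC-self : ∀ t → subC t t ≡ zero
  subC-self = negC-inverseʳ

  subC-zeroʳ : ∀ t → subC t zero ≡ t
  subC-zeroʳ t = sym (subC-of-addC (addC-zeroʳ t))

  addC-swap : ∀ s t u → addC (addC s t) u ≡ addC (addC s u) t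
  addC-swap s t u = trans (addC-assoc s t u) (trans (cong (addC s) (addC-comm t u)) (sym (addC-assoc s u t)))

  subC-translate : ∀ s t u → subC (addC s u) (addC t u) ≡ subC s t
  subC-translate s t u = sym (subC-of-addC (trans (sym (addC-assoc (subC s t) t u)) (cong (λ v → addC v u) (addC-subC s t))))

  ·-zeroʳ : ∀ m → m · zero ≡ zero
  ·-zeroʳ m = cong [_] (*-zeroʳ m)

  ·-identity : ∀ t → 1 · t ≡ t
  ·-identity t = trans (cong [_] (*-identityˡ (toℕ t))) ([]-toℕ t)

  ·-+ : ∀ m k t → (m + k) · t ≡ addC (m · t) (k · t)
  ·-+ m k t = trans (cong [_] (*-distribʳ-+ (toℕ t) m k)) (sym ([]-+ (m * toℕ t) (k * toℕ t)))

  ·-suc : ∀ m t → suc m · t ≡ addC t (m · t)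
  ·-suc m t = trans (·-+ 1 m t) (cong (λ u → addC u (m · t)) (·-identity t))

  ·-* : ∀ m k t → (m * k) · t ≡ m · k · t
  ·-* m k t = trans (cong [_] (*-assoc m k (toℕ t))) (sym ([]-· m (k * toℕ t)))

  ·-addC : ∀ m s t → m · addC s t ≡ addC (m · s) (m · t)
  ·-addC m s t = trans ([]-· m (toℕ s + toℕ t)) (trans (cong [_] (*-distribˡ-+ m (toℕ s) (toℕ t))) (sym ([]-+ (m * toℕ s) (m * toℕ t))))

  ·-subC : ∀ m s t → m · subC s t ≡ subC (m · s) (m · t)
  ·-subC m s t = subC-of-addC (trans (sym (·-addC m (subC s t) t)) (cong (m ·_) (addC-subC s t)))

  ·-order : ∀ t → p · t ≡ zero
  ·-order t = trans (cong [_] (*-comm p (toℕ t))) ([]-multiple (toℕ t))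

  ·-one : ∀ t → toℕ t · [ 1 ] ≡ t
  ·-one t = trans ([]-· (toℕ t) 1) (trans (cong [_] (*-identityʳ (toℕ t))) ([]-toℕ t))

  ·-swap : ∀ m k t → m · k · t ≡ k · m · t
  ·-swap m k t = trans (sym (·-* m k t)) (trans (cong (_· t) (*-comm m k)) (·-* k m t))

  -- A unit modulo p together with its inverse, both as unreduced naturals, so that a composite of
  -- scalings is the plain product.
  record Unit : Set where
    field
      val inv : ℕ
      inv-val : ∀ t → inv · val · t ≡ t
    val-inv : ∀ t → val · inv · t ≡ t
    val-inv t = trans (·-swap val inv t) (inv-val t)

  open Unit

  1ᵤ : Unit
  1ᵤ = record { val = 1 ; inv = 1 ; inv-val = λ t → trans (·-identity (1 · t)) (·-identity t) }

  _⁻¹ᵤ : Unit → Unit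
  u ⁻¹ᵤ = record { val = inv u ; inv = val u ; inv-val = val-inv u }

  _*ᵤ_ : Unit → Unit → Unit
  u *ᵤ v = record { val = val u * val v ; inv = inv v * inv u ; inv-val = λ t →
    trans (·-* (inv v) (inv u) _) (trans (cong (inv v ·_) (trans (cong (inv u ·_) (·-* (val u) (val v) t)) (inv-val u _))) (inv-val v t)) }

  unit-of-nonzero : Prime p → (k : Fin p) → k ≢ zero → Σ Unit λ u → val u ≡ toℕ k
  unit-of-nonzero pp k k≢0 = from-Bézout (coprime-Bézout coprime)
    where
    p∤k : ¬ p ∣ toℕ k
    p∤k (divides zero eq) = k≢0 (toℕ-injective eq)
    p∤k (divides (suc q) eq) = <-irrefl refl (<-≤-trans (toℕ<n k) (subst (p ≤_) (sym eq) (m≤m+n p (q * p))))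
    coprime : Coprime p (toℕ k)
    coprime (d∣p , d∣k) with prime⇒irreducible pp d∣p
    ... | inj₁ d≡1 = d≡1
    ... | inj₂ refl = ⊥-elim (p∤k d∣k)
    from-Bézout : Bézout.Identity 1 p (toℕ k) → Σ Unit λ u → val u ≡ toℕ k
    -- In this case 1 + y k is a multiple of p, so the inverse of k is -y, represented by `n * y`.
    from-Bézout (Bézout.+- x y eq) = record { val = toℕ k ; inv = n * y ; inv-val = λ t → proof t } , refl
      where
      proof : ∀ t → (n * y) · toℕ k · t ≡ t
      proof t = trans (·-* n y _) (sym (trans (sym (addC-zeroʳ t)) (trans (cong (addC t) (sym (negC-inverseʳ yk)))
        (trans (sym (addC-assoc t yk _)) (trans (cong (λ v → addC v (negC yk)) t+yk) (addC-zeroˡ _))))))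
        where
        yk = y · toℕ k · t
        t+yk : addC t yk ≡ zero
        t+yk = trans (cong₂ addC (sym (·-identity t)) (sym (·-* y (toℕ k) t))) (trans (sym (·-+ 1 (y * toℕ k) t))
          (trans (cong (_· t) eq) (trans (·-* x p t) (trans (cong (x ·_) (·-order t)) (·-zeroʳ x)))))
    from-Bézout (Bézout.-+ x y eq) = record { val = toℕ k ; inv = y ; inv-val = λ t →
      trans (sym (·-* y (toℕ k) t)) (trans (cong (_· t) (sym eq)) (trans (·-+ 1 (x * p) t)
        (trans (cong₂ addC (·-identity t) (trans (·-* x p t) (trans (cong (x ·_) (·-order t)) (·-zeroʳ x)))) (addC-zeroʳ t)))) } , refl

infixl 6 _⊕_
_⊕_ : ∀ {n} → Vec (Fin 2) n → Vec (Fin 2) n → Vec (Fin 2) n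
_⊕_ = zipWith addC

𝟎 : ∀ {n} → Vec (Fin 2) n
𝟎 = replicate _ zero

⊕-comm : ∀ {n} (x y : Vec (Fin 2) n) → x ⊕ y ≡ y ⊕ x
⊕-comm [] [] = refl
⊕-comm (a ∷ x) (b ∷ y) = cong₂ _∷_ (CyclicGroup.addC-comm 1 a b) (⊕-comm x y)

⊕-assoc : ∀ {n} (x y z : Vec (Fin 2) n) → (x ⊕ y) ⊕ z ≡ x ⊕ (y ⊕ z)
⊕-assoc [] [] [] = refl
⊕-assoc (a ∷ x) (b ∷ y) (c ∷ z) = cong₂ _∷_ (CyclicGroup.addC-assoc 1 a b c) (⊕-assoc x y z)

⊕-identityʳ : ∀ {n} (x : Vec (Fin 2) n) → x ⊕ 𝟎 ≡ x
⊕-identityʳ [] = refl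
⊕-identityʳ (a ∷ x) = cong₂ _∷_ (CyclicGroup.addC-zeroʳ 1 a) (⊕-identityʳ x)

⊕-identityˡ : ∀ {n} (x : Vec (Fin 2) n) → 𝟎 ⊕ x ≡ x
⊕-identityˡ x = trans (⊕-comm 𝟎 x) (⊕-identityʳ x)

addC-self : (a : Fin 2) → addC a a ≡ zero
addC-self zero = refl
addC-self (suc zero) = refl

⊕-self : ∀ {n} (x : Vec (Fin 2) n) → x ⊕ x ≡ 𝟎
⊕-self [] = refl
⊕-self (a ∷ x) = cong₂ _∷_ (addC-self a) (⊕-self x)

⊕-cancelˡ : ∀ {n} (x y : Vec (Fin 2) n) → x ⊕ (x ⊕ y) ≡ y
⊕-cancelˡ x y = trans (sym (⊕-assoc x x y)) (trans (cong (_⊕ y) (⊕-self x)) (⊕-identityˡ y))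

⊕-cancelʳ : ∀ {n} (x y : Vec (Fin 2) n) → (x ⊕ y) ⊕ y ≡ x
⊕-cancelʳ x y = trans (⊕-assoc x y y) (trans (cong (x ⊕_) (⊕-self y)) (⊕-identityʳ x))

⊕-swap : ∀ {n} (x y z : Vec (Fin 2) n) → (x ⊕ y) ⊕ z ≡ (x ⊕ z) ⊕ y
⊕-swap x y z = trans (⊕-assoc x y z) (trans (cong (x ⊕_) (⊕-comm y z)) (sym (⊕-assoc x z y)))

⊕-interchange : ∀ {n} (x y z w : Vec (Fin 2) n) → (x ⊕ y) ⊕ (z ⊕ w) ≡ (x ⊕ z) ⊕ (y ⊕ w)
⊕-interchange x y z w = trans (sym (⊕-assoc (x ⊕ y) z w)) (trans (cong (_⊕ w) (⊕-swap x y z)) (⊕-assoc (x ⊕ z) y w))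

⊕-translate : ∀ {n} (x y z : Vec (Fin 2) n) → (x ⊕ z) ⊕ (y ⊕ z) ≡ x ⊕ y
⊕-translate x y z = trans (⊕-interchange x z y z) (trans (cong ((x ⊕ y) ⊕_) (⊕-self z)) (⊕-identityʳ (x ⊕ y)))

⊕-≡⇒𝟎 : ∀ {n} {x y : Vec (Fin 2) n} → x ≡ y → x ⊕ y ≡ 𝟎
⊕-≡⇒𝟎 {x = x} refl = ⊕-self x

⊕-𝟎⇒≡ : ∀ {n} {x y : Vec (Fin 2) n} → x ⊕ y ≡ 𝟎 → x ≡ y
⊕-𝟎⇒≡ {x = x} {y} eq = trans (sym (⊕-cancelʳ x y)) (trans (cong (_⊕ y) eq) (⊕-identityˡ y))

-- Linear algebra over F₂

-- dropk i x ≡ dropk i y says that x and y agree modulo the span of the first i coordinate vectors.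
dropk : ∀ {A : Set} {n} (i : ℕ) → Vec A n → Vec A (n ∸ i)
dropk zero x = x
dropk (suc i) [] = []
dropk (suc i) (_ ∷ x) = dropk i x

pad : ∀ {n} (i : ℕ) → Vec (Fin 2) (n ∸ i) → Vec (Fin 2) n
pad zero x = x
pad {zero} (suc i) x = []
pad {suc n} (suc i) x = zero ∷ pad i x

dropk-pad : ∀ {n} i (x : Vec (Fin 2) (n ∸ i)) → dropk i (pad {n} i x) ≡ x
dropk-pad zero x = refl
dropk-pad {zero} (suc i) [] = refl
dropk-pad {suc n} (suc i) x = dropk-pad i x

dropk-⊕ : ∀ {n} i (x y : Vec (Fin 2) n) → dropk i (x ⊕ y) ≡ dropk i x ⊕ dropk i y
dropk-⊕ zero x y = refl
dropk-⊕ (suc i) [] [] = refl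
dropk-⊕ (suc i) (_ ∷ x) (_ ∷ y) = dropk-⊕ i x y

dropk-𝟎 : ∀ {n} i → dropk i (𝟎 {n}) ≡ 𝟎
dropk-𝟎 zero = refl
dropk-𝟎 {zero} (suc i) = refl
dropk-𝟎 {suc n} (suc i) = dropk-𝟎 {n} i

pad-⊕ : ∀ {n} i (x y : Vec (Fin 2) (n ∸ i)) → pad {n} i (x ⊕ y) ≡ pad i x ⊕ pad i y
pad-⊕ zero x y = refl
pad-⊕ {zero} (suc i) x y = refl
pad-⊕ {suc n} (suc i) x y = cong (zero ∷_) (pad-⊕ i x y)

dropk-all : ∀ {n} (x y : Vec (Fin 2) n) → dropk n x ≡ dropk n y
dropk-all [] [] = refl
dropk-all (_ ∷ x) (_ ∷ y) = dropk-all x y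

dropk-mono : ∀ {n i j} → i ≤ j → (x y : Vec (Fin 2) n) → dropk i x ≡ dropk i y → dropk j x ≡ dropk j y
dropk-mono {j = j} z≤n x y eq = cong (dropk j) eq
dropk-mono (s≤s i≤j) [] [] eq = refl
dropk-mono (s≤s i≤j) (_ ∷ x) (_ ∷ y) eq = dropk-mono i≤j x y eq

dropk-≡⇒𝟎 : ∀ {n} i (x y : Vec (Fin 2) n) → dropk i x ≡ dropk i y → dropk i (x ⊕ y) ≡ 𝟎
dropk-≡⇒𝟎 i x y eq = trans (dropk-⊕ i x y) (⊕-≡⇒𝟎 eq)

dropk-𝟎⇒≡ : ∀ {n} i (x y : Vec (Fin 2) n) → dropk i (x ⊕ y) ≡ 𝟎 → dropk i x ≡ dropk i y
dropk-𝟎⇒≡ i x y eq = ⊕-𝟎⇒≡ (trans (sym (dropk-⊕ i x y)) eq)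

lookup-dropk : ∀ {n} i (x y : Vec (Fin 2) n) → dropk i x ≡ dropk i y → ∀ j → i ≤ toℕ j → lookup x j ≡ lookup y j
lookup-dropk zero x y refl j _ = refl
lookup-dropk (suc i) (_ ∷ x) (_ ∷ y) eq (suc j) (s≤s i≤j) = lookup-dropk i x y eq j i≤j

unit : ∀ {n} → Fin n → Vec (Fin 2) n
unit zero = suc zero ∷ 𝟎
unit (suc j) = zero ∷ unit j

lookup-unit : ∀ {n} (j : Fin n) → lookup (unit j) j ≡ suc zero
lookup-unit zero = refl
lookup-unit (suc j) = lookup-unit j

lookup-unit-≢ : ∀ {n} (i j : Fin n) → i ≢ j → lookup (unit i) j ≡ zero
lookup-unit-≢ zero zero ne = ⊥-elim (ne refl)
lookup-unit-≢ zero (suc j) ne = lookup-replicate j zero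
lookup-unit-≢ (suc i) zero ne = refl
lookup-unit-≢ (suc i) (suc j) ne = lookup-unit-≢ i j (ne ∘ cong suc)

dropk-unit : ∀ {n} i (k : Fin n) → toℕ k < i → dropk i (unit k) ≡ 𝟎
dropk-unit (suc i) zero _ = dropk-𝟎 i
dropk-unit (suc i) (suc k) (s≤s k<i) = dropk-unit i k k<i

dropk-unit-≢𝟎 : ∀ {n} (k : Fin n) → dropk (toℕ k) (unit k) ≢ 𝟎
dropk-unit-≢𝟎 zero ()
dropk-unit-≢𝟎 (suc k) eq = dropk-unit-≢𝟎 k eq

-- Each member of the coordinate flag has index 2 in the next, with `unit k` representing the other
-- coset.
dropk-suc : ∀ {n} (k : Fin n) (x : Vec (Fin 2) n) → dropk (suc (toℕ k)) x ≡ 𝟎 →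
  dropk (toℕ k) x ≡ 𝟎 ⊎ dropk (toℕ k) x ≡ dropk (toℕ k) (unit k)
dropk-suc zero (zero ∷ x) eq = inj₁ (cong (zero ∷_) eq)
dropk-suc zero (suc zero ∷ x) eq = inj₂ (cong (suc zero ∷_) eq)
dropk-suc (suc k) (_ ∷ x) eq = dropk-suc k x eq

nonzero-coordinate : ∀ {n} i (x : Vec (Fin 2) n) → dropk i x ≢ 𝟎 → Σ (Fin n) λ j → i ≤ toℕ j × lookup x j ≡ suc zero
nonzero-coordinate zero [] ne = ⊥-elim (ne refl)
nonzero-coordinate zero (suc zero ∷ x) ne = zero , z≤n , refl
nonzero-coordinate zero (zero ∷ x) ne with nonzero-coordinate zero x (ne ∘ cong (zero ∷_))
... | j , _ , eq = suc j , z≤n , eq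
nonzero-coordinate (suc i) [] ne = ⊥-elim (ne refl)
nonzero-coordinate (suc i) (_ ∷ x) ne with nonzero-coordinate i x ne
... | j , i≤j , eq = suc j , s≤s i≤j , eq

scale : ∀ {n} → Fin 2 → Vec (Fin 2) n → Vec (Fin 2) n
scale zero w = 𝟎
scale (suc zero) w = w

scale-addC : ∀ {n} a b (w : Vec (Fin 2) n) → scale (addC a b) w ≡ scale a w ⊕ scale b w
scale-addC zero b w = trans (cong (λ c → scale c w) (CyclicGroup.addC-zeroˡ 1 b)) (sym (⊕-identityˡ _))
scale-addC (suc zero) zero w = sym (⊕-identityʳ w)
scale-addC (suc zero) (suc zero) w = sym (⊕-self w)

lookup-scale : ∀ {n} a (w : Vec (Fin 2) n) j → lookup w j ≡ zero → lookup (scale a w) j ≡ zero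
lookup-scale zero w j eq = lookup-replicate j zero
lookup-scale (suc zero) w j eq = eq

dropk-scale : ∀ {n} i a (w : Vec (Fin 2) n) → dropk i w ≡ 𝟎 → dropk i (scale a w) ≡ 𝟎
dropk-scale i zero w eq = dropk-𝟎 i
dropk-scale i (suc zero) w eq = eq

record LinIso (n : ℕ) : Set where
  field
    to from : Vec (Fin 2) n → Vec (Fin 2) n
    from-to : ∀ x → from (to x) ≡ x
    to-from : ∀ x → to (from x) ≡ x
    to-⊕    : ∀ x y → to (x ⊕ y) ≡ to x ⊕ to y

  from-⊕ : ∀ x y → from (x ⊕ y) ≡ from x ⊕ from y
  from-⊕ x y = trans (cong from (trans (sym (cong₂ _⊕_ (to-from x) (to-from y))) (sym (to-⊕ (from x) (from y))))) (from-to _)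

  to-𝟎 : to 𝟎 ≡ 𝟎
  to-𝟎 = trans (sym (⊕-cancelʳ (to 𝟎) (to 𝟎))) (trans (cong (_⊕ to 𝟎) (trans (sym (to-⊕ 𝟎 𝟎)) (cong to (⊕-self 𝟎)))) (⊕-self _))

open LinIso

idₗ : ∀ {n} → LinIso n
idₗ = record { to = id ; from = id ; from-to = λ _ → refl ; to-from = λ _ → refl ; to-⊕ = λ _ _ → refl }

_⁻¹ₗ : ∀ {n} → LinIso n → LinIso n
α ⁻¹ₗ = record { to = from α ; from = to α ; from-to = to-from α ; to-from = from-to α ; to-⊕ = from-⊕ α }

_∘ₗ_ : ∀ {n} → LinIso n → LinIso n → LinIso n
α ∘ₗ β = record
  { to = to α ∘ to β ; from = from β ∘ from α
  ; from-to = λ x → trans (cong (from β) (from-to α (to β x))) (from-to β x)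
  ; to-from = λ x → trans (cong (to α) (to-from β (from α x))) (to-from α x)
  ; to-⊕ = λ x y → trans (cong (to α) (to-⊕ β x y)) (to-⊕ α _ _) }

-- The condition on `w` leaves coordinate j unchanged, which makes the map its own inverse.
transvection : ∀ {n} (j : Fin n) (w : Vec (Fin 2) n) → lookup w j ≡ zero → LinIso n
transvection j w wⱼ = record { to = τ ; from = τ ; from-to = invol ; to-from = invol ; to-⊕ = add }
  where
  τ : Vec (Fin 2) _ → Vec (Fin 2) _
  τ x = x ⊕ scale (lookup x j) w
  invol : ∀ x → τ (τ x) ≡ x
  invol x = trans (cong (λ a → τ x ⊕ scale a w) coord) (⊕-cancelʳ x _)
    where
    coord : lookup (τ x) j ≡ lookup x j
    coord = trans (lookup-zipWith addC j x _) (trans (cong (addC (lookup x j)) (lookup-scale (lookup x j) w j wⱼ))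
              (CyclicGroup.addC-zeroʳ 1 _))
  add : ∀ x y → τ (x ⊕ y) ≡ τ x ⊕ τ y
  add x y = trans (cong ((x ⊕ y) ⊕_) (trans (cong (λ a → scale a w) (lookup-zipWith addC j x y)) (scale-addC (lookup x j) (lookup y j) w)))
              (⊕-interchange x y _ _)

Preserves : ∀ {n} → ℕ → (Vec (Fin 2) n → Vec (Fin 2) n) → Set
Preserves i f = ∀ x y → dropk i x ≡ dropk i y → dropk i (f x) ≡ dropk i (f y)

Preserves₂ : ∀ {n} → ℕ → LinIso n → Set
Preserves₂ i α = Preserves i (to α) × Preserves i (from α)

preserves-∘ₗ : ∀ {n} i (α β : LinIso n) → Preserves₂ i α → Preserves₂ i β → Preserves₂ i (α ∘ₗ β)
preserves-∘ₗ i α β (a , a′) (b , b′) = (λ x y eq → a _ _ (b x y eq)) , (λ x y eq → b′ _ _ (a′ x y eq))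

preserves-kernel : ∀ {n} i (α : LinIso n) → Preserves i (to α) → ∀ x → dropk i x ≡ 𝟎 → dropk i (to α x) ≡ 𝟎
preserves-kernel i α h x eq = trans (h x 𝟎 (trans eq (sym (dropk-𝟎 i)))) (trans (cong (dropk i) (to-𝟎 α)) (dropk-𝟎 i))

transvection-preserves : ∀ {n} i (j : Fin n) w (wⱼ : lookup w j ≡ zero) → i ≤ toℕ j ⊎ dropk i w ≡ 𝟎 →
  Preserves₂ i (transvection j w wⱼ)
transvection-preserves i j w wⱼ h = pres h , pres h
  where
  pres : i ≤ toℕ j ⊎ dropk i w ≡ 𝟎 → Preserves i (to (transvection j w wⱼ))
  pres (inj₁ i≤j) x y eq = trans (dropk-⊕ i x _) (trans (cong₂ (λ u a → u ⊕ dropk i (scale a w)) eq (lookup-dropk i x y eq j i≤j)) (sym (dropk-⊕ i y _)))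
  pres (inj₂ w0) x y eq = trans (dropk-⊕ i x _) (trans (cong₂ _⊕_ eq (trans (dropk-scale i (lookup x j) w w0) (sym (dropk-scale i (lookup y j) w w0)))) (sym (dropk-⊕ i y _)))

-- The base change must not destroy what has been achieved: it keeps the flag up to level k, and
-- every higher level that contains `w`.
Eliminates : ∀ {n} → Fin n → Vec (Fin 2) n → LinIso n → Set
Eliminates k w γ = to γ w ≡ unit k × (∀ i → i ≤ toℕ k ⊎ (toℕ k < i × dropk i w ≡ 𝟎) → Preserves₂ i γ)

-- A Gauss step. If the entry of `w` at k is 1, a transvection adding `w ⊕ unit k` finishes.
-- Otherwise an entry 1 at some later j is first used to create one at k.
eliminate : ∀ {n} (k : Fin n) (w : Vec (Fin 2) n) → dropk (toℕ k) w ≢ 𝟎 → Σ (LinIso n) (Eliminates k w)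
eliminate {n} k w ne = by-cases (lookup w k) refl
  where
  clear : (v : Vec (Fin 2) n) → lookup v k ≡ suc zero → Σ (LinIso n) (Eliminates k v)
  clear v vₖ = transvection k (v ⊕ unit k) wₖ ,
      trans (cong (λ a → v ⊕ scale a (v ⊕ unit k)) vₖ) (⊕-cancelˡ v (unit k)) ,
      λ { i (inj₁ i≤k) → transvection-preserves i k _ wₖ (inj₁ i≤k)
        ; i (inj₂ (k<i , v0)) → transvection-preserves i k _ wₖ
            (inj₂ (trans (dropk-⊕ i v (unit k)) (trans (cong₂ _⊕_ v0 (dropk-unit i k k<i)) (⊕-self 𝟎)))) }
    where
    wₖ : lookup (v ⊕ unit k) k ≡ zero
    wₖ = trans (lookup-zipWith addC k v (unit k)) (cong₂ addC vₖ (lookup-unit k))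
  by-cases : ∀ a → lookup w k ≡ a → Σ (LinIso n) (Eliminates k w)
  by-cases (suc zero) eq = clear w eq
  by-cases zero eq with nonzero-coordinate (toℕ k) w ne
  ... | j , k≤j , wⱼ = γ ∘ₗ τ , trans (cong (to γ) τw) γw , λ
      { i (inj₁ i≤k) → preserves-∘ₗ i γ τ (γ-pres i (inj₁ i≤k)) (transvection-preserves i j (unit k) uⱼ (inj₁ (≤-trans i≤k k≤j)))
      ; i (inj₂ (k<i , w0)) → preserves-∘ₗ i γ τ
          (γ-pres i (inj₂ (k<i , trans (dropk-⊕ i w (unit k)) (trans (cong₂ _⊕_ w0 (dropk-unit i k k<i)) (⊕-self 𝟎)))))
          (transvection-preserves i j (unit k) uⱼ (inj₂ (dropk-unit i k k<i))) }
    where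
    k≢j : k ≢ j
    k≢j refl with () ← trans (sym eq) wⱼ
    uⱼ = lookup-unit-≢ k j k≢j
    τ = transvection j (unit k) uⱼ
    τw : to τ w ≡ w ⊕ unit k
    τw = cong (λ a → w ⊕ scale a (unit k)) wⱼ
    cleared = clear (w ⊕ unit k) (trans (lookup-zipWith addC k w (unit k)) (cong₂ addC eq (lookup-unit k)))
    γ = proj₁ cleared
    γw = proj₁ (proj₂ cleared)
    γ-pres = proj₂ (proj₂ cleared)

Vec↔Finᴬ : ∀ {A : Set} {k} → A ↔ Fin k → ∀ n → Vec A n ↔ Fin (k ^ n)
Vec↔Finᴬ A↔ zero = mk↔ₛ′ (λ _ → zero) (λ _ → []) (λ { zero → refl }) (λ { [] → refl })
Vec↔Finᴬ {k = k} A↔ (suc n) = ↔-trans (mk↔ₛ′ (λ x → head x , tail x) (λ (a , x) → a ∷ x) (λ _ → refl) (λ { (a ∷ x) → refl }))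
  (↔-trans (A↔ ×-↔ Vec↔Finᴬ A↔ n) (↔-sym (*↔× {k} {k ^ n})))

Vec↔Fin : ∀ n → Vec (Fin 2) n ↔ Fin (2 ^ n)
Vec↔Fin = Vec↔Finᴬ ↔-refl

search : ∀ {A : Set} {n} → A ↔ Fin n → {P : A → Set} → (∀ x → Dec (P x)) → Dec (Σ A P)
search A↔ {P} P? = map′ (λ { (i , h) → Inverse.from A↔ i , h })
  (λ { (x , h) → Inverse.to A↔ x , subst P (sym (Inverse.strictlyInverseʳ A↔ x)) h })
  (Finₚ.any? (λ i → P? (Inverse.from A↔ i)))

every : ∀ {A : Set} {n} → A ↔ Fin n → {P : A → Set} → (∀ x → Dec (P x)) → Dec (∀ x → P x)
every A↔ {P} P? = map′ (λ h x → subst P (Inverse.strictlyInverseʳ A↔ x) (h (Inverse.to A↔ x))) (λ h i → h (Inverse.from A↔ i))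
  (Finₚ.all? (λ i → P? (Inverse.from A↔ i)))

_≟ᵥ_ : ∀ {n} (x y : Vec (Fin 2) n) → Dec (x ≡ y)
_≟ᵥ_ = ≡-dec Finₚ._≟_

data Span {n} (U : Vec (Fin 2) n → Set) : Vec (Fin 2) n → Set where
  nil : Span U 𝟎
  add : ∀ {x u} → Span U x → U u → Span U (x ⊕ u)

-- Coordinates adapted to the span of U, found greedily: as long as a member of U lies outside the
-- span of the first k coordinate vectors, elimination turns it into the next one. As only members
-- of U are used, the first d coordinates never leave the span.
span-coordinates : ∀ {n} (U : Vec (Fin 2) n → Set) → (∀ x → Dec (U x)) →
  Σ ℕ λ d → d ≤ n × Σ (LinIso n) λ β →
    (∀ u → U u → dropk d (to β u) ≡ 𝟎) × (∀ x → dropk d (to β x) ≡ 𝟎 → Span U x)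
span-coordinates {n} U U? = go n 0 refl idₗ λ { x refl → nil }
  where
  go : ∀ m k → k + m ≡ n → (β : LinIso n) → (∀ x → dropk k (to β x) ≡ 𝟎 → Span U x) →
    Σ ℕ λ d → d ≤ n × Σ (LinIso n) λ β → (∀ u → U u → dropk d (to β u) ≡ 𝟎) × (∀ x → dropk d (to β x) ≡ 𝟎 → Span U x)
  go zero k eq β span = n , ≤-refl , β , (λ u _ → trans (dropk-all (to β u) 𝟎) (dropk-𝟎 n)) ,
    subst (λ k → ∀ x → dropk k (to β x) ≡ 𝟎 → Span U x) (trans (sym (+-identityʳ k)) eq) span
  go (suc m) k eq β span with search (Vec↔Fin n) {λ u → U u × dropk k (to β u) ≢ 𝟎} (λ u → U? u ×-dec ¬? (dropk k (to β u) ≟ᵥ 𝟎))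
  ... | no none = k , <⇒≤ k<n , β , small , span
    where
    k<n : k < n
    k<n = subst (k <_) eq (m<m+n k z<s)
    small : ∀ u → U u → dropk k (to β u) ≡ 𝟎
    small u uu with dropk k (to β u) ≟ᵥ 𝟎
    ... | yes e = e
    ... | no ne = ⊥-elim (none (u , uu , ne))
  ... | yes (u , uu , ne) = go m (suc k) (trans (sym (+-suc k m)) eq) (γ ∘ₗ β) span′
    where
    k<n : k < n
    k<n = subst (k <_) eq (m<m+n k z<s)
    k′ : Fin n
    k′ = fromℕ< k<n
    k′≡ : toℕ k′ ≡ k
    k′≡ = toℕ-fromℕ< k<n
    elim = eliminate k′ (to β u) (subst (λ k → dropk k (to β u) ≢ 𝟎) (sym k′≡) ne)
    γ = proj₁ elim
    γ-from : ∀ x → dropk k (to γ x) ≡ 𝟎 → dropk k x ≡ 𝟎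
    γ-from x e = subst (λ y → dropk k y ≡ 𝟎) (from-to γ x)
      (preserves-kernel k (γ ⁻¹ₗ) (proj₂ (proj₂ (proj₂ elim) k (inj₁ (≤-reflexive (sym k′≡))))) (to γ x) e)
    -- The new level is the old one together with its translate by `unit k′`, the image of u; in the
    -- second case x ⊕ u is therefore in the old level.
    span′ : ∀ x → dropk (suc k) (to γ (to β x)) ≡ 𝟎 → Span U x
    span′ x e with subst (λ k → dropk k (to γ (to β x)) ≡ 𝟎 ⊎ dropk k (to γ (to β x)) ≡ dropk k (unit k′)) k′≡
                     (dropk-suc k′ (to γ (to β x)) (subst (λ k → dropk (suc k) (to γ (to β x)) ≡ 𝟎) (sym k′≡) e))
    ... | inj₁ e₀ = span x (γ-from _ e₀)
    ... | inj₂ e₁ = subst (Span U) (⊕-cancelʳ x u) (add (span (x ⊕ u) (γ-from _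
          (trans (cong (dropk k) (trans (cong (to γ) (to-⊕ β x u)) (to-⊕ γ _ _)))
            (dropk-≡⇒𝟎 k _ _ (trans e₁ (cong (dropk k) (sym (proj₁ (proj₂ elim))))))))) uu)

-- Walks of length p

module _ {A : Set} where

  rotate : ∀ {n} → Vec A (suc n) → Vec A (suc n)
  rotate (x ∷ v) = v ∷ʳ x

  private
    rotateᴸ : List A → List A
    rotateᴸ [] = []
    rotateᴸ (x ∷ xs) = xs ++ (x ∷ [])

    rotateᴸ-fold : ∀ xs ys → fold (xs ++ ys) rotateᴸ (length xs) ≡ ys ++ xs
    rotateᴸ-fold [] ys = sym (++-identityʳ ys)
    rotateᴸ-fold (x ∷ xs) ys = begin
      fold (x ∷ xs ++ ys) rotateᴸ (suc (length xs))   ≡⟨ fold-suc rotateᴸ _ (length xs) ⟩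
      fold ((xs ++ ys) ++ (x ∷ [])) rotateᴸ (length xs)   ≡⟨ cong (λ z → fold z rotateᴸ (length xs)) (++-assoc xs ys (x ∷ [])) ⟩
      fold (xs ++ (ys ++ (x ∷ []))) rotateᴸ (length xs)   ≡⟨ rotateᴸ-fold xs (ys ++ (x ∷ [])) ⟩
      (ys ++ (x ∷ [])) ++ xs   ≡⟨ ++-assoc ys (x ∷ []) xs ⟩
      ys ++ x ∷ xs   ∎
      where open ≡-Reasoning

    toList-inj : ∀ {n} (v w : Vec A n) → toList v ≡ toList w → v ≡ w
    toList-inj [] [] _ = refl
    toList-inj (x ∷ v) (y ∷ w) eq = cong₂ _∷_ (proj₁ (Listₚ.∷-injective eq)) (toList-inj v w (proj₂ (Listₚ.∷-injective eq)))

    toList-fold : ∀ {n} k (v : Vec A (suc n)) → toList (fold v rotate k) ≡ fold (toList v) rotateᴸ k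
    toList-fold zero v = refl
    toList-fold (suc k) v = trans (step (fold v rotate k)) (cong rotateᴸ (toList-fold k v))
      where
      step : ∀ {n} (w : Vec A (suc n)) → toList (rotate w) ≡ rotateᴸ (toList w)
      step (x ∷ w) = toList-∷ʳ x w

  rotate-order : ∀ {n} (v : Vec A (suc n)) → fold v rotate (suc n) ≡ v
  rotate-order {n} v = toList-inj _ _ (trans (toList-fold (suc n) v)
    (subst (λ k → fold (toList v) rotateᴸ k ≡ toList v) (Vecₚ.length-toList v)
      (trans (cong (λ z → fold z rotateᴸ (length (toList v))) (sym (++-identityʳ (toList v)))) (rotateᴸ-fold (toList v) []))))

  rotate-fixed : ∀ {n} x (v : Vec A n) → v ∷ʳ x ≡ x ∷ v → v ≡ replicate n x
  rotate-fixed x [] _ = refl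
  rotate-fixed x (y ∷ v) eq with refl ← ∷-injectiveˡ eq = cong (x ∷_) (rotate-fixed x v (∷-injectiveʳ eq))

  replicate-∷ʳ : ∀ n (x : A) → replicate n x ∷ʳ x ≡ x ∷ replicate n x
  replicate-∷ʳ zero x = refl
  replicate-∷ʳ (suc n) x = cong (x ∷_) (replicate-∷ʳ n x)

module Finite {A : Set} {N : ℕ} (A↔Fin : A ↔ Fin N) where
  elements : List A
  elements = map (Inverse.from A↔Fin) (allFin N)

  elements-unique : Unique elements
  elements-unique = Uniqueₚ.map⁺ (λ {i} {j} eq → trans (sym (Inverse.strictlyInverseˡ A↔Fin i)) (trans (cong (Inverse.to A↔Fin) eq) (Inverse.strictlyInverseˡ A↔Fin j)))
    (Uniqueₚ.allFin⁺ N)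

  ∈-elements : ∀ x → x ∈ elements
  ∈-elements x = subst (_∈ elements) (Inverse.strictlyInverseʳ A↔Fin x) (∈-map⁺ (Inverse.from A↔Fin) (∈-allFin (Inverse.to A↔Fin x)))

  sum-reindex : (π π⁻ : A → A) → (∀ x → π⁻ (π x) ≡ x) → (∀ x → π (π⁻ x) ≡ x) → (F : A → ℕ) →
    sum (map (F ∘ π) elements) ≡ sum (map F elements)
  sum-reindex π π⁻ l r F = trans (cong sum (map-∘ elements)) (sum-↭ (↭-map⁺ F
    (∼bag⇒↭ (unique∧set⇒bag (Uniqueₚ.map⁺ (λ {x} {y} eq → trans (sym (l x)) (trans (cong π⁻ eq) (l y))) elements-unique) elements-unique
      (λ {x} → mk⇔ (λ _ → ∈-elements x) (λ _ → subst (_∈ map π elements) (r x) (∈-map⁺ π (∈-elements (π⁻ x)))))))))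

module GroupOps (n m : ℕ) where
  open CyclicGroup n
  private p = suc n

  G : Set
  G = Vec (Fin 2) m × Fin p

  infixl 6 _∙_ _⊖_
  _∙_ _⊖_ : G → G → G
  (u , a) ∙ (v , b) = u ⊕ v , addC a b
  (u , a) ⊖ (v , b) = u ⊕ v , subC a b

  0ᴳ : G
  0ᴳ = 𝟎 , zero

  _≟ᴳ_ : DecidableEquality G
  _≟ᴳ_ = ×-≡-dec _≟ᵥ_ Finₚ._≟_

  G↔Fin : G ↔ Fin (2 ^ m * p)
  G↔Fin = ↔-trans (Vec↔Fin m ×-↔ ↔-refl) (↔-sym *↔×)

  ⊖-self : ∀ g → g ⊖ g ≡ 0ᴳ
  ⊖-self (u , a) = cong₂ _,_ (⊕-self u) (subC-self a)

  ∙-⊖ : ∀ g h → (g ∙ h) ⊖ h ≡ g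
  ∙-⊖ (u , a) (v , b) = cong₂ _,_ (⊕-cancelʳ u v) (subC-addC a b)

  ⊖-∙ : ∀ g h → (g ⊖ h) ∙ h ≡ g
  ⊖-∙ (u , a) (v , b) = cong₂ _,_ (⊕-cancelʳ u v) (addC-subC a b)

  0ᴳ-identity : ∀ g → 0ᴳ ∙ g ≡ g
  0ᴳ-identity (u , a) = cong₂ _,_ (⊕-identityˡ u) (addC-zeroˡ a)

  ⊖-≡ : ∀ {g h} → g ⊖ h ≡ 0ᴳ → g ≡ h
  ⊖-≡ {g} {h} eq = trans (sym (⊖-∙ g h)) (trans (cong (_∙ h) eq) (0ᴳ-identity h))

  ⊖-swap : ∀ g h k → (g ⊖ h) ⊖ k ≡ (g ⊖ k) ⊖ h
  ⊖-swap (u , a) (v , b) (w , c) = cong₂ _,_ (⊕-swap u v w) (addC-swap a (negC b) (negC c))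

  ⊖-telescope : ∀ g h k → (g ⊖ k) ⊖ (h ⊖ k) ≡ g ⊖ h
  ⊖-telescope (u , a) (v , b) (w , c) = cong₂ _,_ (⊕-translate u v w) (subC-translate a b (negC c))

  -- There is an arc from g to h exactly when h - g lies in the connection set, so an isomorphism of
  -- Cayley digraphs becomes an identity between Boolean functions.
  Iso : (G → Bool) → (G → Bool) → (G → G) → Set
  Iso S T f = ∀ g h → S (h ⊖ g) ≡ T (f h ⊖ f g)

  -- Constancy expresses that the row over e is empty or full.
  Trivial : (G → Bool) → Vec (Fin 2) m → Set
  Trivial S e = ∀ t t′ → S (e , t) ≡ S (e , t′)

  Trivial? : ∀ S e → Dec (Trivial S e)
  Trivial? S e = Finₚ.all? (λ t → Finₚ.all? (λ t′ → S (e , t) Bool.≟ S (e , t′)))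

module WalkCount (n m : ℕ) (pp : Prime (suc n)) (odd : suc n ≢ 2) where
  open CyclicGroup n using (_·_; addC-subC; subC-addC; ·-order; ·-suc; addC-zeroʳ; subC; addC-comm)
  open GroupOps n m
  open Finite G↔Fin
  private p = suc n

  sumsTo : (G → Bool) → ∀ {k} → G → Vec G k → Bool
  sumsTo S h [] = ⌊ h ≟ᴳ 0ᴳ ⌋
  sumsTo S h (s ∷ v) = S s ∧ sumsTo S (h ⊖ s) v

  tuples : (G → Bool) → ∀ k → G → List (Vec G k)
  tuples S k h = filter (λ v → sumsTo S h v Bool.≟ true) (choices {m = k} (λ _ → elements))

  ∈-tuples⁻ : ∀ S k h {v} → v ∈ tuples S k h → sumsTo S h v ≡ true
  ∈-tuples⁻ S k h v∈ = proj₂ (∈-filter⁻ (λ v → sumsTo S h v Bool.≟ true) {xs = choices {m = k} (λ _ → elements)} v∈)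

  ∈-tuples⁺ : ∀ S k h {v} → sumsTo S h v ≡ true → v ∈ tuples S k h
  ∈-tuples⁺ S k h {v} eq = ∈-filter⁺ (λ v → sumsTo S h v Bool.≟ true) (∈-choices⁺ _ v (λ _ → ∈-elements _)) eq

  tuples-unique : ∀ S k h → Unique (tuples S k h)
  tuples-unique S k h = Uniqueₚ.filter⁺ _ (choices-unique {m = k} (λ _ → elements) (λ _ → elements-unique))

  walks : (G → Bool) → ℕ → G → ℕ
  walks S k h = length (tuples S k h)

  walks-suc : ∀ S k h → walks S (suc k) h ≡ sum (map (λ s → if S s then walks S k (h ⊖ s) else 0) elements)
  walks-suc S k h = go elements
    where
    rest : List (Vec G k)
    rest = choices (λ _ → elements)
    P? = λ v → sumsTo S h v Bool.≟ true
    length-filter-∷ : ∀ s (vs : List (Vec G k)) →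
      length (filter P? (map (s ∷_) vs)) ≡ (if S s then length (filter (λ v → sumsTo S (h ⊖ s) v Bool.≟ true) vs) else 0)
    length-filter-∷ s [] with S s
    ... | true = refl
    ... | false = refl
    length-filter-∷ s (v ∷ vs) with S s | length-filter-∷ s vs
    ... | false | ih = ih
    ... | true | ih with sumsTo S (h ⊖ s) v
    ... | true = cong suc ih
    ... | false = ih
    go : ∀ xs → length (filter P? (cartesianProductWith _∷_ xs rest)) ≡ sum (map (λ s → if S s then walks S k (h ⊖ s) else 0) xs)
    go [] = refl
    go (s ∷ xs) = trans (cong length (filter-++ P? (map (s ∷_) rest) _))
      (trans (length-++ (filter P? (map (s ∷_) rest))) (cong₂ _+_ (length-filter-∷ s rest) (go xs)))

  -- Induction on the first arc. Only vertices can be transported by `f`, so the sum over elements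
  -- of the connection set is rewritten as a sum over the second vertex u, reindexed by `f`, and
  -- rewritten back.
  walks-iso : ∀ S T (f f⁻ : G → G) → (∀ x → f⁻ (f x) ≡ x) → (∀ x → f (f⁻ x) ≡ x) → Iso S T f →
    ∀ k g h → walks S k (h ⊖ g) ≡ walks T k (f h ⊖ f g)
  walks-iso S T f f⁻ l r iso zero g h with (h ⊖ g) ≟ᴳ 0ᴳ | (f h ⊖ f g) ≟ᴳ 0ᴳ
  ... | yes _ | yes _ = refl
  ... | no _ | no _ = refl
  ... | yes eq | no ne = ⊥-elim (ne (trans (cong (λ x → f x ⊖ f g) (⊖-≡ eq)) (⊖-self (f g))))
  ... | no ne | yes eq = ⊥-elim (ne (trans (cong (_⊖ g) (trans (sym (l h)) (trans (cong f⁻ (⊖-≡ eq)) (l g)))) (⊖-self g)))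
  walks-iso S T f f⁻ l r iso (suc k) g h = begin
    walks S (suc k) (h ⊖ g)   ≡⟨ walks-suc S k (h ⊖ g) ⟩
    sum (map F elements)   ≡⟨ sym (sum-reindex (_⊖ g) (_∙ g) (λ x → ⊖-∙ x g) (λ x → ∙-⊖ x g) F) ⟩
    sum (map (F ∘ (_⊖ g)) elements)   ≡⟨ cong sum (map-cong same elements) ⟩
    sum (map (F′ ∘ (_⊖ f g) ∘ f) elements)   ≡⟨ sum-reindex f f⁻ l r (F′ ∘ (_⊖ f g)) ⟩
    sum (map (F′ ∘ (_⊖ f g)) elements)   ≡⟨ sum-reindex (_⊖ f g) (_∙ f g) (λ x → ⊖-∙ x (f g)) (λ x → ∙-⊖ x (f g)) F′ ⟩
    sum (map F′ elements)   ≡⟨ sym (walks-suc T k (f h ⊖ f g)) ⟩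
    walks T (suc k) (f h ⊖ f g)   ∎
    where
    open ≡-Reasoning
    F F′ : G → ℕ
    F s = if S s then walks S k ((h ⊖ g) ⊖ s) else 0
    F′ s = if T s then walks T k ((f h ⊖ f g) ⊖ s) else 0
    same : ∀ u → F (u ⊖ g) ≡ F′ (f u ⊖ f g)
    same u = cong₂ (λ b w → if b then w else 0) (iso g u)
      (trans (cong (walks S k) (⊖-telescope h u g)) (trans (walks-iso S T f f⁻ l r iso k u h)
        (cong (walks T k) (sym (⊖-telescope (f h) (f u) (f g))))))

  sumsTo-∷ʳ : ∀ S {k} h s (v : Vec G k) → sumsTo S h (v ∷ʳ s) ≡ sumsTo S h (s ∷ v)
  sumsTo-∷ʳ S h s [] = refl
  sumsTo-∷ʳ S h s (w ∷ v) = begin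
    S w ∧ sumsTo S (h ⊖ w) (v ∷ʳ s)   ≡⟨ cong (S w ∧_) (sumsTo-∷ʳ S (h ⊖ w) s v) ⟩
    S w ∧ (S s ∧ sumsTo S ((h ⊖ w) ⊖ s) v)   ≡⟨ cong (λ x → S w ∧ (S s ∧ sumsTo S x v)) (⊖-swap h w s) ⟩
    S w ∧ (S s ∧ sumsTo S ((h ⊖ s) ⊖ w) v)   ≡⟨ trans (sym (∧-assoc (S w) (S s) _)) (trans (cong (_∧ sumsTo S ((h ⊖ s) ⊖ w) v) (∧-comm (S w) (S s))) (∧-assoc (S s) (S w) _)) ⟩
    S s ∧ (S w ∧ sumsTo S ((h ⊖ s) ⊖ w) v)   ∎
    where open ≡-Reasoning

  times : ℕ → G → G
  times zero s = 0ᴳ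
  times (suc k) s = times k s ∙ s

  -- Multiplication by p kills C_p and, p being odd, is the identity on E. Hence a constant tuple
  -- remembers the row it comes from.
  times-order : ∀ e t → times p (e , t) ≡ (e , zero)
  times-order e t = cong₂ _,_ (trans (fst-times p) (trans (cong copies (odd-prime pp odd)) (trans (even (p / 2) 1) (⊕-identityˡ e))))
                              (trans (snd-times p) (·-order t))
    where
    snd-times : ∀ k → proj₂ (times k (e , t)) ≡ k · t
    snd-times zero = refl
    snd-times (suc k) = trans (cong (λ x → addC x t) (snd-times k)) (trans (addC-comm _ t) (sym (·-suc k t)))
    copies : ℕ → Vec (Fin 2) m
    copies k = fold 𝟎 (_⊕ e) k
    even : ∀ j r → copies (r + j * 2) ≡ copies r
    even zero r = cong copies (+-identityʳ r)
    even (suc j) zero = trans (⊕-cancelʳ _ e) (even j zero)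
    even (suc j) (suc r) = cong (_⊕ e) (even (suc j) r)
    fst-times : ∀ k → proj₁ (times k (e , t)) ≡ copies k
    fst-times zero = refl
    fst-times (suc k) = cong (_⊕ e) (fst-times k)

  sumsTo-replicate⁺ : ∀ S s → S s ≡ true → ∀ k → sumsTo S (times k s) (replicate k s) ≡ true
  sumsTo-replicate⁺ S s Ss zero with 0ᴳ ≟ᴳ 0ᴳ
  ... | yes _ = refl
  ... | no ne = ⊥-elim (ne refl)
  sumsTo-replicate⁺ S s Ss (suc k) rewrite Ss = trans (cong (λ x → sumsTo S x (replicate k s)) (∙-⊖ (times k s) s)) (sumsTo-replicate⁺ S s Ss k)

  sumsTo-replicate⁻ : ∀ S s k h → sumsTo S h (replicate k s) ≡ true → h ≡ times k s
  sumsTo-replicate⁻ S s zero h eq with h ≟ᴳ 0ᴳ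
  ... | yes h≡0 = h≡0
  sumsTo-replicate⁻ S s (suc k) h eq = trans (sym (⊖-∙ h s)) (cong (_∙ s) (sumsTo-replicate⁻ S s k (h ⊖ s) (∧-conicalʳ (S s) _ eq)))

  private
    _≟ⱽ_ : DecidableEquality (Vec G p)
    _≟ⱽ_ = Vecₚ.≡-dec _≟ᴳ_
    open PrimeOrder pp _≟ⱽ_ rotate rotate-order

    tuples-closed : ∀ S h {v} → v ∈ tuples S p h → rotate v ∈ tuples S p h
    tuples-closed S h {s ∷ v} v∈ = ∈-tuples⁺ S p h (trans (sumsTo-∷ʳ S h s v) (∈-tuples⁻ S p h v∈))

    fixed-tuple : ∀ S h {v} → v ∈ fixed (tuples S p h) → Σ G λ s → v ≡ replicate p s × S s ≡ true × h ≡ (proj₁ s , zero)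
    fixed-tuple S h {s ∷ v} v∈ with ∈-filter⁻ (λ x → rotate x ≟ⱽ x) {xs = tuples S p h} v∈
    ... | v∈t , fx with refl ← rotate-fixed s v fx =
      s , refl , ∧-conicalˡ (S s) _ (∈-tuples⁻ S p h v∈t) ,
      trans (sumsTo-replicate⁻ S s p h (∈-tuples⁻ S p h v∈t)) (times-order (proj₁ s) (proj₂ s))

    row : (G → Bool) → Vec (Fin 2) m → List (Fin p)
    row S e = filter (λ t → S (e , t) Bool.≟ true) (allFin p)

    fixed-count : ∀ S e → length (fixed (tuples S p (e , zero))) ≡ length (row S e)
    fixed-count S e = trans (length-≡-of-⊆⊇ (Uniqueₚ.filter⁺ _ (tuples-unique S p (e , zero)))
        (Uniqueₚ.map⁺ (λ eq → cong proj₂ (∷-injectiveˡ eq)) (Uniqueₚ.filter⁺ (λ t → S (e , t) Bool.≟ true) (Uniqueₚ.allFin⁺ p))) sub sup)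
      (length-map (λ t → replicate p (e , t)) (row S e))
      where
      sub : ∀ {v} → v ∈ fixed (tuples S p (e , zero)) → v ∈ map (λ t → replicate p (e , t)) (row S e)
      sub v∈ with fixed-tuple S (e , zero) v∈
      ... | (.e , t) , refl , Ss , refl = ∈-map⁺ _ (∈-filter⁺ (λ t → S (e , t) Bool.≟ true) (∈-allFin t) Ss)
      sup : ∀ {v} → v ∈ map (λ t → replicate p (e , t)) (row S e) → v ∈ fixed (tuples S p (e , zero))
      sup v∈ with ∈-map⁻ _ v∈
      ... | t , t∈ , refl = ∈-filter⁺ (λ x → rotate x ≟ⱽ x)
        (∈-tuples⁺ S p (e , zero) (subst (λ h → sumsTo S h (replicate p (e , t)) ≡ true) (times-order e t)
          (sumsTo-replicate⁺ S (e , t) (proj₂ (∈-filter⁻ (λ t → S (e , t) Bool.≟ true) {xs = allFin p} t∈)) p)))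
        (replicate-∷ʳ n (e , t))

    -- A row that is neither empty nor full has more than 0 and fewer than p elements.
    row-indivisible : ∀ S e → ¬ Trivial S e → ¬ p ∣ length (row S e)
    row-indivisible S e nt d with Finₚ.any? (λ t → S (e , t) Bool.≟ true) | Finₚ.any? (λ t → S (e , t) Bool.≟ false)
    ... | no none | _ = nt (λ t t′ → trans (falsity t) (sym (falsity t′)))
      where
      falsity : ∀ t → S (e , t) ≡ false
      falsity t with S (e , t) in eq
      ... | true = ⊥-elim (none (t , eq))
      ... | false = refl
    ... | _ | no none = nt (λ t t′ → trans (truth t) (sym (truth t′)))
      where
      truth : ∀ t → S (e , t) ≡ true
      truth t with S (e , t) in eq
      ... | false = ⊥-elim (none (t , eq))
      ... | true = refl
    ... | yes (t , St) | yes (t′ , St′) = <⇒≱ below (∣⇒≤ {{ℕ.>-nonZero (filter-some (λ t → S (e , t) Bool.≟ true) (lose (∈-allFin t) St))}} d)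
      where
      below : length (row S e) < p
      below = subst (length (row S e) <_) (length-tabulate {n = p} id)
        (filter-notAll (λ t → S (e , t) Bool.≟ true) (allFin p) (lose (∈-allFin t′) (λ St″ → case trans (sym St′) St″ of λ ())))

    row-divisible : ∀ S e → Trivial S e → p ∣ length (row S e)
    row-divisible S e tr = by-cases (S (e , zero)) refl
      where
      by-cases : ∀ b → S (e , zero) ≡ b → p ∣ length (row S e)
      by-cases true eq = subst (p ∣_) (sym (trans
        (cong length (filter-all (λ t → S (e , t) Bool.≟ true) {xs = allFin p} (All.tabulate (λ {t} _ → trans (tr t zero) eq))))
        (length-tabulate {n = p} id))) ∣-refl
      by-cases false eq = subst (p ∣_) (sym (cong length (filter-none (λ t → S (e , t) Bool.≟ true) {xs = allFin p}
        (All.tabulate (λ {t} _ St → case trans (sym St) (trans (tr t zero) eq) of λ ()))))) (p ∣0)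

  -- Modulo p, the walks of length p ending at h are the constant ones (Frobenius).
  nontrivial-row⇒p∤walks : ∀ S e → ¬ Trivial S e → ¬ p ∣ walks S p (e , zero)
  nontrivial-row⇒p∤walks S e nt d = row-indivisible S e nt (subst (p ∣_) (fixed-count S e)
    (∣-fixed-of-∣ (tuples-unique S p (e , zero)) (tuples-closed S (e , zero)) d))

  p∤walks⇒nontrivial-row : ∀ S h → ¬ p ∣ walks S p h → Σ (Vec (Fin 2) m) λ e → h ≡ (e , zero) × ¬ Trivial S e
  p∤walks⇒nontrivial-row S (e , zero) nd = e , refl , λ tr → nd (∣-of-∣-fixed (tuples-unique S p (e , zero)) (tuples-closed S (e , zero))
    (subst (p ∣_) (sym (fixed-count S e)) (row-divisible S e tr)))
  p∤walks⇒nontrivial-row S (e , suc t) nd = ⊥-elim (nd (∣-of-∣-fixed (tuples-unique S p (e , suc t)) (tuples-closed S (e , suc t))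
    (subst (p ∣_) (sym (cong length empty)) (p ∣0))))
    where
    empty : fixed (tuples S p (e , suc t)) ≡ []
    empty with fixed (tuples S p (e , suc t)) in eq
    ... | [] = refl
    ... | v ∷ _ with fixed-tuple S (e , suc t) (subst (v ∈_) (sym eq) (here refl))
    ...   | _ , _ , _ , ()

  -- The number of walks of length p between two vertices is an invariant, and it is prime to p
  -- exactly when their difference is some (u , 0) with a nontrivial row over u. So `f` takes
  -- differences of this kind to differences of this kind.
  iso-nontrivial : ∀ S T (f f⁻ : G → G) → (∀ x → f⁻ (f x) ≡ x) → (∀ x → f (f⁻ x) ≡ x) → Iso S T f →
    ∀ g u → ¬ Trivial S u → Σ (Vec (Fin 2) m) λ u′ → ¬ Trivial T u′ × f ((u , zero) ∙ g) ≡ (u′ , zero) ∙ f g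
  iso-nontrivial S T f f⁻ l r iso g u nt with p∤walks⇒nontrivial-row T (f ((u , zero) ∙ g) ⊖ f g)
    (subst (λ w → ¬ p ∣ w) (trans (cong (walks S p) (sym (∙-⊖ (u , zero) g))) (walks-iso S T f f⁻ l r iso p g ((u , zero) ∙ g)))
      (nontrivial-row⇒p∤walks S u nt))
  ... | u′ , eq , nt′ = u′ , nt′ , trans (sym (⊖-∙ _ (f g))) (cong (_∙ f g) eq)

-- Colourings and admissible maps

module Colourings (n m : ℕ) where
  open CyclicGroup n
  open GroupOps n m
  open LinIso
  private
    p = suc n
    E = Vec (Fin 2) m

  -- Only automorphisms acting separately on the two factors are used; for odd p every automorphism
  -- of E × C_p is of this form.
  Equivalent : (G → Bool) → (G → Bool) → Set
  Equivalent S T = Σ (LinIso m) λ α → Σ Unit λ a → ∀ e t → T (to α e , Unit.val a · t) ≡ S (e , t)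

  twist : LinIso m → (G → Bool) → G → Bool
  twist β S (e , t) = S (from β e , t)

  untwist : ∀ β β′ {S T} → Equivalent (twist β S) (twist β′ T) → Equivalent S T
  untwist β β′ {S} {T} (α , a , h) = ((β′ ⁻¹ₗ) ∘ₗ α) ∘ₗ β , a , λ e t →
    trans (h (to β e) t) (cong (λ x → S (x , t)) (from-to β e))

  TrivialOutside : ℕ → (G → Bool) → Set
  TrivialOutside d S = ∀ e → dropk d e ≢ 𝟎 → Trivial S e

  twist-trivial : ∀ d γ → Preserves d (to γ) → ∀ {S} → TrivialOutside d S → TrivialOutside d (twist γ S)
  twist-trivial d γ pr tr e ne = tr (from γ e) (λ eq → ne (subst (λ x → dropk d x ≡ 𝟎) (to-from γ e) (preserves-kernel d γ pr (from γ e) eq)))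

  -- The maps (e , t) ↦ (φ e , a_e t) with a_e depending only on the coset of e modulo the first d coordinates.
  record Admissible (d : ℕ) (S T : G → Bool) (φ φ⁻ : E → E) : Set where
    field
      leftInv  : ∀ x → φ⁻ (φ x) ≡ x
      rightInv : ∀ x → φ (φ⁻ x) ≡ x
      pres     : Preserves d φ
      pres⁻    : Preserves d φ⁻
      scalar   : Vec (Fin 2) (m ∸ d) → Unit
      respects : ∀ e e′ t → S (e ⊕ e′ , t) ≡ T (φ e ⊕ φ e′ , Unit.val (scalar (dropk d e)) · t)

  open Admissible

  adm-id : ∀ {d S} → Admissible d S S id id
  adm-id {S = S} = record
    { leftInv = λ _ → refl ; rightInv = λ _ → refl ; pres = λ _ _ → id ; pres⁻ = λ _ _ → id
    ; scalar = λ _ → 1ᵤ ; respects = λ e e′ t → cong (λ s → S (e ⊕ e′ , s)) (sym (·-identity t)) }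

  adm-inv : ∀ {d S T φ φ⁻} → Admissible d S T φ φ⁻ → Admissible d T S φ⁻ φ
  adm-inv {d} {S} {T} {φ} {φ⁻} A = record
    { leftInv = rightInv A ; rightInv = leftInv A ; pres = pres⁻ A ; pres⁻ = pres A
    -- `pad d v` is an arbitrary representative of the coset; as `φ⁻` respects cosets, the scalar
    -- found does not depend on it.
    ; scalar = λ v → scalar A (dropk d (φ⁻ (pad d v))) ⁻¹ᵤ
    ; respects = λ e e′ t → sym (begin
        S (φ⁻ e ⊕ φ⁻ e′ , Unit.inv (scalar A (dropk d (φ⁻ (pad d (dropk d e))))) · t)
          ≡⟨ cong (λ v → S (φ⁻ e ⊕ φ⁻ e′ , Unit.inv (scalar A v) · t)) (pres⁻ A _ _ (dropk-pad d (dropk d e))) ⟩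
        S (φ⁻ e ⊕ φ⁻ e′ , Unit.inv (scalar A (dropk d (φ⁻ e))) · t)
          ≡⟨ respects A (φ⁻ e) (φ⁻ e′) _ ⟩
        T (φ (φ⁻ e) ⊕ φ (φ⁻ e′) , Unit.val (scalar A (dropk d (φ⁻ e))) · Unit.inv (scalar A (dropk d (φ⁻ e))) · t)
          ≡⟨ cong₂ (λ x s → T (x , s)) (cong₂ _⊕_ (rightInv A e) (rightInv A e′)) (Unit.val-inv (scalar A (dropk d (φ⁻ e))) t) ⟩
        T (e ⊕ e′ , t) ∎) }
    where open ≡-Reasoning

  adm-∘ : ∀ {d S T R φ φ⁻ ψ ψ⁻} → Admissible d T R ψ ψ⁻ → Admissible d S T φ φ⁻ → Admissible d S R (ψ ∘ φ) (φ⁻ ∘ ψ⁻)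
  adm-∘ {d} {S} {T} {R} {φ} {φ⁻} {ψ} {ψ⁻} B A = record
    { leftInv = λ x → trans (cong φ⁻ (leftInv B (φ x))) (leftInv A x)
    ; rightInv = λ x → trans (cong ψ (rightInv A (ψ⁻ x))) (rightInv B x)
    ; pres = λ x y eq → pres B _ _ (pres A x y eq) ; pres⁻ = λ x y eq → pres⁻ A _ _ (pres⁻ B x y eq)
    ; scalar = λ v → scalar B (dropk d (φ (pad d v))) *ᵤ scalar A v
    ; respects = λ e e′ t → begin
        S (e ⊕ e′ , t)   ≡⟨ respects A e e′ t ⟩
        T (φ e ⊕ φ e′ , a e · t)   ≡⟨ respects B (φ e) (φ e′) _ ⟩
        R (ψ (φ e) ⊕ ψ (φ e′) , Unit.val (scalar B (dropk d (φ e))) · a e · t)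
          ≡⟨ cong (λ v → R (ψ (φ e) ⊕ ψ (φ e′) , Unit.val (scalar B v) · a e · t)) (pres A _ _ (sym (dropk-pad d (dropk d e)))) ⟩
        R (ψ (φ e) ⊕ ψ (φ e′) , Unit.val (scalar B (dropk d (φ (pad d (dropk d e))))) · a e · t)
          ≡⟨ cong (λ s → R (ψ (φ e) ⊕ ψ (φ e′) , s)) (sym (·-* (Unit.val (scalar B (dropk d (φ (pad d (dropk d e)))))) (a e) t)) ⟩
        R (ψ (φ e) ⊕ ψ (φ e′) , Unit.val (scalar B (dropk d (φ (pad d (dropk d e)))) *ᵤ scalar A (dropk d e)) · t) ∎ }
    where
    open ≡-Reasoning
    a : E → ℕ
    a e = Unit.val (scalar A (dropk d e))

  translate-preserves : ∀ i (z : E) → Preserves i (_⊕ z)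
  translate-preserves i z x y eq = trans (dropk-⊕ i x z) (trans (cong (_⊕ dropk i z) eq) (sym (dropk-⊕ i y z)))

  adm-translate : ∀ {d S} z → Admissible d S S (_⊕ z) (_⊕ z)
  adm-translate {d} {S} z = record
    { leftInv = λ x → ⊕-cancelʳ x z ; rightInv = λ x → ⊕-cancelʳ x z
    ; pres = translate-preserves d z ; pres⁻ = translate-preserves d z
    ; scalar = λ _ → 1ᵤ ; respects = λ e e′ t → cong₂ (λ x s → S (x , s)) (sym (⊕-translate e e′ z)) (sym (·-identity t)) }

  adm-twist : ∀ {d S} γ → Preserves₂ d γ → Admissible d S (twist γ S) (to γ) (from γ)
  adm-twist {d} {S} γ (pr , pr⁻) = record
    { leftInv = from-to γ ; rightInv = to-from γ ; pres = pr ; pres⁻ = pr⁻ ; scalar = λ _ → 1ᵤ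
    ; respects = λ e e′ t → cong₂ (λ x s → S (x , s)) (sym (trans (cong (from γ) (sym (to-⊕ γ e e′))) (from-to γ _))) (sym (·-identity t)) }

  Flag : ℕ → (E → E) → Set
  Flag k φ = ∀ i → i ≤ k → Preserves i φ

  -- Levels k < d refine the subspace spanned by the first d coordinates, later levels refine the whole space.
  module Level (d : ℕ) (S T : G → Bool) (φ φ⁻ : E → E) (A : Admissible d S T φ φ⁻)
               (k′ : Fin m) (flag : Flag (toℕ k′) φ) (flag⁻ : Flag (toℕ k′) φ⁻)
               (D : ℕ) (k<D : toℕ k′ < D) (D-cases : D ≡ d ⊎ (D ≡ m × d ≤ toℕ k′)) where

    private
      k = toℕ k′
      X = Vec (Fin 2) (m ∸ k)

      lift : X → E
      lift = pad k

      presD : ∀ {S T ψ ψ⁻} → Admissible d S T ψ ψ⁻ → Preserves D ψ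
      presD {ψ = ψ} B = by-cases D-cases
        where
        by-cases : D ≡ d ⊎ (D ≡ m × d ≤ k) → Preserves D ψ
        by-cases (inj₁ eq) = subst (λ i → Preserves i ψ) (sym eq) (pres B)
        by-cases (inj₂ (eq , _)) = subst (λ i → Preserves i ψ) (sym eq) (λ x y _ → dropk-all (ψ x) (ψ y))

      record Elem (a b : X → X) : Set where
        field
          σ σ⁻ : E → E
          adm : Admissible d S S σ σ⁻
          σ-flag : Flag k σ
          σ⁻-flag : Flag k σ⁻
          σ-a : ∀ x → dropk k (σ x) ≡ a (dropk k x)
          σ⁻-b : ∀ x → dropk k (σ⁻ x) ≡ b (dropk k x)

      open Elem

      𝒢 : PermGroup X
      𝒢 = record
        { Elem = Elem
        ; invˡ = λ {a} {b} e x → begin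
            b (a x)   ≡⟨ cong (b ∘ a) (sym (dropk-pad k x)) ⟩
            b (a (dropk k (lift x)))   ≡⟨ cong b (sym (σ-a e (lift x))) ⟩
            b (dropk k (σ e (lift x)))   ≡⟨ sym (σ⁻-b e _) ⟩
            dropk k (σ⁻ e (σ e (lift x)))   ≡⟨ cong (dropk k) (leftInv (adm e) _) ⟩
            dropk k (lift x)   ≡⟨ dropk-pad k x ⟩
            x   ∎
        ; elem-id = record { σ = id ; σ⁻ = id ; adm = adm-id ; σ-flag = λ _ _ _ _ → id ; σ⁻-flag = λ _ _ _ _ → id ; σ-a = λ _ → refl ; σ⁻-b = λ _ → refl }
        ; elem-inv = λ e → record { σ = σ⁻ e ; σ⁻ = σ e ; adm = adm-inv (adm e) ; σ-flag = σ⁻-flag e ; σ⁻-flag = σ-flag e ; σ-a = σ⁻-b e ; σ⁻-b = σ-a e }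
        ; elem-∘ = λ {a} {b} {c} {c⁻} e e′ → record
            { σ = σ e ∘ σ e′ ; σ⁻ = σ⁻ e′ ∘ σ⁻ e ; adm = adm-∘ (adm e) (adm e′)
            ; σ-flag = λ i i≤k x y eq → σ-flag e i i≤k _ _ (σ-flag e′ i i≤k x y eq)
            ; σ⁻-flag = λ i i≤k x y eq → σ⁻-flag e′ i i≤k _ _ (σ⁻-flag e i i≤k x y eq)
            ; σ-a = λ x → trans (σ-a e _) (cong a (σ-a e′ x))
            ; σ⁻-b = λ x → trans (σ⁻-b e′ _) (cong c⁻ (σ⁻-b e x)) } }
        where open ≡-Reasoning

      _R_ : X → X → Set
      x R y = dropk D (lift x) ≡ dropk D (lift y)

      dropD-lift : ∀ x → dropk D (lift (dropk k x)) ≡ dropk D x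
      dropD-lift x = dropk-mono (<⇒≤ k<D) _ _ (dropk-pad k (dropk k x))

      descend : (E → E) → X → X
      descend ψ x = dropk k (ψ (lift x))

      descend-drop : ∀ {ψ} → Preserves k ψ → ∀ x → descend ψ (dropk k x) ≡ dropk k (ψ x)
      descend-drop pr x = pr _ _ (dropk-pad k (dropk k x))

      descend-R : ∀ {ψ} → Preserves D ψ → ∀ {x y} → x R y → descend ψ x R descend ψ y
      descend-R {ψ} pr {x} {y} xRy = trans (dropD-lift (ψ (lift x))) (trans (pr _ _ xRy) (sym (dropD-lift (ψ (lift y)))))

      R-elem : ∀ {a b} → Elem a b → ∀ {x y} → x R y → a x R a y
      R-elem {a} e {x} {y} xRy = subst₂ _R_ (on x) (on y) (descend-R (presD (adm e)) xRy)
        where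
        on : ∀ x → descend (σ e) x ≡ a x
        on x = trans (σ-a e (lift x)) (cong a (dropk-pad k x))

      z₀ : X
      z₀ = dropk k (unit k′)

      lift-⊕ : ∀ x z → dropk D (lift z) ≡ 𝟎 → (x ⊕ z) R x
      lift-⊕ x z eq = trans (cong (dropk D) (pad-⊕ k x z)) (trans (dropk-⊕ D (lift x) (lift z)) (trans (cong (dropk D (lift x) ⊕_) eq) (⊕-identityʳ _)))

      ⊕-≢ : ∀ {l} (x z : Vec (Fin 2) l) → z ≢ 𝟎 → x ⊕ z ≢ x
      ⊕-≢ x z ne eq = ne (trans (sym (⊕-cancelˡ x z)) (trans (cong (x ⊕_) eq) (⊕-self x)))

      φ̄ φ̄⁻ : X → X
      φ̄ = descend φ
      φ̄⁻ = descend φ⁻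

      φ̄-inv : ∀ x → φ̄ (φ̄⁻ x) ≡ x
      φ̄-inv x = trans (descend-drop (flag k ≤-refl) (φ⁻ (lift x))) (trans (cong (dropk k) (rightInv A (lift x))) (dropk-pad k x))

      φ̄⁻-inv : ∀ x → φ̄⁻ (φ̄ x) ≡ x
      φ̄⁻-inv x = trans (descend-drop (flag⁻ k ≤-refl) (φ (lift x))) (trans (cong (dropk k) (leftInv A (lift x))) (dropk-pad k x))

      translations : CommutingFamily 2 𝒢
      translations = record
        { I = X ; indices = Finite.elements (Vec↔Fin (m ∸ k)) ; γ = λ z → _⊕ z ; γ⁻ = λ z → _⊕ z
        ; elem = λ z → record
            { σ = _⊕ lift z ; σ⁻ = _⊕ lift z ; adm = adm-translate (lift z)
            ; σ-flag = λ i _ → translate-preserves i (lift z) ; σ⁻-flag = λ i _ → translate-preserves i (lift z)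
            ; σ-a = λ x → shift z x ; σ⁻-b = λ x → shift z x }
        ; order = λ z x → ⊕-cancelʳ x z ; comm = λ z z′ x → ⊕-swap x z′ z }
        where
        shift : ∀ z x → dropk k (x ⊕ lift z) ≡ dropk k x ⊕ z
        shift z x = trans (dropk-⊕ k x (lift z)) (cong (dropk k x ⊕_) (dropk-pad k z))

      -- The translations on the side of T, carried back along φ. They lift to symmetries of S
      -- because φ is admissible from S to T.
      conjugates : CommutingFamily 2 𝒢
      conjugates = record
        { I = X ; indices = Finite.elements (Vec↔Fin (m ∸ k))
        ; γ = λ z x → φ̄⁻ (φ̄ x ⊕ z) ; γ⁻ = λ z x → φ̄⁻ (φ̄ x ⊕ z)
        ; elem = λ z → record
            { σ = conj z ; σ⁻ = conj z ; adm = adm-∘ (adm-inv A) (adm-∘ (adm-translate (lift z)) A)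
            ; σ-flag = conj-flag z ; σ⁻-flag = conj-flag z ; σ-a = conj-drop z ; σ⁻-b = conj-drop z }
        ; order = λ z x → trans (cong (λ w → φ̄⁻ (w ⊕ z)) (φ̄-inv _)) (trans (cong φ̄⁻ (⊕-cancelʳ (φ̄ x) z)) (φ̄⁻-inv x))
        ; comm = λ z z′ x → trans (cong (λ w → φ̄⁻ (w ⊕ z)) (φ̄-inv _)) (trans (cong φ̄⁻ (⊕-swap (φ̄ x) z′ z))
                   (sym (cong (λ w → φ̄⁻ (w ⊕ z′)) (φ̄-inv _)))) }
        where
        conj : X → E → E
        conj z x = φ⁻ (φ x ⊕ lift z)
        conj-flag : ∀ z → Flag k (conj z)
        conj-flag z i i≤k x y eq = flag⁻ i i≤k _ _ (translate-preserves i (lift z) _ _ (flag i i≤k x y eq))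
        conj-drop : ∀ z x → dropk k (conj z x) ≡ φ̄⁻ (φ̄ (dropk k x) ⊕ z)
        conj-drop z x = trans (sym (descend-drop (flag⁻ k ≤-refl) (φ x ⊕ lift z)))
          (cong φ̄⁻ (trans (dropk-⊕ k (φ x) (lift z)) (cong₂ _⊕_ (sym (descend-drop (flag k ≤-refl) x)) (dropk-pad k z))))

      -- Translation by the class of `unit k′` is an involution without fixed points; as k is less
      -- than D, it preserves each class modulo the first D coordinates.
      open SylowConjugacy prime[2] _≟ᵥ_ (Vec↔Fin (m ∸ k)) _R_ refl trans (λ x y → dropk D (lift x) ≟ᵥ dropk D (lift y))
        (_⊕ z₀) (λ x → ⊕-cancelʳ x z₀) (λ x → ⊕-≢ x z₀ (dropk-unit-≢𝟎 k′))
        (λ x → lift-⊕ x z₀ (trans (dropD-lift (unit k′)) (dropk-unit D k′ k<D))) 𝒢 R-elem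

      -- Translations are transitive, so a map commuting with all of them is determined by its value
      -- at 0.
      is-translation : ∀ y → (∀ x → y x R x × y x ≢ x) → (∀ z x → y (x ⊕ z) ≡ y x ⊕ z) →
        (∀ x → y x ≡ x ⊕ y 𝟎) × y 𝟎 ≢ 𝟎 × dropk D (lift (y 𝟎)) ≡ 𝟎
      is-translation y valid comm =
        (λ x → trans (cong y (sym (⊕-identityˡ x))) (trans (comm x 𝟎) (⊕-comm (y 𝟎) x))) ,
        proj₂ (valid 𝟎) ,
        trans (proj₁ (valid 𝟎)) (trans (cong (λ x → dropk D (lift x)) (sym (dropk-𝟎 k)))
          (trans (dropD-lift 𝟎) (dropk-𝟎 D)))

    record Refined : Set where
      field
        S′ T′ : G → Bool
        ψ ψ⁻ : E → E
        γ γ′ : LinIso m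
        S′≡ : S′ ≡ twist γ S
        T′≡ : T′ ≡ twist γ′ T
        pres-γ : Preserves d (to γ)
        pres-γ′ : Preserves d (to γ′)
        adm : Admissible d S′ T′ ψ ψ⁻
        flag-ψ : Flag (suc k) ψ
        flag-ψ⁻ : Flag (suc k) ψ⁻

    private
      -- A coset of level k + 1 consists of two cosets of level k differing by `unit k′`. In the new
      -- coordinates θ turns the shift by `unit k′` into itself modulo level k, so it keeps such
      -- pairs together.
      next-level : (θ : E → E) (γ γ′ : LinIso m) (w w′ : E) → Flag k θ → (∀ i → i ≤ k → Preserves i (from γ)) → (∀ i → i ≤ k → Preserves i (to γ′)) →
        to γ w ≡ unit k′ → to γ′ w′ ≡ unit k′ → (∀ y → dropk k (θ (y ⊕ w)) ≡ dropk k (θ y ⊕ w′)) → Flag (suc k) (to γ′ ∘ θ ∘ from γ)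
      next-level θ γ γ′ w w′ fl fγ fγ′ γw γ′w′ shift i i≤ with m≤n⇒m<n∨m≡n i≤
      ... | inj₁ (s≤s i≤k) = λ x y eq → fγ′ i i≤k _ _ (fl i i≤k _ _ (fγ i i≤k x y eq))
      ... | inj₂ refl = λ x y eq → next x y (dropk-suc k′ (x ⊕ y) (dropk-≡⇒𝟎 (suc k) x y eq))
        where
        ψ = to γ′ ∘ θ ∘ from γ
        pk : Preserves k ψ
        pk x y eq = fγ′ k ≤-refl _ _ (fl k ≤-refl _ _ (fγ k ≤-refl x y eq))
        next : ∀ x y → dropk k (x ⊕ y) ≡ 𝟎 ⊎ dropk k (x ⊕ y) ≡ dropk k (unit k′) → dropk (suc k) (ψ x) ≡ dropk (suc k) (ψ y)
        next x y (inj₁ eq) = dropk-mono (n≤1+n k) _ _ (pk x y (dropk-𝟎⇒≡ k x y eq))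
        next x y (inj₂ eq) = trans (dropk-mono (n≤1+n k) _ _ (begin
            dropk k (ψ x)   ≡⟨ pk x (y ⊕ unit k′) (dropk-𝟎⇒≡ k x (y ⊕ unit k′)
                                                               (trans (cong (dropk k) (sym (⊕-assoc x y (unit k′)))) (dropk-≡⇒𝟎 k (x ⊕ y) (unit k′) eq))) ⟩
            dropk k (ψ (y ⊕ unit k′))   ≡⟨ cong (λ v → dropk k (to γ′ (θ v))) (trans (from-⊕ γ y (unit k′))
                                                               (cong (from γ y ⊕_) (trans (cong (from γ) (sym γw)) (from-to γ w)))) ⟩
            dropk k (to γ′ (θ (from γ y ⊕ w)))   ≡⟨ fγ′ k ≤-refl _ _ (shift (from γ y)) ⟩
            dropk k (to γ′ (θ (from γ y) ⊕ w′))   ≡⟨ cong (dropk k) (trans (to-⊕ γ′ _ w′) (cong (ψ y ⊕_) γ′w′)) ⟩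
            dropk k (ψ y ⊕ unit k′)   ∎))
          (trans (dropk-⊕ (suc k) (ψ y) (unit k′)) (trans (cong (dropk (suc k) (ψ y) ⊕_) (dropk-unit (suc k) k′ ≤-refl)) (⊕-identityʳ _)))
          where open ≡-Reasoning

    -- The centralising maps `y` and `y″` are translations by vectors z and z′, and φ composed with
    -- the lifted conjugator turns the first into the second modulo level k. Base changes sending
    -- the lifts of z and z′ to `unit k′` on the two sides make the next level invariant.
    refine : ¬ ¬ Refined
    refine ¬r = conjugate-centralized translations conjugates λ (y , y′ , vy , vy′ , cy , cy′ , a , b , e , ya) →
      let
        y″ : X → X
        y″ x = φ̄ (y′ (φ̄⁻ x))
        y-tr , z≢0 , zD = is-translation y vy (λ z x → cy (Finite.∈-elements (Vec↔Fin (m ∸ k)) z) x)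
        y″-tr , z′≢0 , z′D = is-translation y″
          (λ x → subst (y″ x R_) (φ̄-inv x) (descend-R (presD A) (proj₁ (vy′ (φ̄⁻ x)))) ,
                 λ eq → proj₂ (vy′ (φ̄⁻ x)) (trans (sym (φ̄⁻-inv _)) (cong φ̄⁻ eq)))
          (λ z x → trans (cong (φ̄ ∘ y′) (cong (λ w → φ̄⁻ (w ⊕ z)) (sym (φ̄-inv x))))
                     (trans (cong φ̄ (cy′ (Finite.∈-elements (Vec↔Fin (m ∸ k)) z) (φ̄⁻ x))) (φ̄-inv _)))
        z = y 𝟎
        z′ = y″ 𝟎
        w = lift z
        w′ = lift z′
        γ , γw , γ-pres = eliminate k′ w (λ eq → z≢0 (trans (sym (dropk-pad k z)) eq))
        γ′ , γ′w′ , γ′-pres = eliminate k′ w′ (λ eq → z′≢0 (trans (sym (dropk-pad k z′)) eq))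
        d-case : ∀ v → dropk D v ≡ 𝟎 → d ≤ k ⊎ (k < d × dropk d v ≡ 𝟎)
        d-case v v0 = d-case′ D-cases v v0
        χ = φ ∘ σ e
        χ⁻ = σ⁻ e ∘ φ⁻
        χ-flag : Flag k χ
        χ-flag i i≤k x x′ eq = flag i i≤k _ _ (σ-flag e i i≤k x x′ eq)
        χ⁻-flag : Flag k χ⁻
        χ⁻-flag i i≤k x x′ eq = σ⁻-flag e i i≤k _ _ (flag⁻ i i≤k x x′ eq)
        χ̄ : ∀ x → dropk k (χ x) ≡ φ̄ (a (dropk k x))
        χ̄ x = trans (sym (descend-drop (flag k ≤-refl) (σ e x))) (cong φ̄ (σ-a e x))
        shift : ∀ x → dropk k (χ (x ⊕ w)) ≡ dropk k (χ x ⊕ w′)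
        shift x = begin
          dropk k (χ (x ⊕ w))   ≡⟨ χ̄ (x ⊕ w) ⟩
          φ̄ (a (dropk k (x ⊕ w)))   ≡⟨ cong (φ̄ ∘ a) (trans (dropk-⊕ k x w) (cong (dropk k x ⊕_) (dropk-pad k z))) ⟩
          φ̄ (a (dropk k x ⊕ z))   ≡⟨ cong (φ̄ ∘ a) (sym (y-tr (dropk k x))) ⟩
          φ̄ (a (y (dropk k x)))   ≡⟨ cong φ̄ (sym (ya (dropk k x))) ⟩
          φ̄ (y′ (a (dropk k x)))   ≡⟨ cong (φ̄ ∘ y′) (sym (φ̄⁻-inv _)) ⟩
          y″ (φ̄ (a (dropk k x)))   ≡⟨ y″-tr _ ⟩
          φ̄ (a (dropk k x)) ⊕ z′   ≡⟨ cong₂ _⊕_ (sym (χ̄ x)) (sym (dropk-pad k z′)) ⟩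
          dropk k (χ x) ⊕ dropk k w′   ≡⟨ sym (dropk-⊕ k (χ x) w′) ⟩
          dropk k (χ x ⊕ w′)   ∎
        B = adm-∘ A (adm e)
        shift⁻ : ∀ x → dropk k (χ⁻ (x ⊕ w′)) ≡ dropk k (χ⁻ x ⊕ w)
        shift⁻ x = trans (χ⁻-flag k ≤-refl _ _ (trans (cong (λ u → dropk k (u ⊕ w′)) (sym (rightInv B x))) (sym (shift (χ⁻ x)))))
          (cong (dropk k) (leftInv B (χ⁻ x ⊕ w)))
      in ¬r record
        { S′ = twist γ S ; T′ = twist γ′ T ; ψ = to γ′ ∘ χ ∘ from γ ; ψ⁻ = to γ ∘ χ⁻ ∘ from γ′
        ; γ = γ ; γ′ = γ′ ; S′≡ = refl ; T′≡ = refl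
        ; pres-γ = proj₁ (γ-pres d (d-case w zD)) ; pres-γ′ = proj₁ (γ′-pres d (d-case w′ z′D))
        ; adm = adm-∘ (adm-twist γ′ (γ′-pres d (d-case w′ z′D))) (adm-∘ B (adm-inv (adm-twist γ (γ-pres d (d-case w zD)))))
        ; flag-ψ = next-level χ γ γ′ w w′ χ-flag (λ i i≤ → proj₂ (γ-pres i (inj₁ i≤))) (λ i i≤ → proj₁ (γ′-pres i (inj₁ i≤))) γw γ′w′ shift
        ; flag-ψ⁻ = next-level χ⁻ γ′ γ w′ w χ⁻-flag (λ i i≤ → proj₂ (γ′-pres i (inj₁ i≤))) (λ i i≤ → proj₁ (γ-pres i (inj₁ i≤))) γ′w′ γw shift⁻ }
      where
      open ≡-Reasoning
      d-case′ : D ≡ d ⊎ (D ≡ m × d ≤ k) → ∀ v → dropk D v ≡ 𝟎 → d ≤ k ⊎ (k < d × dropk d v ≡ 𝟎)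
      d-case′ (inj₁ eq) v v0 = inj₂ (subst (k <_) eq k<D , subst (λ i → dropk i v ≡ 𝟎) eq v0)
      d-case′ (inj₂ (_ , d≤k)) v v0 = inj₁ d≤k

-- The finite search for linear maps

module FiniteCheck where

  -- A triangular map ψ fixing 0 and the basis satisfies ψ(1 , u) = ψ(0 , u) + (1 , 0), so it is stored as the table
  -- u ↦ ψ(0 , u) on F₂⁴; a table may be partial, and a claim checked on it holds for every completion.
  Point Value : Set
  Point = Vec Bool 4
  Value = Vec Bool 5

  infixl 6 _⊻_
  _⊻_ : ∀ {n} → Vec Bool n → Vec Bool n → Vec Bool n
  _⊻_ = zipWith _xor_

  _==_ : ∀ {n} → Vec Bool n → Vec Bool n → Bool
  [] == [] = true
  (true ∷ x) == (true ∷ y) = x == y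
  (false ∷ x) == (false ∷ y) = x == y
  (_ ∷ x) == (_ ∷ y) = false

  ==-sound : ∀ {n} (x y : Vec Bool n) → (x == y) ≡ true → x ≡ y
  ==-sound [] [] eq = refl
  ==-sound (true ∷ x) (true ∷ y) eq = cong (true ∷_) (==-sound x y eq)
  ==-sound (false ∷ x) (false ∷ y) eq = cong (false ∷_) (==-sound x y eq)

  isZero : ∀ {n} → Vec Bool n → Bool
  isZero [] = true
  isZero (true ∷ x) = false
  isZero (false ∷ x) = isZero x

  -- u lies in every subspace of the coordinate flag that contains v.
  under : ∀ {n} → Vec Bool n → Vec Bool n → Bool
  under [] [] = true
  under (a ∷ u) (b ∷ v) = (isZero (a ∷ u) ∨ not (isZero (b ∷ v))) ∧ under u v

  data Tab : ℕ → Set where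
    leaf : Maybe Value → Tab 0
    node : ∀ {n} → Tab n → Tab n → Tab (suc n)

  get : ∀ {n} → Tab n → Vec Bool n → Maybe Value
  get (leaf m) [] = m
  get (node l r) (false ∷ u) = get l u
  get (node l r) (true ∷ u) = get r u

  put : ∀ {n} → Vec Bool n → Value → Tab n → Tab n
  put [] y (leaf _) = leaf (just y)
  put (false ∷ u) y (node l r) = node (put u y l) r
  put (true ∷ u) y (node l r) = node l (put u y r)

  empty : ∀ n → Tab n
  empty zero = leaf nothing
  empty (suc n) = node (empty n) (empty n)

  links : Maybe Value → Maybe Value → Value → Bool
  links (just a) (just b) y = (a ⊻ b) == y
  links _ _ _ = false

  isLink : Tab 4 → Point → Point → Value → Bool
  isLink P v u y = under u v ∧ links (get P u) (get P (u ⊻ v)) y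

  words : ∀ n → List (Vec Bool n)
  words zero = [] ∷ []
  words (suc n) = map (false ∷_) (words n) ++ map (true ∷_) (words n)

  -- Restricting to points with last bit 0 loses nothing: u and u ⊻ v yield the same difference. If
  -- the last bit of v is 1, one of the two has last bit 0; if it is 0, `under u v` forces the last
  -- bit of u to be 0.
  bases : List Point
  bases = map (λ w → w Vec.++ (false ∷ [])) (words 3)

  step : Tab 4 → Point → Value → Bool
  step P v y = any (λ u → isLink P v u y) bases

  -- Values are stored relative to the first coordinate of e. Passing to an e′ whose first
  -- coordinate differs by b shifts the first entry by b.
  flip : Bool → Value → Value
  flip b (y ∷ ys) = (b xor y) ∷ ys

  meetAt : Tab 4 → Bool → Point → Maybe Value → Maybe Value → Bool
  meetAt P b v (just a) (just a′) = step P v (flip b (a ⊻ a′))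
  meetAt _ _ _ _ _ = false

  meet : Tab 4 → Point → Bool → Point → Bool
  meet P v b v′ = any (λ u → under u v ∧ meetAt P b v′ (get P u) (get P (u ⊻ v))) bases

  zigzag : Tab 4 → Point → Value → Vec Bool 5 → Bool
  zigzag P v y (b ∷ v′) = step P v′ (flip b y) ∧ meet P v b v′

  -- Either one link, or three links through one further vector; the 32 words give its tail and the
  -- difference of the first coordinates. `verified` confirms that chains this short suffice.
  reach : Tab 4 → Point → Value → Bool
  reach P v y = step P v y ∨ any (zigzag P v y) (words 5)

  bits : ∀ n → ℕ → Vec Bool n
  bits zero m = []
  bits (suc n) m = (m % 2 ≡ᵇ 1) ∷ bits n (m / 2)

  scaleᵇ : ∀ {n} → Bool → Vec Bool n → Vec Bool n
  scaleᵇ true w = w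
  scaleᵇ false w = replicate _ false

  shear : ℕ → ℕ → Point → Value
  shear m₃ m₄ v@(_ ∷ _ ∷ x₃ ∷ x₄ ∷ []) = ((false ∷ v) ⊻ scaleᵇ x₃ (bits 3 m₃ Vec.++ false ∷ false ∷ [])) ⊻ scaleᵇ x₄ (bits 4 m₄ Vec.++ false ∷ [])

  leafOK : ℕ → ℕ → Tab 4 → Bool
  leafOK m₃ m₄ P = all (λ v → reach P v (shear m₃ m₄ v)) (words 4)

  -- ask branches on the next unknown bit of ψ; use m₃ m₄ claims that the shear adding the binary expansions of m₃ and m₄
  -- to the images of the last two basis vectors works, whatever the remaining bits are.
  data Plan : Set where
    ask : Plan → Plan → Plan
    use : ℕ → ℕ → Plan

  verify : Plan → List Point → (Point → Vec Bool 4) → Tab 4 → Bool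
  verify (use m₃ m₄) _ h P = leafOK m₃ m₄ P
  verify (ask l r) [] h P = false
  verify (ask l r) (u ∷ us) h P = verify l us h (put u (false ∷ h u) P) ∧ verify r us h (put u (true ∷ h u) P)

  -- The top five layers of the plan ask for the parameters of `upper`. They must all be known
  -- before any table can be filled, so a plan stopping inside these layers is rejected.
  verifyBits : ∀ m → Plan → (Vec Bool m → Plan → Bool) → Bool
  verifyBits zero pl f = f [] pl
  verifyBits (suc m) (use _ _) f = false
  verifyBits (suc m) (ask l r) f = verifyBits m l (f ∘ (false ∷_)) ∧ verifyBits m r (f ∘ (true ∷_))

  -- The coordinates of ψ(0 , u) other than the first: two of them are x₃, x₄, one is off by a multiple of x₃x₄, and one
  -- by a function of x₂, x₃, x₄ vanishing at 0 and at the basis.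
  cubic : Vec Bool 5 → Bool → Bool → Bool → Bool
  cubic (_ ∷ b₁ ∷ b₂ ∷ b₃ ∷ b₄ ∷ []) true true false = b₁
  cubic (_ ∷ b₁ ∷ b₂ ∷ b₃ ∷ b₄ ∷ []) true false true = b₂
  cubic (_ ∷ b₁ ∷ b₂ ∷ b₃ ∷ b₄ ∷ []) false true true = b₃
  cubic (_ ∷ b₁ ∷ b₂ ∷ b₃ ∷ b₄ ∷ []) true true true = b₄
  cubic _ _ _ _ = false

  quadratic : Vec Bool 5 → Bool → Bool → Bool
  quadratic (c ∷ _) true true = c
  quadratic _ _ _ = false

  upper : Vec Bool 5 → Point → Vec Bool 4
  upper b (x₁ ∷ x₂ ∷ x₃ ∷ x₄ ∷ []) = (x₁ xor cubic b x₂ x₃ x₄) ∷ (x₂ xor quadratic b x₃ x₄) ∷ x₃ ∷ x₄ ∷ []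

  -- `basics` are 0 and the basis, where ψ is known; `order` lists the other eleven points, where
  -- the first coordinate is free. Its arrangement determines how early a branch of the plan can
  -- stop.
  order basics : List Point
  order = map (bits 4) (6 ∷ 13 ∷ 14 ∷ 11 ∷ 5 ∷ 15 ∷ 9 ∷ 10 ∷ 12 ∷ 7 ∷ 3 ∷ [])
  basics = map (bits 4) (0 ∷ 1 ∷ 2 ∷ 4 ∷ 8 ∷ [])

  initial : (Point → Vec Bool 4) → Tab 4
  initial h = List.foldr (λ u → put u (false ∷ h u)) (empty 4) basics

  -- Found by computer search.
  plan : Plan
  plan =
      ask (ask (ask (ask (ask (ask (ask (use 0 0) (ask (ask (use 0 0) (ask (use 0 0) (ask (use 0 0) (ask (use 0 0) (use 0 1))))) (use 0 1))) (ask (ask (ask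
      (ask (use 0 0) (ask (use 1 1) (ask (use 1 0) (ask (use 1 0) (use 1 1))))) (ask (use 0 0) (use 1 1))) (ask (ask (use 0 0) (use 1 0)) (ask (ask (use 0
      0) (ask (ask (use 0 0) (use 0 1)) (use 0 1))) (use 1 0)))) (ask (ask (ask (use 0 0) (use 1 0)) (ask (use 0 0) (use 1 0))) (ask (ask (use 0 0) (use 1
      0)) (ask (use 0 1) (use 1 0)))))) (ask (ask (use 0 0) (ask (ask (use 0 0) (use 0 2)) (ask (use 0 0) (use 0 3)))) (ask (ask (ask (ask (use 0 0) (use 1
      3)) (ask (use 0 0) (use 1 1))) (ask (ask (use 0 0) (use 1 2)) (ask (use 0 0) (use 1 1)))) (ask (ask (ask (use 0 0) (use 1 0)) (ask (use 0 1) (use 1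
      0))) (ask (ask (use 0 0) (use 1 0)) (ask (use 0 1) (use 1 0))))))) (ask (ask (ask (ask (ask (use 0 0) (use 0 2)) (ask (use 0 0) (use 0 1))) (ask (ask
      (use 0 0) (use 0 3)) (ask (use 0 0) (use 0 1)))) (ask (ask (ask (ask (use 0 0) (use 1 3)) (ask (use 0 0) (use 1 1))) (ask (ask (use 0 0) (use 1 0))
      (ask (use 0 1) (use 1 0)))) (ask (ask (ask (use 0 0) (use 1 2)) (ask (use 0 0) (use 1 1))) (ask (ask (use 0 0) (use 1 0)) (ask (use 0 1) (use 1
      0)))))) (ask (ask (ask (use 0 2) (ask (use 0 0) (use 0 0))) (ask (ask (use 0 0) (use 0 0)) (use 0 3))) (ask (ask (ask (ask (use 0 0) (use 1 0)) (ask
      (use 0 2) (use 1 0))) (ask (ask (use 0 0) (use 1 0)) (ask (use 0 0) (use 1 0)))) (ask (ask (ask (use 0 0) (use 1 0)) (ask (use 0 0) (use 1 0))) (ask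
      (ask (use 0 0) (use 1 0)) (ask (use 0 3) (use 1 0)))))))) (ask (ask (ask (ask (use 0 0) (ask (ask (use 0 2) (use 0 3)) (use 0 1))) (ask (ask (ask (ask
      (use 0 0) (use 1 2)) (ask (use 0 0) (use 1 3))) (ask (ask (use 0 0) (use 1 0)) (ask (use 0 0) (use 1 0)))) (ask (ask (ask (use 0 0) (use 1 0)) (ask
      (use 0 0) (use 1 0))) (ask (ask (use 0 1) (use 1 0)) (ask (use 0 1) (use 1 0)))))) (ask (ask (use 0 0) (ask (ask (use 0 2) (use 0 0)) (ask (use 0 0)
      (use 0 3)))) (ask (ask (ask (ask (use 0 0) (use 1 0)) (ask (use 0 0) (use 1 3))) (ask (ask (use 0 0) (use 1 2)) (ask (use 0 0) (use 1 0)))) (ask (ask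
      (ask (use 0 2) (use 1 0)) (ask (use 0 0) (use 1 0))) (ask (ask (use 0 0) (use 1 0)) (ask (use 0 3) (use 1 0))))))) (ask (ask (ask (ask (ask (use 0 0)
      (use 0 0)) (ask (use 0 2) (use 0 0))) (ask (ask (use 0 0) (use 0 0)) (ask (use 0 0) (use 0 3)))) (ask (ask (ask (ask (use 0 0) (use 1 0)) (ask (use 0
      0) (use 1 3))) (ask (ask (use 0 2) (use 1 0)) (ask (use 0 0) (use 1 0)))) (ask (ask (ask (use 0 0) (use 1 2)) (ask (use 0 0) (use 1 0))) (ask (ask
      (use 0 0) (use 1 0)) (ask (use 0 3) (use 1 0)))))) (ask (ask (ask (use 0 2) (ask (use 0 0) (use 0 3))) (ask (ask (use 0 2) (use 0 0)) (use 0 3))) (ask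
      (ask (ask (ask (use 0 2) (use 1 0)) (ask (use 0 2) (use 1 3))) (ask (ask (use 0 2) (use 1 2)) (ask (use 0 3) (use 1 3)))) (ask (ask (ask (use 0 2)
      (use 1 2)) (ask (use 0 3) (use 1 3))) (ask (ask (use 0 3) (use 1 2)) (ask (use 0 3) (use 1 0))))))))) (ask (ask (ask (ask (ask (ask (ask (use 0 0)
      (use 2 2)) (ask (use 2 0) (use 0 2))) (ask (ask (use 2 0) (use 0 2)) (ask (use 2 0) (use 2 3)))) (ask (ask (ask (use 0 0) (use 3 3)) (ask (use 3 0)
      (use 0 2))) (ask (ask (use 3 0) (use 0 2)) (ask (use 3 0) (use 3 2))))) (ask (ask (ask (use 0 0) (ask (use 0 0) (use 2 1))) (ask (ask (use 2 0) (use 2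
      0)) (ask (use 0 0) (use 2 1)))) (ask (ask (ask (use 0 0) (use 3 1)) (use 0 0)) (ask (ask (use 0 0) (use 3 1)) (ask (use 3 0) (use 3 0)))))) (ask (ask
      (ask (use 2 0) (ask (ask (use 0 0) (use 2 1)) (ask (use 0 0) (use 0 1)))) (ask (ask (ask (use 0 0) (use 3 1)) (ask (use 0 0) (use 0 1))) (use 3 0)))
      (ask (ask (use 2 0) (ask (ask (use 2 0) (use 2 2)) (ask (use 0 0) (use 2 1)))) (ask (ask (ask (use 0 0) (use 3 1)) (ask (use 3 0) (use 3 2))) (use 3
      0))))) (ask (ask (ask (ask (ask (ask (use 2 2) (use 0 0)) (ask (use 0 0) (use 2 3))) (ask (ask (use 2 2) (use 2 3)) (ask (use 0 1) (use 2 3)))) (ask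
      (ask (ask (use 0 0) (use 3 3)) (ask (use 3 2) (use 0 0))) (ask (ask (use 3 2) (use 3 3)) (ask (use 3 2) (use 0 1))))) (ask (ask (ask (use 0 0) (ask
      (use 0 0) (use 0 0))) (ask (ask (use 0 2) (use 2 0)) (ask (use 0 0) (use 0 3)))) (ask (ask (ask (use 0 0) (use 0 0)) (use 0 0)) (ask (ask (use 0 2)
      (use 0 0)) (ask (use 3 0) (use 0 3)))))) (ask (ask (ask (use 2 0) (ask (ask (use 2 2) (use 0 0)) (ask (use 0 0) (use 2 3)))) (ask (ask (ask (use 0 0)
      (use 3 3)) (ask (use 3 2) (use 0 0))) (use 3 0))) (ask (ask (use 2 0) (ask (ask (use 0 2) (use 2 0)) (ask (use 0 3) (use 0 3)))) (ask (ask (ask (use 0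
      2) (use 0 2)) (ask (use 3 0) (use 0 3))) (use 3 0))))))) (ask (ask (ask (ask (ask (ask (ask (use 0 4) (ask (use 0 0) (use 0 0))) (ask (ask (use 0 0)
      (use 0 0)) (use 0 5))) (ask (ask (ask (ask (use 0 0) (use 1 0)) (ask (use 0 4) (use 1 0))) (ask (ask (use 0 0) (use 1 0)) (ask (use 0 0) (use 1 0))))
      (ask (ask (ask (use 0 0) (use 1 0)) (ask (use 0 0) (use 1 0))) (ask (ask (use 0 0) (use 1 0)) (ask (use 0 5) (use 1 0)))))) (ask (ask (ask (use 0 2)
      (use 0 3)) (ask (use 0 3) (use 0 2))) (ask (ask (ask (ask (use 0 0) (use 1 5)) (ask (use 0 4) (use 1 0))) (ask (ask (use 0 0) (use 1 5)) (ask (use 0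
      4) (use 1 0)))) (ask (ask (ask (use 0 0) (use 1 4)) (ask (use 0 5) (use 1 0))) (ask (ask (use 0 0) (use 1 4)) (ask (use 0 5) (use 1 0))))))) (ask (ask
      (ask (ask (ask (use 0 0) (use 0 3)) (ask (use 0 0) (use 0 2))) (ask (ask (use 0 0) (use 0 2)) (ask (use 0 0) (use 0 3)))) (ask (ask (ask (ask (use 0
      0) (use 1 5)) (ask (use 0 4) (use 1 0))) (ask (ask (use 0 0) (use 1 4)) (ask (use 0 5) (use 1 0)))) (ask (ask (ask (use 0 0) (use 1 5)) (ask (use 0 4)
      (use 1 0))) (ask (ask (use 0 0) (use 1 4)) (ask (use 0 5) (use 1 0)))))) (ask (ask (ask (use 0 6) (ask (use 0 0) (ask (use 0 0) (ask (ask (use 0 0)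
      (use 0 1)) (use 0 7))))) (ask (ask (use 0 0) (ask (use 0 0) (ask (use 0 6) (ask (use 0 0) (use 0 1))))) (use 0 7))) (ask (ask (ask (ask (use 0 0) (ask
      (use 1 7) (use 1 0))) (ask (use 0 6) (use 1 0))) (ask (ask (use 0 0) (use 1 0)) (ask (ask (use 0 6) (ask (use 0 0) (use 0 1))) (use 1 0)))) (ask (ask
      (ask (use 0 0) (use 1 0)) (ask (ask (ask (use 0 0) (use 0 1)) (use 0 7)) (use 1 0))) (ask (ask (use 0 0) (ask (use 1 0) (use 1 6))) (ask (use 0 7)
      (use 1 0)))))))) (ask (ask (ask (ask (ask (use 0 4) (ask (use 0 6) (use 0 7))) (ask (ask (use 0 7) (use 0 6)) (use 0 5))) (ask (ask (ask (ask (use 0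
      4) (use 1 0)) (ask (use 0 4) (use 1 0))) (ask (ask (use 0 0) (use 1 4)) (ask (use 0 0) (use 1 4)))) (ask (ask (ask (use 0 0) (use 1 4)) (ask (use 0 0)
      (use 1 4))) (ask (ask (use 0 5) (use 1 0)) (ask (use 0 5) (use 1 0)))))) (ask (ask (ask (use 0 2) (use 0 3)) (ask (use 0 3) (use 0 2))) (ask (ask (ask
      (ask (use 0 0) (use 1 0)) (ask (ask (use 0 0) (use 0 6)) (use 1 0))) (ask (ask (ask (use 0 6) (use 0 0)) (use 1 0)) (ask (use 0 0) (use 1 0)))) (ask
      (ask (ask (ask (use 0 0) (use 0 6)) (use 1 0)) (ask (use 0 0) (use 1 0))) (ask (ask (use 0 0) (use 1 0)) (ask (ask (use 0 6) (use 0 0)) (use 1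
      0))))))) (ask (ask (ask (ask (ask (use 0 0) (ask (use 0 0) (ask (use 0 4) (use 0 0)))) (ask (ask (use 0 0) (ask (use 0 0) (use 0 5))) (use 0 0))) (ask
      (ask (ask (use 0 0) (ask (use 0 4) (use 0 0))) (use 0 0)) (ask (use 0 0) (ask (use 0 0) (ask (use 0 0) (use 0 5)))))) (ask (ask (ask (ask (use 0 0)
      (use 1 0)) (ask (use 0 0) (use 1 0))) (ask (ask (use 0 0) (use 1 0)) (ask (use 0 0) (use 1 0)))) (ask (ask (ask (use 0 0) (use 1 0)) (ask (use 0 0)
      (use 1 0))) (ask (ask (use 0 0) (use 1 0)) (ask (use 0 0) (use 1 0)))))) (ask (ask (ask (use 0 6) (ask (use 0 5) (use 0 4))) (ask (ask (use 0 4) (use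
      0 5)) (use 0 7))) (ask (ask (ask (ask (use 0 6) (use 1 2)) (ask (use 0 6) (use 1 3))) (ask (ask (use 0 2) (use 1 6)) (ask (use 0 3) (use 1 6)))) (ask
      (ask (ask (use 0 2) (use 1 6)) (ask (use 0 3) (use 1 6))) (ask (ask (use 0 7) (use 1 2)) (ask (use 0 7) (use 1 3))))))))) (ask (ask (ask (ask (ask
      (ask (ask (use 0 0) (use 0 4)) (ask (use 0 0) (ask (use 0 0) (use 0 0)))) (ask (ask (use 0 0) (ask (use 0 0) (use 0 0))) (ask (use 0 0) (use 0 5))))
      (ask (ask (ask (use 0 0) (use 0 4)) (ask (use 0 0) (ask (use 0 0) (use 0 0)))) (ask (ask (use 0 0) (ask (use 0 0) (use 0 0))) (ask (use 0 0) (use 0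
      5))))) (ask (ask (ask (ask (use 0 0) (use 0 4)) (ask (ask (use 0 0) (use 1 0)) (use 0 4))) (ask (ask (ask (use 0 0) (use 1 0)) (use 0 5)) (ask (use 0
      0) (use 0 5)))) (ask (ask (ask (ask (use 0 0) (use 1 0)) (use 0 4)) (ask (use 0 0) (use 0 4))) (ask (ask (use 0 0) (use 0 5)) (ask (ask (use 0 0) (use
      1 0)) (use 0 5)))))) (ask (ask (ask (ask (ask (use 0 0) (use 0 4)) (ask (ask (use 0 0) (use 1 0)) (use 0 5))) (ask (ask (ask (use 0 0) (use 1 0)) (use
      0 4)) (ask (use 0 0) (use 0 5)))) (ask (ask (ask (ask (use 0 0) (use 1 0)) (use 0 4)) (ask (use 0 0) (use 0 5))) (ask (ask (use 0 0) (use 0 4)) (ask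
      (ask (use 0 0) (use 1 0)) (use 0 5))))) (ask (ask (ask (ask (use 2 0) (use 2 4)) (ask (use 2 0) (ask (use 0 2) (use 0 2)))) (ask (ask (use 2 0) (ask
      (use 0 2) (use 0 2))) (ask (use 2 0) (use 2 5)))) (ask (ask (ask (use 3 0) (use 3 5)) (ask (use 3 0) (ask (use 0 2) (use 0 2)))) (ask (ask (use 3 0)
      (ask (use 0 2) (use 0 2))) (ask (use 3 0) (use 3 4))))))) (ask (ask (ask (ask (ask (ask (use 0 4) (ask (use 0 4) (use 1 5))) (ask (use 0 0) (use 0
      0))) (ask (ask (use 0 0) (use 0 0)) (ask (use 0 5) (ask (use 0 5) (use 1 4))))) (ask (ask (ask (ask (use 0 4) (use 1 5)) (use 0 4)) (ask (use 0 0)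
      (use 0 0))) (ask (ask (use 0 0) (use 0 0)) (ask (ask (use 0 5) (use 1 4)) (use 0 5))))) (ask (ask (ask (ask (use 0 0) (use 0 0)) (ask (use 0 4) (ask
      (use 0 0) (ask (use 0 0) (use 0 7))))) (ask (ask (use 0 5) (ask (use 0 0) (ask (use 0 6) (use 0 0)))) (ask (use 0 0) (use 0 0)))) (ask (ask (ask (ask
      (use 0 0) (ask (use 0 6) (use 0 0))) (use 0 4)) (ask (use 0 0) (use 0 0))) (ask (ask (use 0 0) (use 0 0)) (ask (ask (use 0 0) (ask (use 0 0) (use 0
      7))) (use 0 5)))))) (ask (ask (ask (ask (ask (use 0 0) (use 0 4)) (ask (use 0 0) (use 0 0))) (ask (ask (use 0 0) (use 0 0)) (ask (use 0 0) (use 0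
      5)))) (ask (ask (ask (use 0 0) (use 0 0)) (ask (use 0 5) (use 0 0))) (ask (ask (use 0 4) (use 0 0)) (ask (use 0 0) (use 0 0))))) (ask (ask (ask (ask
      (use 0 6) (ask (use 0 6) (use 2 4))) (ask (use 0 2) (use 2 0))) (ask (ask (use 0 2) (use 2 0)) (ask (use 0 7) (ask (use 0 7) (use 1 6))))) (ask (ask
      (ask (ask (use 0 6) (use 1 7)) (use 0 6)) (ask (use 0 2) (use 0 3))) (ask (ask (use 0 2) (use 0 3)) (ask (ask (use 0 7) (use 1 6)) (use 0 7)))))))))

  verified : verifyBits 5 plan (λ b pl → verify pl order (upper b) (initial (upper b))) ≡ true
  verified = refl

  any-sound : ∀ {A : Set} (f : A → Bool) xs → any f xs ≡ true → Σ A λ x → f x ≡ true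
  any-sound f (x ∷ xs) eq with f x in fx
  ... | true = x , fx
  ... | false = any-sound f xs eq

  all-sound : ∀ {A : Set} (f : A → Bool) xs → all f xs ≡ true → ∀ {x} → x ∈ xs → f x ≡ true
  all-sound f (x ∷ xs) eq (here refl) = ∧-conicalˡ (f x) _ eq
  all-sound f (x ∷ xs) eq (there x∈) = all-sound f xs (∧-conicalʳ (f x) _ eq) x∈

  ∈-words : ∀ {n} (x : Vec Bool n) → x ∈ words n
  ∈-words [] = here refl
  ∈-words (false ∷ x) = ∈-++⁺ˡ (∈-map⁺ (false ∷_) (∈-words x))
  ∈-words {suc n} (true ∷ x) = ∈-++⁺ʳ (map (false ∷_) (words n)) (∈-map⁺ (true ∷_) (∈-words x))

  bit : Bool → Fin 2
  bit false = zero
  bit true = suc zero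

  emb : ∀ {n} → Vec Bool n → Vec (Fin 2) n
  emb = Vec.map bit

  bit-xor : ∀ a b → bit (a xor b) ≡ addC (bit a) (bit b)
  bit-xor false false = refl
  bit-xor false true = refl
  bit-xor true false = refl
  bit-xor true true = refl

  emb-⊻ : ∀ {n} (x y : Vec Bool n) → emb (x ⊻ y) ≡ emb x ⊕ emb y
  emb-⊻ [] [] = refl
  emb-⊻ (a ∷ x) (b ∷ y) = cong₂ _∷_ (bit-xor a b) (emb-⊻ x y)

  emb-surjective : ∀ {n} (x : Vec (Fin 2) n) → Σ (Vec Bool n) λ b → emb b ≡ x
  emb-surjective [] = [] , refl
  emb-surjective (zero ∷ x) = let b , eq = emb-surjective x in false ∷ b , cong (zero ∷_) eq
  emb-surjective (suc zero ∷ x) = let b , eq = emb-surjective x in true ∷ b , cong (suc zero ∷_) eq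

  emb-false : ∀ n → emb (replicate n false) ≡ 𝟎
  emb-false zero = refl
  emb-false (suc n) = cong (zero ∷_) (emb-false n)

  emb-scale : ∀ {n} b (w : Vec Bool n) → emb (scaleᵇ b w) ≡ scale (bit b) (emb w)
  emb-scale false w = emb-false _
  emb-scale true w = refl

  emb-isZero : ∀ {n} (x : Vec Bool n) → emb x ≡ 𝟎 → isZero x ≡ true
  emb-isZero [] eq = refl
  emb-isZero (false ∷ x) eq = emb-isZero x (∷-injectiveʳ eq)
  emb-isZero (true ∷ x) ()

  isZero-emb : ∀ {n} (x : Vec Bool n) → isZero x ≡ true → emb x ≡ 𝟎
  isZero-emb [] eq = refl
  isZero-emb (false ∷ x) eq = cong (zero ∷_) (isZero-emb x eq)

  under-sound : ∀ {n} (u v : Vec Bool n) → under u v ≡ true → ∀ i → dropk i (emb v) ≡ 𝟎 → dropk i (emb u) ≡ 𝟎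
  under-sound [] [] eq zero h = refl
  under-sound [] [] eq (suc i) h = refl
  under-sound (a ∷ u) (b ∷ v) eq (suc i) h = under-sound u v (∧-conicalʳ (isZero (a ∷ u) ∨ not (isZero (b ∷ v))) _ eq) i h
  under-sound (a ∷ u) (b ∷ v) eq zero h = isZero-emb (a ∷ u) (first (∧-conicalˡ _ (under u v) eq))
    where
    first : (isZero (a ∷ u) ∨ not (isZero (b ∷ v))) ≡ true → isZero (a ∷ u) ≡ true
    first q rewrite emb-isZero (b ∷ v) h = trans (sym (∨-identityʳ _)) q

  -- The side condition keeps a link inside the smallest flag subspace containing e; if that subspace lies in L, only the
  -- scalar of the trivial coset occurs.
  data Reach {n} (ψ : Vec (Fin 2) n → Vec (Fin 2) n) : Vec (Fin 2) n → Vec (Fin 2) n → Set where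
    link : ∀ o e → (∀ i → dropk i e ≡ 𝟎 → dropk i o ≡ 𝟎) → Reach ψ e (ψ o ⊕ ψ (o ⊕ e))
    zig  : ∀ {e e′ y y′} → Reach ψ e y → Reach ψ e′ y → Reach ψ e′ y′ → Reach ψ e y′

  module Soundness (ψ : Vec (Fin 2) 5 → Vec (Fin 2) 5) (k : Point → Value)
                   (ψ-k : ∀ a u → ψ (a ∷ emb u) ≡ (a ∷ 𝟎) ⊕ emb (k u)) where

    Consistent : ∀ {n} → (Vec Bool n → Value) → Tab n → Set
    Consistent f (leaf m) = ∀ y → m ≡ just y → f [] ≡ y
    Consistent f (node l r) = Consistent (f ∘ (false ∷_)) l × Consistent (f ∘ (true ∷_)) r

    get-consistent : ∀ {n} (f : Vec Bool n → Value) (P : Tab n) → Consistent f P → ∀ u {y} → get P u ≡ just y → f u ≡ y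
    get-consistent f (leaf m) c [] eq = c _ eq
    get-consistent f (node l r) (cl , cr) (false ∷ u) eq = get-consistent _ l cl u eq
    get-consistent f (node l r) (cl , cr) (true ∷ u) eq = get-consistent _ r cr u eq

    put-consistent : ∀ {n} (f : Vec Bool n → Value) (P : Tab n) → Consistent f P → ∀ u {y} → f u ≡ y → Consistent f (put u y P)
    put-consistent f (leaf m) c [] eq y refl = eq
    put-consistent f (node l r) (cl , cr) (false ∷ u) eq = put-consistent _ l cl u eq , cr
    put-consistent f (node l r) (cl , cr) (true ∷ u) eq = cl , put-consistent _ r cr u eq

    empty-consistent : ∀ n (f : Vec Bool n → Value) → Consistent f (empty n)
    empty-consistent zero f y ()
    empty-consistent (suc n) f = empty-consistent n _ , empty-consistent n _

    Reachᵇ : Fin 2 → Point → Value → Set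
    Reachᵇ a v y = Reach ψ (a ∷ emb v) ((a ∷ 𝟎) ⊕ emb y)

    link-sound : ∀ a v u → under u v ≡ true → Reachᵇ a v (k u ⊻ k (u ⊻ v))
    -- The base point has first coordinate 0, so the first coordinate a of e enters the difference
    -- exactly once.
    link-sound a v u un = subst (Reach ψ (a ∷ emb v)) value (link (zero ∷ emb u) (a ∷ emb v) below)
      where
      below : ∀ i → dropk i (a ∷ emb v) ≡ 𝟎 → dropk i (zero ∷ emb u) ≡ 𝟎
      below zero eq = cong (zero ∷_) (under-sound u v un 0 (∷-injectiveʳ eq))
      below (suc i) eq = under-sound u v un i eq
      value : ψ (zero ∷ emb u) ⊕ ψ ((zero ∷ emb u) ⊕ (a ∷ emb v)) ≡ (a ∷ 𝟎) ⊕ emb (k u ⊻ k (u ⊻ v))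
      value = begin
        ψ (zero ∷ emb u) ⊕ ψ (addC zero a ∷ emb u ⊕ emb v)
          ≡⟨ cong₂ (λ s t → ψ (zero ∷ emb u) ⊕ ψ (s ∷ t)) (CyclicGroup.addC-zeroˡ 1 a) (sym (emb-⊻ u v)) ⟩
        ψ (zero ∷ emb u) ⊕ ψ (a ∷ emb (u ⊻ v))   ≡⟨ cong₂ _⊕_ (ψ-k zero u) (ψ-k a (u ⊻ v)) ⟩
        (𝟎 ⊕ emb (k u)) ⊕ ((a ∷ 𝟎) ⊕ emb (k (u ⊻ v)))   ≡⟨ ⊕-interchange 𝟎 _ (a ∷ 𝟎) _ ⟩
        (𝟎 ⊕ (a ∷ 𝟎)) ⊕ (emb (k u) ⊕ emb (k (u ⊻ v)))   ≡⟨ cong₂ _⊕_ (⊕-identityˡ (a ∷ 𝟎)) (sym (emb-⊻ (k u) _)) ⟩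
        (a ∷ 𝟎) ⊕ emb (k u ⊻ k (u ⊻ v))   ∎
        where open ≡-Reasoning

    links-sound : ∀ m m′ y → links m m′ y ≡ true → Σ Value λ a → Σ Value λ b → m ≡ just a × m′ ≡ just b × a ⊻ b ≡ y
    links-sound (just a) (just b) y eq = a , b , refl , refl , ==-sound _ y eq

    flip-shift : ∀ a b y → (addC a (bit b) ∷ 𝟎) ⊕ emb (flip b y) ≡ (a ∷ 𝟎) ⊕ emb y
    flip-shift a b (y ∷ ys) = cong (_∷ (𝟎 ⊕ emb ys)) (trans (cong (addC (addC a (bit b))) (bit-xor b y)) (lemma a (bit b) (bit y)))
      where
      lemma : ∀ a b y → addC (addC a b) (addC b y) ≡ addC a y
      lemma a b y = trans (CyclicGroup.addC-assoc 1 a b _) (cong (addC a)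
        (trans (sym (CyclicGroup.addC-assoc 1 b b y)) (trans (cong (λ c → addC c y) (addC-self b)) (CyclicGroup.addC-zeroˡ 1 y))))

    module _ (P : Tab 4) (cons : Consistent k P) where

      step-sound : ∀ v y → step P v y ≡ true → ∀ a → Reachᵇ a v y
      step-sound v y eq a with any-sound _ bases eq
      ... | u , eq′ with links-sound (get P u) (get P (u ⊻ v)) y (∧-conicalʳ (under u v) _ eq′)
      ... | _ , _ , e₁ , e₂ , refl rewrite sym (get-consistent k P cons u e₁) | sym (get-consistent k P cons (u ⊻ v) e₂) =
        link-sound a v u (∧-conicalˡ (under u v) _ eq′)

      meetAt-sound : ∀ b v m m′ → meetAt P b v m m′ ≡ true →
        Σ Value λ a → Σ Value λ a′ → m ≡ just a × m′ ≡ just a′ × step P v (flip b (a ⊻ a′)) ≡ true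
      meetAt-sound b v (just a) (just a′) eq = a , a′ , refl , refl , eq

      meet-sound : ∀ v b v′ → meet P v b v′ ≡ true → Σ Value λ y → (∀ a → Reachᵇ a v y) × (∀ a → Reachᵇ a v′ (flip b y))
      meet-sound v b v′ eq with any-sound _ bases eq
      ... | u , eq′ with meetAt-sound b v′ (get P u) (get P (u ⊻ v)) (∧-conicalʳ (under u v) _ eq′)
      ... | _ , _ , e₁ , e₂ , st rewrite sym (get-consistent k P cons u e₁) | sym (get-consistent k P cons (u ⊻ v) e₂) =
        k u ⊻ k (u ⊻ v) , (λ a → link-sound a v u (∧-conicalˡ (under u v) _ eq′)) , step-sound v′ _ st

      reach-sound : ∀ v y → reach P v y ≡ true → ∀ a → Reachᵇ a v y
      reach-sound v y eq a with step P v y in st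
      ... | true = step-sound v y st a
      ... | false with any-sound (zigzag P v y) (words 5) eq
      ... | b ∷ v′ , eq′ with meet-sound v b v′ (∧-conicalʳ (step P v′ (flip b y)) _ eq′)
      ... | y₁ , r , r′ = zig (r a) (subst (Reach ψ _) (flip-shift a b y₁) (r′ (addC a (bit b))))
                             (subst (Reach ψ _) (flip-shift a b y) (step-sound v′ _ (∧-conicalˡ (step P v′ (flip b y)) _ eq′) (addC a (bit b))))

      module _ (m₃ m₄ : ℕ) where
        private
          w₃ w₄ : Vec Bool 5
          w₃ = bits 3 m₃ Vec.++ false ∷ false ∷ []
          w₄ = bits 4 m₄ Vec.++ false ∷ []

        shearₗ : LinIso 5
        shearₗ = transvection (# 4) (emb w₄) refl ∘ₗ transvection (# 3) (emb w₃) refl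

        shearₗ-emb : ∀ a v → LinIso.to shearₗ (a ∷ emb v) ≡ (a ∷ 𝟎) ⊕ emb (shear m₃ m₄ v)
        shearₗ-emb a v@(x₁ ∷ x₂ ∷ x₃ ∷ x₄ ∷ []) = begin
          x ⊕ scale (bit x₃) (emb w₃) ⊕ scale (lookup (x ⊕ scale (bit x₃) (emb w₃)) (# 4)) (emb w₄)
            ≡⟨ cong (λ c → x ⊕ scale (bit x₃) (emb w₃) ⊕ scale c (emb w₄)) coord ⟩
          x ⊕ scale (bit x₃) (emb w₃) ⊕ scale (bit x₄) (emb w₄)
            ≡⟨ cong₂ (λ s t → x ⊕ s ⊕ t) (sym (emb-scale x₃ w₃)) (sym (emb-scale x₄ w₄)) ⟩
          x ⊕ emb (scaleᵇ x₃ w₃) ⊕ emb (scaleᵇ x₄ w₄)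
            ≡⟨ cong (λ z → z ⊕ emb (scaleᵇ x₃ w₃) ⊕ emb (scaleᵇ x₄ w₄))
                 (cong₂ _∷_ (sym (CyclicGroup.addC-zeroʳ 1 a)) (sym (⊕-identityˡ (emb v)))) ⟩
          (a ∷ 𝟎) ⊕ emb (false ∷ v) ⊕ emb (scaleᵇ x₃ w₃) ⊕ emb (scaleᵇ x₄ w₄)
            ≡⟨ trans (cong (_⊕ emb (scaleᵇ x₄ w₄)) (⊕-assoc (a ∷ 𝟎) _ _)) (⊕-assoc (a ∷ 𝟎) _ _) ⟩
          (a ∷ 𝟎) ⊕ (emb (false ∷ v) ⊕ emb (scaleᵇ x₃ w₃) ⊕ emb (scaleᵇ x₄ w₄))
            ≡⟨ cong ((a ∷ 𝟎) ⊕_) (sym (trans (emb-⊻ ((false ∷ v) ⊻ scaleᵇ x₃ w₃) _) (cong (_⊕ emb (scaleᵇ x₄ w₄)) (emb-⊻ (false ∷ v) _)))) ⟩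
          (a ∷ 𝟎) ⊕ emb (shear m₃ m₄ v) ∎
          where
          open ≡-Reasoning
          x = a ∷ emb v
          coord : lookup (x ⊕ scale (bit x₃) (emb w₃)) (# 4) ≡ bit x₄
          coord = trans (lookup-zipWith addC (# 4) x (scale (bit x₃) (emb w₃)))
            (trans (cong (addC (bit x₄)) (lookup-scale (bit x₃) (emb w₃) (# 4) refl)) (CyclicGroup.addC-zeroʳ 1 (bit x₄)))

        leafOK-sound : leafOK m₃ m₄ P ≡ true → ∀ e → Reach ψ e (LinIso.to shearₗ e)
        leafOK-sound eq (a ∷ x) with emb-surjective x
        ... | v , refl = subst (Reach ψ (a ∷ emb v)) (sym (shearₗ-emb a v))
                           (reach-sound v _ (all-sound (λ v → reach P v (shear m₃ m₄ v)) (words 4) eq (∈-words v)) a)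

    -- The plan is followed along the answers given by the actual bits `g`; each answer adds a true
    -- entry to the table.
    verify-sound : (h : Point → Vec Bool 4) (g : Point → Bool) → (∀ u → k u ≡ g u ∷ h u) →
      ∀ pl us P → Consistent k P → verify pl us h P ≡ true → Σ (LinIso 5) λ α → ∀ e → Reach ψ e (LinIso.to α e)
    verify-sound h g kg (use m₃ m₄) us P c eq = shearₗ P c m₃ m₄ , leafOK-sound P c m₃ m₄ eq
    verify-sound h g kg (ask l r) (u ∷ us) P c eq with g u in gu
    ... | false = verify-sound h g kg l us _ (put-consistent k P c u (trans (kg u) (cong (_∷ h u) gu))) (∧-conicalˡ _ _ eq)
    ... | true = verify-sound h g kg r us _ (put-consistent k P c u (trans (kg u) (cong (_∷ h u) gu)))
                   (∧-conicalʳ (verify l us h (put u (false ∷ h u) P)) _ eq)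

  verifyBits-sound : ∀ m pl f → verifyBits m pl f ≡ true → ∀ b → Σ Plan λ pl′ → f b pl′ ≡ true
  verifyBits-sound zero pl f eq [] = pl , eq
  verifyBits-sound (suc m) (ask l r) f eq (false ∷ b) = verifyBits-sound m l _ (∧-conicalˡ _ _ eq) b
  verifyBits-sound (suc m) (ask l r) f eq (true ∷ b) = verifyBits-sound m r _ (∧-conicalʳ (verifyBits m l _) _ eq) b

  linear-in-components : (ψ : Vec (Fin 2) 5 → Vec (Fin 2) 5) (b : Vec Bool 5) (g : Point → Bool) →
    (∀ {u} → u ∈ basics → g u ≡ false) → (∀ a u → ψ (a ∷ emb u) ≡ (a ∷ 𝟎) ⊕ emb (g u ∷ upper b u)) →
    Σ (LinIso 5) λ α → ∀ e → Reach ψ e (LinIso.to α e)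
  linear-in-components ψ b g g0 ψ-k with verifyBits-sound 5 plan (λ b pl → verify pl order (upper b) (initial (upper b))) verified b
  ... | pl , eq = verify-sound (upper b) g (λ _ → refl) pl order (initial (upper b)) (init basics g0) eq
    where
    open Soundness ψ (λ u → g u ∷ upper b u) ψ-k
    init : ∀ us → (∀ {u} → u ∈ us → g u ≡ false) →
      Consistent (λ u → g u ∷ upper b u) (List.foldr (λ u → put u (false ∷ upper b u)) (empty 4) us)
    init [] h = empty-consistent 4 (λ u → g u ∷ upper b u)
    init (u ∷ us) h = put-consistent _ _ (init us (h ∘ there)) u (cong (_∷ upper b u) (h (here refl)))

open FiniteCheck using (Point; basics; cubic; quadratic; upper; bit; bit-xor; emb; Reach; link; zig; linear-in-components)

-- Triangular maps

dropk-∷ : ∀ {n} (i : Fin n) (x y : Vec (Fin 2) n) → dropk (suc (toℕ i)) x ≡ dropk (suc (toℕ i)) y →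
  lookup x i ≡ lookup y i → dropk (toℕ i) x ≡ dropk (toℕ i) y
dropk-∷ zero (a ∷ x) (b ∷ y) eq eq₀ = cong₂ _∷_ eq₀ eq
dropk-∷ (suc i) (a ∷ x) (b ∷ y) eq eq₀ = dropk-∷ i x y eq eq₀

bool : Fin 2 → Bool
bool zero = false
bool (suc zero) = true

bit-bool : ∀ a → bit (bool a) ≡ a
bit-bool zero = refl
bit-bool (suc zero) = refl

module TriangularMap {m : ℕ} (ψ ψ⁻ : Vec (Fin 2) m → Vec (Fin 2) m) (inv : ∀ x → ψ⁻ (ψ x) ≡ x)
                     (flag : ∀ i → i ≤ m → Preserves i ψ) (flag⁻ : ∀ i → i ≤ m → Preserves i ψ⁻) where

  reflects : ∀ i → i ≤ m → ∀ x y → dropk i (ψ x) ≡ dropk i (ψ y) → dropk i x ≡ dropk i y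
  reflects i i≤m x y eq = subst₂ (λ u v → dropk i u ≡ dropk i v) (inv x) (inv y) (flag⁻ i i≤m _ _ eq)

  excess : Fin m → Vec (Fin 2) m → Fin 2
  excess i x = addC (lookup (ψ x) i) (lookup x i)

  -- With the later coordinates held fixed, ψ acts on coordinate i by a bijection of F₂, since its
  -- inverse is triangular too. Both bijections of F₂ are translations, so the amount added depends
  -- on the later coordinates only.
  excess-cong : ∀ i x y → dropk (suc (toℕ i)) x ≡ dropk (suc (toℕ i)) y → excess i x ≡ excess i y
  excess-cong i x y eq = decide (lookup x i) (lookup y i) (lookup (ψ x) i) (lookup (ψ y) i)
    (λ xy → lookup-dropk (toℕ i) (ψ x) (ψ y) (flag (toℕ i) (<⇒≤ (toℕ<n i)) x y (dropk-∷ i x y eq xy)) i ≤-refl)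
    (λ ψxy → lookup-dropk (toℕ i) x y (reflects (toℕ i) (<⇒≤ (toℕ<n i)) x y
               (dropk-∷ i (ψ x) (ψ y) (flag (suc (toℕ i)) (toℕ<n i) x y eq) ψxy)) i ≤-refl)
    where
    decide : ∀ a b u v → (a ≡ b → u ≡ v) → (u ≡ v → a ≡ b) → addC u a ≡ addC v b
    decide zero zero u v h h′ = cong (λ w → addC w zero) (h refl)
    decide (suc zero) (suc zero) u v h h′ = cong (λ w → addC w (suc zero)) (h refl)
    decide zero (suc zero) zero (suc zero) h h′ = refl
    decide zero (suc zero) (suc zero) zero h h′ = refl
    decide zero (suc zero) zero zero h h′ with () ← h′ refl
    decide zero (suc zero) (suc zero) (suc zero) h h′ with () ← h′ refl
    decide (suc zero) zero zero (suc zero) h h′ = refl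
    decide (suc zero) zero (suc zero) zero h h′ = refl
    decide (suc zero) zero zero zero h h′ with () ← h′ refl
    decide (suc zero) zero (suc zero) (suc zero) h h′ with () ← h′ refl

  excess-fixed : ∀ i x → ψ x ≡ x → excess i x ≡ zero
  excess-fixed i x eq = trans (cong (λ y → addC (lookup y i) (lookup x i)) eq) (addC-self (lookup x i))

  coordinate : ∀ i x → lookup (ψ x) i ≡ addC (lookup x i) (excess i x)
  coordinate i x = trans (sym (trans (CyclicGroup.addC-assoc 1 (lookup (ψ x) i) _ _)
    (trans (cong (addC (lookup (ψ x) i)) (addC-self (lookup x i))) (CyclicGroup.addC-zeroʳ 1 _)))) (CyclicGroup.addC-comm 1 _ (lookup x i))

  -- If entry j of the image were 0, the image would lie in level j, and the triangular inverse
  -- would put `unit j` there as well.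
  unit-coordinate : ψ 𝟎 ≡ 𝟎 → ∀ j → dropk (suc (toℕ j)) (ψ (unit j)) ≡ 𝟎 × lookup (ψ (unit j)) j ≡ suc zero
  unit-coordinate ψ0 j = above , at
    where
    above : dropk (suc (toℕ j)) (ψ (unit j)) ≡ 𝟎
    above = trans (flag (suc (toℕ j)) (toℕ<n j) (unit j) 𝟎 (trans (dropk-unit (suc (toℕ j)) j ≤-refl) (sym (dropk-𝟎 {m} (suc (toℕ j))))))
      (trans (cong (dropk (suc (toℕ j))) ψ0) (dropk-𝟎 {m} (suc (toℕ j))))
    at : lookup (ψ (unit j)) j ≡ suc zero
    at with dropk-suc j (ψ (unit j)) above
    ... | inj₂ eq = trans (lookup-dropk (toℕ j) _ _ eq j ≤-refl) (lookup-unit j)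
    ... | inj₁ eq = ⊥-elim (dropk-unit-≢𝟎 j (trans (reflects (toℕ j) (<⇒≤ (toℕ<n j)) (unit j) 𝟎
            (trans eq (sym (trans (cong (dropk (toℕ j)) ψ0) (dropk-𝟎 (toℕ j)))))) (dropk-𝟎 (toℕ j))))

module _ (ψ ψ⁻ : Vec (Fin 2) 5 → Vec (Fin 2) 5) (inv : ∀ x → ψ⁻ (ψ x) ≡ x)
         (flag : ∀ i → i ≤ 5 → Preserves i ψ) (flag⁻ : ∀ i → i ≤ 5 → Preserves i ψ⁻)
         (ψ0 : ψ 𝟎 ≡ 𝟎) (ψunit : ∀ j → ψ (unit j) ≡ unit j) where
  open TriangularMap ψ ψ⁻ inv flag flag⁻

  private
    -- The values not forced by the basis, in the order in which `quadratic` and `cubic` read them: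
    -- coordinate 2 at (1, 1), then coordinate 1 at the four triples with at least two ones.
    parameters : Vec Bool 5
    parameters = bool (excess (# 2) (emb (false ∷ false ∷ false ∷ true ∷ true ∷ []))) ∷
      bool (excess (# 1) (emb (false ∷ false ∷ true ∷ true ∷ false ∷ []))) ∷
      bool (excess (# 1) (emb (false ∷ false ∷ true ∷ false ∷ true ∷ []))) ∷
      bool (excess (# 1) (emb (false ∷ false ∷ false ∷ true ∷ true ∷ []))) ∷
      bool (excess (# 1) (emb (false ∷ false ∷ true ∷ true ∷ true ∷ []))) ∷ []

    g : Point → Bool
    g u = bool (excess zero (zero ∷ emb u))

    g-basics : ∀ {u} → u ∈ basics → g u ≡ false
    g-basics (here refl) = cong bool (excess-fixed zero 𝟎 ψ0)
    g-basics (there (here refl)) = cong bool (excess-fixed zero (unit (# 1)) (ψunit (# 1)))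
    g-basics (there (there (here refl))) = cong bool (excess-fixed zero (unit (# 2)) (ψunit (# 2)))
    g-basics (there (there (there (here refl)))) = cong bool (excess-fixed zero (unit (# 3)) (ψunit (# 3)))
    g-basics (there (there (there (there (here refl))))) = cong bool (excess-fixed zero (unit (# 4)) (ψunit (# 4)))

    -- Each excess is a function of the later coordinates that vanishes at 0 and at the basis. For
    -- coordinates 4 and 3 there are no other arguments, so nothing is free.
    excess₄ : ∀ x → excess (# 4) x ≡ zero
    excess₄ x = trans (excess-cong (# 4) x 𝟎 (dropk-all x 𝟎)) (excess-fixed (# 4) 𝟎 ψ0)

    excess₃ : ∀ x₀ x₁ x₂ x₃ x₄ → excess (# 3) (x₀ ∷ x₁ ∷ x₂ ∷ x₃ ∷ x₄ ∷ []) ≡ zero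
    excess₃ x₀ x₁ x₂ x₃ zero = trans (excess-cong (# 3) _ 𝟎 refl) (excess-fixed (# 3) 𝟎 ψ0)
    excess₃ x₀ x₁ x₂ x₃ (suc zero) = trans (excess-cong (# 3) _ (unit (# 4)) refl) (excess-fixed (# 3) _ (ψunit (# 4)))

    excess₂ : ∀ x₀ x₁ x₂ x₃ x₄ → excess (# 2) (x₀ ∷ x₁ ∷ x₂ ∷ bit x₃ ∷ bit x₄ ∷ []) ≡ bit (quadratic parameters x₃ x₄)
    excess₂ x₀ x₁ x₂ false false = trans (excess-cong (# 2) _ 𝟎 refl) (excess-fixed (# 2) 𝟎 ψ0)
    excess₂ x₀ x₁ x₂ true false = trans (excess-cong (# 2) _ (unit (# 3)) refl) (excess-fixed (# 2) _ (ψunit (# 3)))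
    excess₂ x₀ x₁ x₂ false true = trans (excess-cong (# 2) _ (unit (# 4)) refl) (excess-fixed (# 2) _ (ψunit (# 4)))
    excess₂ x₀ x₁ x₂ true true = trans (excess-cong (# 2) _ _ refl) (sym (bit-bool _))

    excess₁ : ∀ x₀ x₁ x₂ x₃ x₄ → excess (# 1) (x₀ ∷ x₁ ∷ bit x₂ ∷ bit x₃ ∷ bit x₄ ∷ []) ≡ bit (cubic parameters x₂ x₃ x₄)
    excess₁ x₀ x₁ false false false = trans (excess-cong (# 1) _ 𝟎 refl) (excess-fixed (# 1) 𝟎 ψ0)
    excess₁ x₀ x₁ true false false = trans (excess-cong (# 1) _ (unit (# 2)) refl) (excess-fixed (# 1) _ (ψunit (# 2)))
    excess₁ x₀ x₁ false true false = trans (excess-cong (# 1) _ (unit (# 3)) refl) (excess-fixed (# 1) _ (ψunit (# 3)))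
    excess₁ x₀ x₁ false false true = trans (excess-cong (# 1) _ (unit (# 4)) refl) (excess-fixed (# 1) _ (ψunit (# 4)))
    excess₁ x₀ x₁ true true false = trans (excess-cong (# 1) _ _ refl) (sym (bit-bool _))
    excess₁ x₀ x₁ true false true = trans (excess-cong (# 1) _ _ refl) (sym (bit-bool _))
    excess₁ x₀ x₁ false true true = trans (excess-cong (# 1) _ _ refl) (sym (bit-bool _))
    excess₁ x₀ x₁ true true true = trans (excess-cong (# 1) _ _ refl) (sym (bit-bool _))

    ext₅ : (v w : Vec (Fin 2) 5) → (∀ i → lookup v i ≡ lookup w i) → v ≡ w
    ext₅ v w h = trans (sym (Vecₚ.tabulate∘lookup v)) (trans (Vecₚ.tabulate-cong h) (Vecₚ.tabulate∘lookup w))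

    normal-form : ∀ a u → ψ (a ∷ emb u) ≡ (a ∷ 𝟎) ⊕ emb (g u ∷ upper parameters u)
    normal-form a u@(x₁ ∷ x₂ ∷ x₃ ∷ x₄ ∷ []) = ext₅ _ _ λ
      { zero → trans (coordinate zero x) (cong (addC a) (trans (excess-cong zero x (zero ∷ emb u) refl) (sym (bit-bool _))))
      ; (suc zero) → trans (coordinate (# 1) x) (trans (cong (addC (bit x₁)) (excess₁ a (bit x₁) x₂ x₃ x₄)) (plain x₁ _))
      ; (suc (suc zero)) → trans (coordinate (# 2) x) (trans (cong (addC (bit x₂)) (excess₂ a (bit x₁) (bit x₂) x₃ x₄)) (plain x₂ _))
      ; (suc (suc (suc zero))) → trans (coordinate (# 3) x) (trans (cong (addC (bit x₃)) (excess₃ a (bit x₁) (bit x₂) (bit x₃) (bit x₄))) (unchanged x₃))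
      ; (suc (suc (suc (suc zero)))) → trans (coordinate (# 4) x) (trans (cong (addC (bit x₄)) (excess₄ x)) (unchanged x₄)) }
      where
      x = a ∷ emb u
      plain : ∀ b c → addC (bit b) (bit c) ≡ addC zero (bit (b xor c))
      plain b c = trans (sym (bit-xor b c)) (sym (CyclicGroup.addC-zeroˡ 1 _))
      unchanged : ∀ b → addC (bit b) zero ≡ addC zero (bit b)
      unchanged b = CyclicGroup.addC-comm 1 (bit b) zero

  linear-of-triangular : Σ (LinIso 5) λ α → ∀ e → Reach ψ e (LinIso.to α e)
  linear-of-triangular = linear-in-components ψ parameters g g-basics normal-form

-- From maps preserving a flag to automorphisms

module FromFlag (n : ℕ) (d : ℕ) where
  open CyclicGroup n
  open GroupOps n 5
  open Colourings n 5
  open Admissible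
  open LinIso

  -- A link at e carries the row of S at e to a row of T with the scalar of the coset of o. If e
  -- lies in the span of the first d coordinates, so does o, and the scalar is that of the zero
  -- coset. Otherwise the row of T reached is constant, and any scalar may be put in.
  equivalent-of-normalised : ∀ {S T ψ ψ⁻} → Admissible d S T ψ ψ⁻ → TrivialOutside d S → TrivialOutside d T →
    Flag 5 ψ → Flag 5 ψ⁻ → ψ 𝟎 ≡ 𝟎 → (∀ j → ψ (unit j) ≡ unit j) → Equivalent S T
  equivalent-of-normalised {S} {T} {ψ} {ψ⁻} A trS trT fl fl⁻ ψ0 ψunit with linear-of-triangular ψ ψ⁻ (leftInv A) fl fl⁻ ψ0 ψunit
  ... | α , reach = α , a , λ e t → sym (sound (reach e) t)
    where
    a = scalar A 𝟎
    sound : ∀ {e y} → Reach ψ e y → ∀ t → S (e , t) ≡ T (y , Unit.val a · t)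
    sound (zig r₁ r₂ r₃) t = trans (sound r₁ t) (trans (sym (sound r₂ t)) (sound r₃ t))
    sound (link o e below) t = trans (cong (λ x → S (x , t)) (sym (⊕-cancelˡ o e))) (trans (respects A o (o ⊕ e) t) (rescale (dropk d e ≟ᵥ 𝟎)))
      where
      rescale : Dec (dropk d e ≡ 𝟎) → T (ψ o ⊕ ψ (o ⊕ e) , Unit.val (scalar A (dropk d o)) · t) ≡ T (ψ o ⊕ ψ (o ⊕ e) , Unit.val a · t)
      rescale (yes eq) = cong (λ v → T (ψ o ⊕ ψ (o ⊕ e) , Unit.val (scalar A v) · t)) (below d eq)
      rescale (no ne) = trT _ (λ eq → ne (trans (cong (dropk d) (sym (⊕-cancelˡ o e)))
        (dropk-≡⇒𝟎 d o (o ⊕ e) (subst₂ (λ u v → dropk d u ≡ dropk d v) (leftInv A o) (leftInv A (o ⊕ e))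
          (pres⁻ A _ _ (dropk-𝟎⇒≡ d _ _ eq)))))) _ _

  -- By triangularity the image of `unit j′` is `unit j′` plus a vector w supported on earlier
  -- coordinates. The transvection adding w when coordinate j′ is set repairs this image, keeps all
  -- levels, and fixes the earlier basis vectors.
  equivalent-of-flag : ∀ r j → j + r ≡ 5 → ∀ {S T ψ ψ⁻} → Admissible d S T ψ ψ⁻ → TrivialOutside d S → TrivialOutside d T →
    Flag 5 ψ → Flag 5 ψ⁻ → ψ 𝟎 ≡ 𝟎 → (∀ i → toℕ i < j → ψ (unit i) ≡ unit i) → Equivalent S T
  equivalent-of-flag zero j eq A trS trT fl fl⁻ ψ0 fixes = equivalent-of-normalised A trS trT fl fl⁻ ψ0
    (λ i → fixes i (subst (toℕ i <_) (trans (sym eq) (+-identityʳ j)) (toℕ<n i)))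
  equivalent-of-flag (suc r) j eq {S} {T} {ψ} {ψ⁻} A trS trT fl fl⁻ ψ0 fixes =
    untwist idₗ τ {S} {T} (equivalent-of-flag r (suc j) (trans (sym (+-suc j r)) eq) (adm-∘ (adm-twist τ (τ-pres d)) A) trS (twist-trivial d τ (proj₁ (τ-pres d)) trT)
      (λ i i≤ x y e → proj₁ (τ-pres i) _ _ (fl i i≤ x y e)) (λ i i≤ x y e → fl⁻ i i≤ _ _ (proj₂ (τ-pres i) x y e))
      (trans (cong (to τ) ψ0) (to-𝟎 τ)) fixes′)
    where
    j<5 : j < 5
    j<5 = subst (j <_) eq (m<m+n j z<s)
    j′ : Fin 5
    j′ = fromℕ< j<5
    j′≡ : toℕ j′ ≡ j
    j′≡ = toℕ-fromℕ< j<5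
    column = TriangularMap.unit-coordinate ψ ψ⁻ (leftInv A) fl fl⁻ ψ0 j′
    w = ψ (unit j′) ⊕ unit j′
    wⱼ : lookup w j′ ≡ zero
    wⱼ = trans (lookup-zipWith addC j′ (ψ (unit j′)) (unit j′)) (cong₂ addC (proj₂ column) (lookup-unit j′))
    τ = transvection j′ w wⱼ
    w-above : dropk (suc (toℕ j′)) w ≡ 𝟎
    w-above = trans (dropk-⊕ (suc (toℕ j′)) (ψ (unit j′)) (unit j′)) (trans (cong₂ _⊕_ (proj₁ column) (dropk-unit (suc (toℕ j′)) j′ ≤-refl)) (⊕-self 𝟎))
    τ-pres : ∀ i → Preserves₂ i τ
    τ-pres i with i ≤? toℕ j′
    ... | yes i≤j = transvection-preserves i j′ w wⱼ (inj₁ i≤j)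
    ... | no i≰j = transvection-preserves i j′ w wⱼ (inj₂ (trans (dropk-mono (≰⇒> i≰j) w 𝟎 (trans w-above (sym (dropk-𝟎 {5} (suc (toℕ j′)))))) (dropk-𝟎 i)))
    fixes′ : ∀ i → toℕ i < suc j → to τ (ψ (unit i)) ≡ unit i
    fixes′ i (s≤s i≤j) with m≤n⇒m<n∨m≡n i≤j
    ... | inj₁ i<j = trans (cong (to τ) (fixes i i<j)) (trans (cong (λ b → unit i ⊕ scale b w)
            (lookup-unit-≢ i j′ (λ { refl → <-irrefl j′≡ i<j }))) (⊕-identityʳ (unit i)))
    ... | inj₂ i≡j with refl ← toℕ-injective (trans i≡j (sym j′≡)) =
      trans (cong (λ b → ψ (unit i) ⊕ scale b w) (proj₂ column)) (⊕-cancelˡ (ψ (unit i)) (unit i))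

  -- Here r counts the levels still to be refined. Each refinement replaces S and T by twists, which
  -- are undone in the goal. Once the flag is complete, a translation by `φ 𝟎` makes the map fix 0.
  equivalent-of-level : ∀ r k → k + r ≡ 5 → d ≤ 5 → ∀ {S T φ φ⁻} → Admissible d S T φ φ⁻ → TrivialOutside d S → TrivialOutside d T →
    Flag k φ → Flag k φ⁻ → ¬ ¬ Equivalent S T
  equivalent-of-level zero k eq d≤5 {S} {T} {φ} {φ⁻} A trS trT fl fl⁻ ¬eqv with refl ← trans (sym (+-identityʳ k)) eq =
    ¬eqv (equivalent-of-flag 5 0 refl (adm-∘ (adm-translate (φ 𝟎)) A) trS trT
      (λ i i≤ x y e → translate-preserves i (φ 𝟎) _ _ (fl i i≤ x y e))
      (λ i i≤ x y e → fl⁻ i i≤ _ _ (translate-preserves i (φ 𝟎) x y e)) (⊕-self (φ 𝟎)) (λ _ ()))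
  equivalent-of-level (suc r) k eq d≤5 {S} {T} {φ} {φ⁻} A trS trT fl fl⁻ ¬eqv = by-cases (k <? d)
    where
    k<5 : k < 5
    k<5 = subst (k <_) eq (m<m+n k z<s)
    k′ : Fin 5
    k′ = fromℕ< k<5
    k′≡ : toℕ k′ ≡ k
    k′≡ = toℕ-fromℕ< k<5
    continue : ∀ D → toℕ k′ < D → D ≡ d ⊎ (D ≡ 5 × d ≤ toℕ k′) → ⊥
    continue D k<D D-cases = refine λ R → let open Refined R in
      equivalent-of-level r (suc k) (trans (sym (+-suc k r)) eq) d≤5 adm
        (subst (TrivialOutside d) (sym S′≡) (twist-trivial d γ pres-γ trS)) (subst (TrivialOutside d) (sym T′≡) (twist-trivial d γ′ pres-γ′ trT))
        (subst (λ k → Flag (suc k) ψ) k′≡ flag-ψ) (subst (λ k → Flag (suc k) ψ⁻) k′≡ flag-ψ⁻)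
        (λ eqv → ¬eqv (untwist γ γ′ {S} {T} (subst₂ Equivalent S′≡ T′≡ eqv)))
      where open Level d S T φ φ⁻ A k′ (subst (λ k → Flag k φ) (sym k′≡) fl) (subst (λ k → Flag k φ⁻) (sym k′≡) fl⁻) D k<D D-cases
    by-cases : Dec (k < d) → ⊥
    -- With D equal to d the two vectors found lie in the span of the first d coordinates, so the
    -- base changes keep that subspace.
    by-cases (yes k<d) = continue d (subst (_< d) (sym k′≡) k<d) (inj₁ refl)
    by-cases (no k≮d) = continue 5 (toℕ<n k′) (inj₂ (refl , subst (d ≤_) (sym k′≡) (≮⇒≥ k≮d)))

-- Rotations of single cosets

module Descent (n m d : ℕ) (pp : Prime (suc n)) where
  open CyclicGroup n
  open GroupOps n m
  open Colourings n m
  private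
    p = suc n
    V = Vec (Fin 2) (m ∸ d)

  -- The quotient of G by the subgroup L of E only; a coset of L × C_p becomes one copy of C_p.
  X : Set
  X = V × Fin p

  quotient : G → X
  quotient (e , t) = dropk d e , t

  section : X → G
  section (v , t) = pad d v , t

  quotient-section : ∀ x → quotient (section x) ≡ x
  quotient-section (v , t) = cong (_, t) (dropk-pad d v)

  Descends : (G → G) → Set
  Descends f = ∀ g g′ → quotient g ≡ quotient g′ → quotient (f g) ≡ quotient (f g′)

  descend : (G → G) → X → X
  descend f x = quotient (f (section x))

  descend-quotient : ∀ {f} → Descends f → ∀ g → descend f (quotient g) ≡ quotient (f g)
  descend-quotient ds g = ds _ g (quotient-section (quotient g))

  descend-inv : ∀ {f f⁻} → Descends f → (∀ g → f (f⁻ g) ≡ g) → ∀ x → descend f (descend f⁻ x) ≡ x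
  descend-inv {f} {f⁻} ds r x = trans (descend-quotient ds (f⁻ (section x))) (trans (cong quotient (r (section x))) (quotient-section x))

  record CosetIso (S T : G → Bool) (f f⁻ : G → G) : Set where
    field
      leftInv   : ∀ g → f⁻ (f g) ≡ g
      rightInv  : ∀ g → f (f⁻ g) ≡ g
      iso       : Iso S T f
      descends  : Descends f
      descends⁻ : Descends f⁻

    iso⁻ : Iso T S f⁻
    iso⁻ g h = trans (sym (cong₂ (λ x y → T (x ⊖ y)) (rightInv h) (rightInv g))) (sym (iso (f⁻ g) (f⁻ h)))

    f̄ f̄⁻ : X → X
    f̄ = descend f
    f̄⁻ = descend f⁻

    f̄-inv : ∀ x → f̄ (f̄⁻ x) ≡ x
    f̄-inv = descend-inv descends rightInv

    f̄⁻-inv : ∀ x → f̄⁻ (f̄ x) ≡ x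
    f̄⁻-inv = descend-inv descends⁻ leftInv

  open CosetIso

  iso-id : ∀ {S} → CosetIso S S id id
  iso-id = record { leftInv = λ _ → refl ; rightInv = λ _ → refl ; iso = λ _ _ → refl ; descends = λ _ _ → id ; descends⁻ = λ _ _ → id }

  iso-inv : ∀ {S T f f⁻} → CosetIso S T f f⁻ → CosetIso T S f⁻ f
  iso-inv I = record { leftInv = rightInv I ; rightInv = leftInv I ; iso = iso⁻ I ; descends = descends⁻ I ; descends⁻ = descends I }

  iso-∘ : ∀ {S T R f f⁻ g g⁻} → CosetIso T R g g⁻ → CosetIso S T f f⁻ → CosetIso S R (g ∘ f) (f⁻ ∘ g⁻)
  iso-∘ {f = f} {f⁻} {g} {g⁻} J I = record
    { leftInv = λ x → trans (cong f⁻ (leftInv J (f x))) (leftInv I x)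
    ; rightInv = λ x → trans (cong g (rightInv I (g⁻ x))) (rightInv J x)
    ; iso = λ x y → trans (iso I x y) (iso J (f x) (f y))
    ; descends = λ x y eq → descends J _ _ (descends I x y eq)
    ; descends⁻ = λ x y eq → descends⁻ I _ _ (descends⁻ J x y eq) }

  one : Fin p
  one = [ 1 ]

  one≢0 : one ≢ zero
  one≢0 eq = ¬prime[1] (subst Prime (p≡1 n eq) pp)
    where
    p≡1 : ∀ n → CyclicGroup.[_] n 1 ≡ zero → suc n ≡ 1
    p≡1 zero _ = refl

  addC-one≢ : ∀ t → addC t one ≢ t
  addC-one≢ t eq = one≢0 (addC-cancelʳ t (trans (addC-comm one t) (trans eq (sym (addC-zeroˡ t)))))

  shiftAt unshiftAt : V → V → Fin p → Fin p
  shiftAt v w t with w ≟ᵥ v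
  ... | yes _ = addC t one
  ... | no _ = t
  unshiftAt v w t with w ≟ᵥ v
  ... | yes _ = subC t one
  ... | no _ = t

  shiftAt-here : ∀ v t → shiftAt v v t ≡ addC t one
  shiftAt-here v t with v ≟ᵥ v
  ... | yes _ = refl
  ... | no ne = ⊥-elim (ne refl)

  shiftAt-there : ∀ {v w} t → w ≢ v → shiftAt v w t ≡ t
  shiftAt-there {v} {w} t ne with w ≟ᵥ v
  ... | yes eq = ⊥-elim (ne eq)
  ... | no _ = refl

  unshift-shift : ∀ v w t → unshiftAt v w (shiftAt v w t) ≡ t
  unshift-shift v w t with w ≟ᵥ v
  ... | yes _ = subC-addC t one
  ... | no _ = refl

  shift-unshift : ∀ v w t → shiftAt v w (unshiftAt v w t) ≡ t
  shift-unshift v w t with w ≟ᵥ v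
  ... | yes _ = addC-subC t one
  ... | no _ = refl

  shift-comm : ∀ v v′ w t → shiftAt v w (shiftAt v′ w t) ≡ shiftAt v′ w (shiftAt v w t)
  shift-comm v v′ w t with w ≟ᵥ v | w ≟ᵥ v′
  ... | yes _ | yes _ = refl
  ... | yes _ | no _ = refl
  ... | no _ | yes _ = refl
  ... | no _ | no _ = refl

  fold-addC : ∀ t s k → fold t (λ u → addC u s) k ≡ addC t (k · s)
  fold-addC t s zero = sym (addC-zeroʳ t)
  fold-addC t s (suc k) = trans (cong (λ u → addC u s) (fold-addC t s k)) (trans (addC-assoc t (k · s) s)
    (cong (addC t) (trans (addC-comm (k · s) s) (sym (·-suc k s)))))

  addC-order : ∀ t s → fold t (λ u → addC u s) p ≡ t
  addC-order t s = trans (fold-addC t s p) (trans (cong (addC t) (·-order s)) (addC-zeroʳ t))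

  shift-order : ∀ v w t → fold t (shiftAt v w) p ≡ t
  shift-order v w t with w ≟ᵥ v
  ... | yes _ = addC-order t one
  ... | no _ = const p
    where
    const : ∀ k → fold t (λ u → u) k ≡ t
    const zero = refl
    const (suc k) = const k

  fold-× : ∀ (w : V) (h : Fin p → Fin p) t k → fold {A = X} (w , t) (λ (w , t) → w , h t) k ≡ (w , fold t h k)
  fold-× w h t zero = refl
  fold-× w h t (suc k) = cong (λ (w , t) → w , h t) (fold-× w h t k)

  rotation rotation⁻ : V → X → X
  rotation v (w , t) = w , shiftAt v w t
  rotation⁻ v (w , t) = w , unshiftAt v w t

  rotation-order : ∀ v x → fold x (rotation v) p ≡ x
  rotation-order v (w , t) = trans (go p) (cong (w ,_) (shift-order v w t))
    where
    go : ∀ k → fold (w , t) (rotation v) k ≡ (w , fold t (shiftAt v w) k)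
    go zero = refl
    go (suc k) = cong (rotation v) (go k)

  rotate-coset unrotate-coset : V → G → G
  rotate-coset v (e , t) = e , shiftAt v (dropk d e) t
  unrotate-coset v (e , t) = e , unshiftAt v (dropk d e) t

  -- Inside a coset of L × C_p differences do not change, as both ends rotate together or not at
  -- all. Between different cosets the row is constant, so the C_p coordinate is invisible.
  coset-rotation : ∀ {S} → TrivialOutside d S → ∀ v → CosetIso S S (rotate-coset v) (unrotate-coset v)
  coset-rotation {S} tr v = record
    { leftInv = λ (e , t) → cong (e ,_) (unshift-shift v (dropk d e) t)
    ; rightInv = λ (e , t) → cong (e ,_) (shift-unshift v (dropk d e) t)
    ; iso = λ (e , t) (e′ , t′) → pres e t e′ t′
    ; descends = λ g g′ eq → cong (rotation v) eq
    ; descends⁻ = λ g g′ eq → cong (rotation⁻ v) eq }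
    where
    pres : ∀ e t e′ t′ → S (e′ ⊕ e , subC t′ t) ≡ S (e′ ⊕ e , subC (shiftAt v (dropk d e′) t′) (shiftAt v (dropk d e) t))
    pres e t e′ t′ with dropk d e ≟ᵥ v | dropk d e′ ≟ᵥ v
    ... | yes _ | yes _ = cong (λ s → S (e′ ⊕ e , s)) (sym (subC-translate t′ t one))
    ... | no _ | no _ = refl
    ... | yes eq | no ne = tr _ (λ z → ne (trans (dropk-𝟎⇒≡ d e′ e z) eq)) _ _
    ... | no ne | yes eq = tr _ (λ z → ne (trans (sym (dropk-𝟎⇒≡ d e′ e z)) eq)) _ _

  module _ {S T : G → Bool} {f f⁻ : G → G} (I : CosetIso S T f f⁻) (trS : TrivialOutside d S) (trT : TrivialOutside d T) where

    private
      record Elem (a b : X → X) : Set where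
        field
          â b̂ : G → G
          lift : CosetIso S S â b̂
          lift-a : ∀ g → quotient (â g) ≡ a (quotient g)
          lift-b : ∀ g → quotient (b̂ g) ≡ b (quotient g)

      open Elem

      𝒢 : PermGroup X
      𝒢 = record
        { Elem = Elem
        ; invˡ = λ {a} {b} e x → begin
            b (a x)   ≡⟨ cong (b ∘ a) (sym (quotient-section x)) ⟩
            b (a (quotient (section x)))   ≡⟨ cong b (sym (lift-a e (section x))) ⟩
            b (quotient (â e (section x)))   ≡⟨ sym (lift-b e _) ⟩
            quotient (b̂ e (â e (section x)))  ≡⟨ cong quotient (leftInv (lift e) _) ⟩
            quotient (section x)   ≡⟨ quotient-section x ⟩
            x   ∎
        ; elem-id = record { â = id ; b̂ = id ; lift = iso-id ; lift-a = λ _ → refl ; lift-b = λ _ → refl }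
        ; elem-inv = λ e → record { â = b̂ e ; b̂ = â e ; lift = iso-inv (lift e) ; lift-a = lift-b e ; lift-b = lift-a e }
        ; elem-∘ = λ {a} {b} {c} {c⁻} e e′ → record
            { â = â e ∘ â e′ ; b̂ = b̂ e′ ∘ b̂ e ; lift = iso-∘ (lift e) (lift e′)
            ; lift-a = λ g → trans (lift-a e _) (cong a (lift-a e′ g))
            ; lift-b = λ g → trans (lift-b e′ _) (cong c⁻ (lift-b e g)) } }
        where open ≡-Reasoning

      rotations conjugates : CommutingFamily p 𝒢
      rotations = record
        { I = V ; indices = Finite.elements (Vec↔Fin (m ∸ d)) ; γ = rotation ; γ⁻ = rotation⁻
        ; elem = λ v → record { â = rotate-coset v ; b̂ = unrotate-coset v ; lift = coset-rotation trS v ; lift-a = λ _ → refl ; lift-b = λ _ → refl }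
        ; order = rotation-order
        ; comm = λ v v′ (w , t) → cong (w ,_) (shift-comm v v′ w t) }
      conjugates = record
        { I = V ; indices = Finite.elements (Vec↔Fin (m ∸ d))
        ; γ = λ v x → f̄⁻ I (rotation v (f̄ I x)) ; γ⁻ = λ v x → f̄⁻ I (rotation⁻ v (f̄ I x))
        ; elem = λ v → record
            { â = f⁻ ∘ rotate-coset v ∘ f ; b̂ = f⁻ ∘ unrotate-coset v ∘ f
            ; lift = iso-∘ (iso-inv I) (iso-∘ (coset-rotation trT v) I)
            ; lift-a = λ g → trans (sym (descend-quotient (descends⁻ I) (rotate-coset v (f g)))) (cong (f̄⁻ I ∘ rotation v) (sym (descend-quotient (descends I) g)))
            ; lift-b = λ g → trans (sym (descend-quotient (descends⁻ I) (unrotate-coset v (f g)))) (cong (f̄⁻ I ∘ rotation⁻ v) (sym (descend-quotient (descends I) g))) }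
        ; order = λ v x → trans (conj-fold v x p) (trans (cong (f̄⁻ I) (rotation-order v (f̄ I x))) (f̄⁻-inv I x))
        ; comm = λ v v′ x → cong (f̄⁻ I) (trans (cong (rotation v) (f̄-inv I _))
            (trans (cong (f̄ I x .proj₁ ,_) (shift-comm v v′ (f̄ I x .proj₁) (f̄ I x .proj₂))) (cong (rotation v′) (sym (f̄-inv I _))))) }
        where
        conj-fold : ∀ v x k → fold x (λ x → f̄⁻ I (rotation v (f̄ I x))) k ≡ f̄⁻ I (fold (f̄ I x) (rotation v) k)
        conj-fold v x zero = sym (f̄⁻-inv I x)
        conj-fold v x (suc k) = cong (f̄⁻ I ∘ rotation v) (trans (cong (f̄ I) (conj-fold v x k)) (f̄-inv I _))

      _≟ˣ_ : DecidableEquality X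
      _≟ˣ_ = ×-≡-dec _≟ᵥ_ Finₚ._≟_

      -- All of X is one block; rotating every coset at once has no fixed point and order p.
      open SylowConjugacy pp _≟ˣ_ (↔-trans (Vec↔Fin (m ∸ d) ×-↔ ↔-refl) (↔-sym *↔×)) (λ _ _ → ⊤) tt (λ _ _ → tt) (λ _ _ → yes tt)
        (λ (v , t) → v , addC t one) (λ (v , t) → trans (fold-× v (λ t → addC t one) t p) (cong (v ,_) (addC-order t one)))
        (λ (v , t) eq → addC-one≢ t (cong proj₂ eq)) (λ _ → tt) 𝒢 (λ _ _ → tt)

    Shift : (V → Fin p) → X → X
    Shift k (v , t) = v , addC t (k v)

    private
      -- If `y` moved a point of coset v into another coset w, the rotation of w would fix the point
      -- but not its image. So `y` preserves each coset, and commuting with its rotation makes it a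
      -- rotation there, with nonzero amount since `y` has no fixed points.
      is-shift : (y : X → X) → (∀ x → y x ≢ x) → (∀ v x → y (rotation v x) ≡ rotation v (y x)) →
        Σ (V → Fin p) λ k → (∀ v → k v ≢ zero) × ((x : X) → y x ≡ Shift k x)
      is-shift y fpf comm = k , (λ v kv≡0 → fpf (v , zero) (trans (shifts v zero) (cong (v ,_) (trans (addC-zeroˡ (k v)) kv≡0)))) ,
          λ (v , t) → shifts v t
        where
        k : V → Fin p
        k v = proj₂ (y (v , zero))
        same-coset : ∀ v t → proj₁ (y (v , t)) ≡ v
        same-coset v t with proj₁ (y (v , t)) ≟ᵥ v
        ... | yes eq = eq
        ... | no ne = ⊥-elim (addC-one≢ s (begin
            addC s one   ≡⟨ sym (shiftAt-here w s) ⟩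
            proj₂ (rotation w (y (v , t)))   ≡⟨ cong proj₂ (sym (comm w (v , t))) ⟩
            proj₂ (y (rotation w (v , t)))   ≡⟨ cong (λ t → proj₂ (y (v , t))) (shiftAt-there t (ne ∘ sym)) ⟩
            s   ∎))
          where
          open ≡-Reasoning
          w = proj₁ (y (v , t))
          s = proj₂ (y (v , t))
        next : ∀ v t → y (v , addC t one) ≡ (v , addC (proj₂ (y (v , t))) one)
        next v t = begin
          y (v , addC t one)   ≡⟨ cong (λ t → y (v , t)) (sym (shiftAt-here v t)) ⟩
          y (rotation v (v , t))   ≡⟨ comm v (v , t) ⟩
          rotation v (y (v , t))   ≡⟨ cong (λ w → rotation v (w , proj₂ (y (v , t)))) (same-coset v t) ⟩
          (v , shiftAt v v (proj₂ (y (v , t))))   ≡⟨ cong (v ,_) (shiftAt-here v _) ⟩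
          (v , addC (proj₂ (y (v , t))) one)   ∎
          where open ≡-Reasoning
        multiples : ∀ v j → y (v , j · one) ≡ (v , addC (j · one) (k v))
        multiples v zero = cong₂ {A = V} {B = Fin p} _,_ {u = k v} (same-coset v zero) (sym (addC-zeroˡ (k v)))
        multiples v (suc j) = begin
          y (v , suc j · one)   ≡⟨ cong (λ t → y (v , t)) (trans (·-suc j one) (addC-comm one _)) ⟩
          y (v , addC (j · one) one)   ≡⟨ next v (j · one) ⟩
          (v , addC (proj₂ (y (v , j · one))) one)   ≡⟨ cong (λ x → v , addC (proj₂ x) one) (multiples v j) ⟩
          (v , addC (addC (j · one) (k v)) one)   ≡⟨ cong (v ,_) (addC-swap (j · one) (k v) one) ⟩
          (v , addC (addC (j · one) one) (k v))   ≡⟨ cong (λ t → v , addC t (k v)) (trans (addC-comm _ one) (sym (·-suc j one))) ⟩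
          (v , addC (suc j · one) (k v))   ∎
          where open ≡-Reasoning
        shifts : ∀ v t → y (v , t) ≡ (v , addC t (k v))
        shifts v t = subst (λ t → y (v , t) ≡ (v , addC t (k v))) (·-one t) (multiples v (toℕ t))

    AffineIso : Set
    AffineIso = Σ (G → G) λ h → Σ (G → G) λ h⁻ → CosetIso S T h h⁻ × Σ (V → V) λ W → Σ (V → Fin p) λ c → Σ (V → Unit) λ a →
      ∀ e t → quotient (h (e , t)) ≡ (W (dropk d e) , addC (Unit.val (a (dropk d e)) · t) (c (dropk d e)))

    -- After composition with the lifted conjugator, the induced map on the quotient turns a
    -- rotation by k v in each coset into a rotation by k′ in the image coset. Both amounts generate
    -- C_p, so the map is affine on every coset.
    affine : ¬ ¬ AffineIso
    affine ¬aff = conjugate-centralized rotations conjugates λ (y , y′ , vy , vy′ , cy , cy′ , a , b , e , ya) →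
      let
        y″ : X → X
        y″ x = f̄ I (y′ (f̄⁻ I x))
        k , k≢0 , yk = is-shift y (λ x → proj₂ (vy x)) (λ v x → cy (Finite.∈-elements (Vec↔Fin (m ∸ d)) v) x)
        k′ , k′≢0 , yk′ = is-shift y″ (λ x eq → proj₂ (vy′ (f̄⁻ I x)) (trans (sym (f̄⁻-inv I _)) (cong (f̄⁻ I) eq)))
          (λ v x → trans (cong (f̄ I ∘ y′ ∘ f̄⁻ I ∘ rotation v) (sym (f̄-inv I x)))
            (trans (cong (f̄ I) (cy′ (Finite.∈-elements (Vec↔Fin (m ∸ d)) v) (f̄⁻ I x))) (f̄-inv I _)))
        H = iso-∘ I (lift e)
        h̄ = f̄ H
        h̄-y : ∀ x → h̄ (Shift k x) ≡ Shift k′ (h̄ x)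
        h̄-y x = begin
          h̄ (Shift k x)   ≡⟨ cong h̄ (sym (yk x)) ⟩
          h̄ (y x)   ≡⟨ via e (y x) ⟩
          f̄ I (a (y x))   ≡⟨ cong (f̄ I) (sym (ya x)) ⟩
          f̄ I (y′ (a x))   ≡⟨ cong (f̄ I ∘ y′) (sym (f̄⁻-inv I _)) ⟩
          y″ (f̄ I (a x))   ≡⟨ yk′ (f̄ I (a x)) ⟩
          Shift k′ (f̄ I (a x))   ≡⟨ cong (Shift k′) (sym (via e x)) ⟩
          Shift k′ (h̄ x)   ∎
        W : V → V
        W v = proj₁ (h̄ (v , zero))
        c : V → Fin p
        c v = proj₂ (h̄ (v , zero))
        multiples : ∀ v j → h̄ (v , j · k v) ≡ (W v , addC (j · k′ (W v)) (c v))
        multiples v j = multiples′ h̄ k k′ h̄-y v j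
        u : V → Unit
        u v = proj₁ (unit-of-nonzero pp (k v) (k≢0 v))
        u-val : ∀ v → Unit.val (u v) ≡ toℕ (k v)
        u-val v = proj₂ (unit-of-nonzero pp (k v) (k≢0 v))
        u′ : V → Unit
        u′ v = proj₁ (unit-of-nonzero pp (k′ v) (k′≢0 v))
        u′-val : ∀ v → Unit.val (u′ v) ≡ toℕ (k′ v)
        u′-val v = proj₂ (unit-of-nonzero pp (k′ v) (k′≢0 v))
        coefficient : V → Unit
        -- The quotient of the two rotation amounts: a step of `k v` is sent to a step of
        -- `k′ (W v)`.
        coefficient v = u′ (W v) *ᵤ (u v ⁻¹ᵤ)
        formula : ∀ v t → h̄ (v , t) ≡ (W v , addC (Unit.val (coefficient v) · t) (c v))
        formula v t = begin
          h̄ (v , t)   ≡⟨ cong (λ t → h̄ (v , t)) (sym (Unit.val-inv (u v) t)) ⟩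
          h̄ (v , Unit.val (u v) · Unit.inv (u v) · t)   ≡⟨ cong (λ t → h̄ (v , t)) (as-multiple (k v) (u-val v) (Unit.inv (u v) · t)) ⟩
          h̄ (v , toℕ (Unit.inv (u v) · t) · k v)   ≡⟨ multiples v (toℕ (Unit.inv (u v) · t)) ⟩
          (W v , addC (toℕ (Unit.inv (u v) · t) · k′ (W v)) (c v))
            ≡⟨ cong (λ s → W v , addC s (c v)) (trans (sym (as-multiple (k′ (W v)) (u′-val (W v)) (Unit.inv (u v) · t))) (sym (·-* (Unit.val (u′ (W v))) (Unit.inv (u v)) t))) ⟩
          (W v , addC (Unit.val (coefficient v) · t) (c v))   ∎
      in ¬aff (f ∘ â e , b̂ e ∘ f⁻ , H , W , c , coefficient , λ x t → trans (sym (descend-quotient (descends H) (x , t))) (formula (dropk d x) t))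
      where
      open ≡-Reasoning
      via : ∀ {a b} (e : Elem a b) x → descend (f ∘ â e) x ≡ f̄ I (a x)
      via {a} e x = trans (sym (descend-quotient (descends I) (â e (section x)))) (cong (f̄ I) (trans (lift-a e (section x)) (cong a (quotient-section x))))
      as-multiple : ∀ {u} (k : Fin p) → u ≡ toℕ k → ∀ t → u · t ≡ toℕ t · k
      as-multiple k refl t = cong [_] (*-comm (toℕ k) (toℕ t))
      multiples′ : (h̄ : X → X) (k k′ : V → Fin p) → (∀ x → h̄ (Shift k x) ≡ Shift k′ (h̄ x)) →
        ∀ v j → h̄ (v , j · k v) ≡ (proj₁ (h̄ (v , zero)) , addC (j · k′ (proj₁ (h̄ (v , zero)))) (proj₂ (h̄ (v , zero))))
      multiples′ h̄ k k′ h v zero = cong (proj₁ (h̄ (v , zero)) ,_) (sym (addC-zeroˡ (proj₂ (h̄ (v , zero)))))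
      multiples′ h̄ k k′ h v (suc j) = begin
        h̄ (v , suc j · k v)   ≡⟨ cong (λ t → h̄ (v , t)) (trans (·-suc j (k v)) (addC-comm (k v) _)) ⟩
        h̄ (Shift k (v , j · k v))   ≡⟨ h (v , j · k v) ⟩
        Shift k′ (h̄ (v , j · k v))   ≡⟨ cong (Shift k′) (multiples′ h̄ k k′ h v j) ⟩
        (w , addC (addC (j · k′ w) c) (k′ w))   ≡⟨ cong (w ,_) (trans (addC-swap (j · k′ w) c (k′ w)) (cong (λ s → addC s c) (trans (addC-comm _ (k′ w)) (sym (·-suc j (k′ w)))))) ⟩
        (w , addC (suc j · k′ w) c)   ∎
        where
        w = proj₁ (h̄ (v , zero))
        c = proj₂ (h̄ (v , zero))

  module _ (odd : p ≢ 2) {S T : G → Bool} {h h⁻ : G → G} (H : CosetIso S T h h⁻) (trS : TrivialOutside d S) (trT : TrivialOutside d T)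
           (W : V → V) (c : V → Fin p) (a : V → Unit)
           (formula : ∀ e t → quotient (h (e , t)) ≡ (W (dropk d e) , addC (Unit.val (a (dropk d e)) · t) (c (dropk d e)))) where

    private
      E = Vec (Fin 2) m

      A : V → Fin p → Fin p
      A v t = addC (Unit.val (a v) · t) (c v)

      A-inj : ∀ v {t t′} → A v t ≡ A v t′ → t ≡ t′
      A-inj v eq = trans (sym (Unit.inv-val (a v) _)) (trans (cong (Unit.inv (a v) ·_) (addC-cancelʳ (c v) eq)) (Unit.inv-val (a v) _))

      A-sub : ∀ v s r → subC (A v s) (A v r) ≡ Unit.val (a v) · subC s r
      A-sub v s r = trans (subC-translate (Unit.val (a v) · s) (Unit.val (a v) · r) (c v)) (sym (·-subC (Unit.val (a v)) s r))

      h-form : ∀ e t → h (e , t) ≡ (proj₁ (h (e , t)) , A (dropk d e) t)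
      h-form e t = cong (proj₁ (h (e , t)) ,_) (cong proj₂ (formula e t))

      quotient-inj : ∀ g g′ → quotient (h g) ≡ quotient (h g′) → quotient g ≡ quotient g′
      quotient-inj g g′ eq = subst₂ (λ x y → quotient x ≡ quotient y) (leftInv H g) (leftInv H g′) (descends⁻ H _ _ eq)

      W-inj : ∀ {v v′} → W v ≡ W v′ → v ≡ v′
      W-inj {v} {v′} eq = trans (sym (dropk-pad d v)) (trans (cong proj₁ (quotient-inj (pad d v , zero) (pad d v′ , t′) (begin
          quotient (h (pad d v , zero))   ≡⟨ formula (pad d v) zero ⟩
          (W (dropk d (pad d v)) , A (dropk d (pad d v)) zero)
            ≡⟨ cong (λ v → W v , A v zero) (dropk-pad d v) ⟩
          (W v , A v zero)   ≡⟨ cong₂ _,_ eq (trans (trans (cong (λ s → addC s (c v)) (·-zeroʳ (Unit.val (a v)))) (addC-zeroˡ (c v)))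
                                                              (sym (trans (cong (λ s → addC s (c v′)) (Unit.val-inv (a v′) _)) (addC-subC (c v) (c v′))))) ⟩
          (W v′ , A v′ t′)   ≡⟨ cong (λ v → W v , A v t′) (sym (dropk-pad d v′)) ⟩
          (W (dropk d (pad d v′)) , A (dropk d (pad d v′)) t′)  ≡⟨ sym (formula (pad d v′) t′) ⟩
          quotient (h (pad d v′ , t′))   ∎))) (dropk-pad d v′))
        where
        open ≡-Reasoning
        -- The solution of `A v′ t′ ≡ A v zero`.
        t′ = Unit.inv (a v′) · subC (c v) (c v′)

      -- The C_p coordinate of the image depends only on the coset and on the C_p coordinate of the
      -- argument, injectively on each coset. Hence `h` maps a layer of coset v onto a whole layer
      -- of the image coset.
      preimage : ∀ y v → W v ≡ dropk d y → ∀ r → Σ E λ z → dropk d z ≡ v × h (z , r) ≡ (y , A v r)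
      preimage y v Wv r = z , zv , trans (cong (λ r → h (z , r)) (sym r′≡r)) hz
        where
        g = h⁻ (y , A v r)
        z = proj₁ g
        r′ = proj₂ g
        hz : h (z , r′) ≡ (y , A v r)
        hz = rightInv H (y , A v r)
        qz : (W (dropk d z) , A (dropk d z) r′) ≡ (dropk d y , A v r)
        qz = trans (sym (formula z r′)) (cong quotient hz)
        zv : dropk d z ≡ v
        zv = W-inj (trans (cong proj₁ qz) (sym Wv))
        r′≡r : r′ ≡ r
        r′≡r = A-inj v (trans (cong (λ v → A v r′) (sym zv)) (cong proj₂ qz))

      φ : E → E
      φ e = proj₁ (h (e , zero))

      φ-drop : ∀ e → dropk d (φ e) ≡ W (dropk d e)
      φ-drop e = cong proj₁ (formula e zero)

      φ-inj : ∀ {e e′} → φ e ≡ φ e′ → e ≡ e′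
      φ-inj {e} {e′} eq = cong proj₁ (trans (sym (leftInv H (e , zero))) (trans (cong h⁻ (trans (h-form e zero)
        (trans (cong₂ (λ x v → x , A v zero) eq (W-inj (trans (sym (φ-drop e)) (trans (cong (dropk d) eq) (φ-drop e′))))) (sym (h-form e′ zero)))))
        (leftInv H (e′ , zero))))

      source : E → V
      source y = dropk d (proj₁ (h⁻ (y , zero)))

      W-source : ∀ y → W (source y) ≡ dropk d y
      W-source y = trans (sym (cong proj₁ (formula (proj₁ (h⁻ (y , zero))) (proj₂ (h⁻ (y , zero)))))) (cong (dropk d ∘ proj₁) (rightInv H (y , zero)))

      φ⁻ : E → E
      φ⁻ y = proj₁ (preimage y (source y) (W-source y) zero)

      φ-φ⁻ : ∀ y → φ (φ⁻ y) ≡ y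
      φ-φ⁻ y = cong proj₁ (proj₂ (proj₂ (preimage y (source y) (W-source y) zero)))

      same-coset : ∀ {v e₁ e₂} → dropk d e₁ ≡ v → dropk d e₂ ≡ v → ∀ s r →
        S (e₁ ⊕ e₂ , subC s r) ≡ T (proj₁ (h (e₁ , s)) ⊕ proj₁ (h (e₂ , r)) , Unit.val (a v) · subC s r)
      same-coset {e₁ = e₁} {e₂} refl eq s r = trans (iso H (e₂ , r) (e₁ , s)) (cong (λ t → T (proj₁ (h (e₁ , s)) ⊕ proj₁ (h (e₂ , r)) , t))
        (trans (cong₂ subC (cong proj₂ (formula e₁ s)) (trans (cong proj₂ (formula e₂ r)) (cong (λ v → A v r) eq))) (A-sub _ s r)))

      -- As elements of E are involutions, moving along t and back through a common vertex shows that
      -- z ↦ S (z ⊕ e′ , t) agrees at the preimages of φ e in the layers r and r + 2t, hence in all layers r + jt.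
      module _ (e e′ : E) (t : Fin p) (e′≈e : dropk d e′ ≡ dropk d e) where
        v = dropk d e
        b = Unit.val (a v)

        record Layer (r : Fin p) (z : E) : Set where
          constructor layer
          field
            in-coset : dropk d z ≡ v
            above : proj₁ (h (z , r)) ≡ φ e

        find : ∀ r → Σ E (Layer r)
        find r = let z , zv , hz = preimage (φ e) v (sym (φ-drop e)) r in z , layer zv (cong proj₁ hz)

        two-steps : ∀ {r z z′} → Layer r z → Layer (addC (addC r t) t) z′ → S (z′ ⊕ e′ , t) ≡ S (z ⊕ e′ , t)
        two-steps {r} {z} {z′} (layer zv hz) (layer zv′ hz′) = begin
          S (z′ ⊕ e′ , t)   ≡⟨ cong (λ s → S (z′ ⊕ e′ , s)) (sym (step (addC r t))) ⟩
          S (z′ ⊕ e′ , subC (addC (addC r t) t) (addC r t))   ≡⟨ same-coset zv′ e′≈e _ _ ⟩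
          T (proj₁ (h (z′ , addC (addC r t) t)) ⊕ x , b · subC (addC (addC r t) t) (addC r t))
            ≡⟨ cong₂ (λ y s → T (y ⊕ x , b · s)) (trans hz′ (sym hz)) (trans (step (addC r t)) (sym (step r))) ⟩
          T (proj₁ (h (z , r)) ⊕ x , b · subC (addC r t) r)   ≡⟨ cong (λ y → T (y , b · subC (addC r t) r)) (⊕-comm _ x) ⟩
          T (x ⊕ proj₁ (h (z , r)) , b · subC (addC r t) r)   ≡⟨ sym (same-coset e′≈e zv _ _) ⟩
          S (e′ ⊕ z , subC (addC r t) r)   ≡⟨ cong₂ (λ y s → S (y , s)) (⊕-comm e′ z) (step r) ⟩
          S (z ⊕ e′ , t)   ∎
          where
          open ≡-Reasoning
          x = proj₁ (h (e′ , addC r t))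
          step : ∀ r → subC (addC r t) r ≡ t
          step r = trans (cong (λ s → subC s r) (addC-comm r t)) (subC-addC t r)

        even-steps : ∀ j {z} → Layer ((j * 2) · t) z → S (z ⊕ e′ , t) ≡ S (e ⊕ e′ , t)
        even-steps zero {z} (layer zv hz) = cong (λ x → S (x ⊕ e′ , t)) (φ-inj hz)
        even-steps (suc j) {z} L = let z₀ , L₀ = find ((j * 2) · t) in
          trans (two-steps L₀ (subst (λ r → Layer r z) (trans (·-suc (suc (j * 2)) t) (trans (addC-comm t _)
            (cong (λ s → addC s t) (trans (·-suc (j * 2) t) (addC-comm t _))))) L)) (even-steps j L₀)

        same-layer : S (e ⊕ e′ , t) ≡ T (φ e ⊕ φ e′ , b · t)
        same-layer = let z , L@(layer zv hz) = find t in begin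
          S (e ⊕ e′ , t)   ≡⟨ sym (even-steps (suc (p / 2)) (subst (λ r → Layer r z) all-around L)) ⟩
          S (z ⊕ e′ , t)   ≡⟨ cong (λ s → S (z ⊕ e′ , s)) (sym (subC-zeroʳ t)) ⟩
          S (z ⊕ e′ , subC t zero)   ≡⟨ same-coset zv e′≈e t zero ⟩
          T (proj₁ (h (z , t)) ⊕ φ e′ , b · subC t zero)  ≡⟨ cong₂ (λ y s → T (y ⊕ φ e′ , b · s)) hz (subC-zeroʳ t) ⟩
          T (φ e ⊕ φ e′ , b · t)   ∎
          where
          open ≡-Reasoning
          -- The number of steps is p + 1, even because p is odd, and p of them cancel; so layer t
          -- is reached from layer 0 by steps of 2t.
          all-around : t ≡ (suc (p / 2) * 2) · t
          all-around = sym (trans (cong (_· t) (sym (cong suc (odd-prime pp odd)))) (trans (·-suc p t) (trans (cong (addC t) (·-order t)) (addC-zeroʳ t))))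

      φ-respects : ∀ e e′ t → S (e ⊕ e′ , t) ≡ T (φ e ⊕ φ e′ , Unit.val (a (dropk d e)) · t)
      φ-respects e e′ t with dropk d e′ ≟ᵥ dropk d e
      ... | yes eq = same-layer e e′ t eq
      -- Between different cosets both rows are constant, so t may be replaced by whatever
      -- difference `iso` provides.
      ... | no ne = begin
        S (e ⊕ e′ , t)   ≡⟨ trS _ (λ z → ne (sym (dropk-𝟎⇒≡ d e e′ z))) t (subC zero zero) ⟩
        S (e ⊕ e′ , subC zero zero)   ≡⟨ iso H (e′ , zero) (e , zero) ⟩
        T (φ e ⊕ φ e′ , subC (proj₂ (h (e , zero))) (proj₂ (h (e′ , zero))))
          ≡⟨ trT _ (λ z → ne (sym (W-inj (trans (sym (φ-drop e)) (trans (dropk-𝟎⇒≡ d (φ e) (φ e′) z) (φ-drop e′)))))) _ _ ⟩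
        T (φ e ⊕ φ e′ , Unit.val (a (dropk d e)) · t)   ∎
        where open ≡-Reasoning

    admissible-of-affine : Σ (E → E) λ φ → Σ (E → E) λ φ⁻ → Admissible d S T φ φ⁻
    admissible-of-affine = φ , φ⁻ , record
      { leftInv = λ x → φ-inj (φ-φ⁻ (φ x)) ; rightInv = φ-φ⁻
      ; pres = λ x y eq → trans (φ-drop x) (trans (cong W eq) (sym (φ-drop y)))
      ; pres⁻ = λ x y eq → W-inj (trans (sym (φ-drop (φ⁻ x))) (trans (cong (dropk d) (φ-φ⁻ x)) (trans eq
                  (trans (cong (dropk d) (sym (φ-φ⁻ y))) (φ-drop (φ⁻ y))))))
      ; scalar = a ; respects = φ-respects }

-- The case p = 2

module SixDimensional where

  -- Writing an element of C₂⁶ as (u , h) with u, h ∈ F₂³, the set S is the quadric u·h = 1 and T the cubic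
  -- u·h + h₁h₂h₃ = 1; the shift u ↦ u + (h₂h₃ , h₁h₃ , h₁h₂) turns one Cayley graph into the other.

  private
    G = C2⁵×C 2
    _∙_ = opC2⁵×C 2

    S T : G → Bool
    S (u₁ ∷ u₂ ∷ u₃ ∷ h₁ ∷ h₂ ∷ [] , h₃) = (bool u₁ ∧ bool h₁) xor ((bool u₂ ∧ bool h₂) xor (bool u₃ ∧ bool h₃))
    T x@(_ ∷ _ ∷ _ ∷ h₁ ∷ h₂ ∷ [] , h₃) = S x xor (bool h₁ ∧ (bool h₂ ∧ bool h₃))

    shift : G → G
    shift (u₁ ∷ u₂ ∷ u₃ ∷ h₁ ∷ h₂ ∷ [] , h₃) =
      (addC u₁ (h₂ & h₃) ∷ addC u₂ (h₁ & h₃) ∷ addC u₃ (h₁ & h₂) ∷ h₁ ∷ h₂ ∷ [] , h₃)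
      where
      _&_ : Fin 2 → Fin 2 → Fin 2
      a & b = bit (bool a ∧ bool b)

    addC-invol : (a b : Fin 2) → addC (addC a b) b ≡ a
    addC-invol a b = trans (CyclicGroup.addC-assoc 1 a b b) (trans (cong (addC a) (addC-self b)) (CyclicGroup.addC-zeroʳ 1 a))

    shift-invol : ∀ x → shift (shift x) ≡ x
    shift-invol (u₁ ∷ u₂ ∷ u₃ ∷ h₁ ∷ h₂ ∷ [] , h₃) =
      cong₂ _,_ (cong₂ _∷_ (addC-invol u₁ _) (cong₂ _∷_ (addC-invol u₂ _) (cong (_∷ h₁ ∷ h₂ ∷ []) (addC-invol u₃ _)))) refl

    allVec : ∀ n → (Vec (Fin 2) n → Bool) → Bool
    allVec zero f = f []
    allVec (suc n) f = allVec n (λ x → f (zero ∷ x)) ∧ allVec n (λ x → f (suc zero ∷ x))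

    allVec-sound : ∀ n f → allVec n f ≡ true → ∀ x → f x ≡ true
    allVec-sound zero f eq [] = eq
    allVec-sound (suc n) f eq (zero ∷ x) = allVec-sound n _ (∧-conicalˡ _ _ eq) x
    allVec-sound (suc n) f eq (suc zero ∷ x) = allVec-sound n _ (∧-conicalʳ (allVec n (λ x → f (zero ∷ x))) _ eq) x

    xnor-sound : ∀ a b → not (a xor b) ≡ true → a ≡ b
    xnor-sound false false _ = refl
    xnor-sound true true _ = refl

    unpair : Vec (Fin 2) 12 → G × G
    unpair (a₁ ∷ a₂ ∷ a₃ ∷ a₄ ∷ a₅ ∷ a₆ ∷ b₁ ∷ b₂ ∷ b₃ ∷ b₄ ∷ b₅ ∷ b₆ ∷ []) =
      (a₁ ∷ a₂ ∷ a₃ ∷ a₄ ∷ a₅ ∷ [] , a₆) , (b₁ ∷ b₂ ∷ b₃ ∷ b₄ ∷ b₅ ∷ [] , b₆)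

    -- By evaluation at all 2¹² pairs; as the group has exponent 2, sums serve as differences.
    shift-iso : ∀ g h → T (shift h ∙ shift g) ≡ S (h ∙ g)
    shift-iso (a₁ ∷ a₂ ∷ a₃ ∷ a₄ ∷ a₅ ∷ [] , a₆) (b₁ ∷ b₂ ∷ b₃ ∷ b₄ ∷ b₅ ∷ [] , b₆) =
      xnor-sound _ _ (allVec-sound 12 (λ v → let g , h = unpair v in not (T (shift h ∙ shift g) xor S (h ∙ g))) refl
        (a₁ ∷ a₂ ∷ a₃ ∷ a₄ ∷ a₅ ∷ a₆ ∷ b₁ ∷ b₂ ∷ b₃ ∷ b₄ ∷ b₅ ∷ b₆ ∷ []))

    ∙-cancel : ∀ s g → (s ∙ g) ∙ g ≡ s
    ∙-cancel (u , a) (v , b) = cong₂ _,_ (⊕-cancelʳ u v) (addC-invol a b)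

    arc⇒ : ∀ {Q : G → Bool} {g h} → CayArc _∙_ Q g h → Q (h ∙ g) ≡ true
    arc⇒ {Q} {g} (s , Qs , refl) = trans (cong Q (∙-cancel s g)) Qs

    ⇒arc : ∀ {Q : G → Bool} {g h} → Q (h ∙ g) ≡ true → CayArc _∙_ Q g h
    ⇒arc {Q} {g} {h} eq = h ∙ g , eq , sym (∙-cancel h g)

    S≅T : CayIso _∙_ S T
    S≅T = mk↔ₛ′ shift shift shift-invol shift-invol , λ g h →
      (λ arc → ⇒arc {T} (trans (shift-iso g h) (arc⇒ {S} arc))) ,
      (λ arc → ⇒arc {S} (trans (sym (shift-iso g h)) (arc⇒ {T} arc)))

    xorSum : ∀ {n} → Vec Bool n → Bool
    xorSum [] = false
    xorSum (a ∷ x) = a xor xorSum x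

    xorSum-xor : ∀ {n} (x y : Vec Bool n) → xorSum (zipWith _xor_ x y) ≡ xorSum x xor xorSum y
    xorSum-xor [] [] = refl
    xorSum-xor (a ∷ x) (b ∷ y) = trans (cong ((a xor b) xor_) (xorSum-xor x y)) (interchange a b (xorSum x) (xorSum y))
      where
      interchange : ∀ a b c d → (a xor b) xor (c xor d) ≡ (a xor c) xor (b xor d)
      interchange a b c d = trans (xor-assoc a b _) (trans (cong (a xor_) (trans (sym (xor-assoc b c d))
        (trans (cong (_xor d) (xor-comm b c)) (xor-assoc c b d)))) (sym (xor-assoc a c _)))

    -- The seven nonempty subset sums of three elements. Adding a function over them gives its third
    -- derivative at 0, because S and T vanish at the missing vertex 0.
    cube : {A : Set} → (A → A → A) → A → A → A → Vec A 7
    cube _+_ a b c = a ∷ b ∷ c ∷ (a + b) ∷ (a + c) ∷ (b + c) ∷ ((a + b) + c) ∷ []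

    pairAdd : Fin 2 × Fin 2 → Fin 2 × Fin 2 → Fin 2 × Fin 2
    pairAdd (u , h) (u′ , h′) = addC u u′ , addC h h′

    pairMul : Fin 2 × Fin 2 → Bool
    pairMul (u , h) = bool u ∧ bool h

    pairMul-cube : ∀ a b c → xorSum (Vec.map pairMul (cube pairAdd a b c)) ≡ false
    pairMul-cube (u , h) (u′ , h′) (u″ , h″) = xnor-sound _ false (allVec-sound 6
      (λ { (u ∷ h ∷ u′ ∷ h′ ∷ u″ ∷ h″ ∷ []) → not (xorSum (Vec.map pairMul (cube pairAdd (u , h) (u′ , h′) (u″ , h″))) xor false) }) refl
      (u ∷ h ∷ u′ ∷ h′ ∷ u″ ∷ h″ ∷ []))

    -- S is a sum of three products in separate pairs of variables, so the sum splits into three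
    -- that `pairMul-cube` settles by evaluating 64 cases each.
    S-cube : ∀ a b c → xorSum (Vec.map S (cube _∙_ a b c)) ≡ false
    S-cube a@(a₁ ∷ a₂ ∷ a₃ ∷ a₄ ∷ a₅ ∷ [] , a₆) b@(b₁ ∷ b₂ ∷ b₃ ∷ b₄ ∷ b₅ ∷ [] , b₆) c@(c₁ ∷ c₂ ∷ c₃ ∷ c₄ ∷ c₅ ∷ [] , c₆) =
      trans (xorSum-xor x (zipWith _xor_ y z)) (trans (cong (xorSum x xor_) (xorSum-xor y z))
        (cong₂ _xor_ (pairMul-cube (a₁ , a₄) (b₁ , b₄) (c₁ , c₄))
          (cong₂ _xor_ (pairMul-cube (a₂ , a₅) (b₂ , b₅) (c₂ , c₅)) (pairMul-cube (a₃ , a₆) (b₃ , b₆) (c₃ , c₆)))))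
      where
      x = Vec.map pairMul (cube pairAdd (a₁ , a₄) (b₁ , b₄) (c₁ , c₄))
      y = Vec.map pairMul (cube pairAdd (a₂ , a₅) (b₂ , b₅) (c₂ , c₅))
      z = Vec.map pairMul (cube pairAdd (a₃ , a₆) (b₃ , b₆) (c₃ , c₆))

  -- S has degree 2, so its third derivatives vanish, while T has degree 3.
  C₂⁶-not-DCI : ¬ IsDCIGroup (opC2⁵×C 2)
  C₂⁶-not-DCI dci with dci S T S≅T
  -- On the cube of `e₁`, `e₂`, `e₃` the u-part is 0 and T is true only at the full sum, so the sum
  -- over the cube is true; carried back by φ it would be a third derivative of S.
  ... | φ , aut , TφS = case trans (sym (S-cube a b c)) (trans (cong xorSum S-values) refl) of λ ()
    where
    e₁ e₂ e₃ a b c : G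
    e₁ = zero ∷ zero ∷ zero ∷ suc zero ∷ zero ∷ [] , zero
    e₂ = zero ∷ zero ∷ zero ∷ zero ∷ suc zero ∷ [] , zero
    e₃ = zero ∷ zero ∷ zero ∷ zero ∷ zero ∷ [] , suc zero
    a = Inverse.from φ e₁
    b = Inverse.from φ e₂
    c = Inverse.from φ e₃
    to-cube : Vec.map (Inverse.to φ) (cube _∙_ a b c) ≡ cube _∙_ e₁ e₂ e₃
    to-cube = cong₂ _∷_ φa (cong₂ _∷_ φb (cong₂ _∷_ φc (cong₂ _∷_ φab (cong₂ _∷_ (trans (aut a c) (cong₂ _∙_ φa φc))
      (cong₂ _∷_ (trans (aut b c) (cong₂ _∙_ φb φc)) (cong (_∷ []) (trans (aut (a ∙ b) c) (cong₂ _∙_ φab φc))))))))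
      where
      φa = Inverse.strictlyInverseˡ φ e₁
      φb = Inverse.strictlyInverseˡ φ e₂
      φc = Inverse.strictlyInverseˡ φ e₃
      φab = trans (aut a b) (cong₂ _∙_ φa φb)
    S-values : Vec.map S (cube _∙_ a b c) ≡ Vec.map T (cube _∙_ e₁ e₂ e₃)
    S-values = trans (Vecₚ.map-cong (λ x → sym (TφS x)) (cube _∙_ a b c))
      (trans (Vecₚ.map-∘ T (Inverse.to φ) (cube _∙_ a b c)) (cong (Vec.map T) to-cube))

-- The case of an odd prime

2^-injective : ∀ {i j} → 2 ^ i ≡ 2 ^ j → i ≡ j
2^-injective {i} {j} eq with <-cmp i j
... | tri< i<j _ _ = ⊥-elim (<-irrefl eq (^-monoʳ-< 2 (s≤s (s≤s z≤n)) i<j))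
... | tri≈ _ i≡j _ = i≡j
... | tri> _ _ j<i = ⊥-elim (<-irrefl (sym eq) (^-monoʳ-< 2 (s≤s (s≤s z≤n)) j<i))

module DecidableEquivalence (n m : ℕ) where
  open CyclicGroup n
  open GroupOps n m
  open Colourings n m
  open LinIso
  private
    p = suc n
    E = Vec (Fin 2) m

  -- This removes the double negations left by the conjugacy arguments. Linear maps are coded by
  -- their tables of values and units by residues modulo p, which leaves a finite search.
  equivalent? : ∀ S T → Dec (Equivalent S T)
  equivalent? S T = map′ decode encode
    (search tables λ v → search tables λ w → search ↔-refl λ k → search ↔-refl λ k′ →
      every E↔ (λ x → app w (app v x) ≟ᵥ x) ×-dec every E↔ (λ x → app v (app w x) ≟ᵥ x) ×-dec
      every E↔ (λ x → every E↔ λ y → app v (x ⊕ y) ≟ᵥ (app v x ⊕ app v y)) ×-dec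
      every ↔-refl (λ t → (toℕ k′ · toℕ k · t) Finₚ.≟ t) ×-dec
      every E↔ (λ e → every ↔-refl λ t → T (app v e , toℕ k · t) Bool.≟ S (e , t)))
    where
    E↔ = Vec↔Fin m
    Table = Vec E (2 ^ m)
    tables : Table ↔ Fin ((2 ^ m) ^ (2 ^ m))
    tables = Vec↔Finᴬ E↔ (2 ^ m)
    app : Table → E → E
    app v x = lookup v (Inverse.to E↔ x)
    table : (E → E) → Table
    table f = tabulate (f ∘ Inverse.from E↔)
    app-table : ∀ f x → app (table f) x ≡ f x
    app-table f x = trans (lookup∘tabulate _ (Inverse.to E↔ x)) (cong f (Inverse.strictlyInverseʳ E↔ x))
    Code : Table → Table → Fin p → Fin p → Set
    Code v w k k′ = (∀ x → app w (app v x) ≡ x) × (∀ x → app v (app w x) ≡ x) × (∀ x y → app v (x ⊕ y) ≡ app v x ⊕ app v y) ×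
      (∀ t → toℕ k′ · toℕ k · t ≡ t) × (∀ e t → T (app v e , toℕ k · t) ≡ S (e , t))
    decode : (Σ Table λ v → Σ Table λ w → Σ (Fin p) λ k → Σ (Fin p) λ k′ → Code v w k k′) → Equivalent S T
    decode (v , w , k , k′ , l , r , additive , inv , eq) =
      record { to = app v ; from = app w ; from-to = l ; to-from = r ; to-⊕ = additive } ,
      record { val = toℕ k ; inv = toℕ k′ ; inv-val = inv } , eq
    reduce : ∀ k t → toℕ [ k ] · t ≡ k · t
    reduce k t = trans (cong [_] (*-comm (toℕ [ k ]) (toℕ t))) (trans ([]-· (toℕ t) k) (cong [_] (*-comm (toℕ t) k)))
    encode : Equivalent S T → Σ Table λ v → Σ Table λ w → Σ (Fin p) λ k → Σ (Fin p) λ k′ → Code v w k k′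
    encode (α , a , eq) = table (to α) , table (from α) , [ Unit.val a ] , [ Unit.inv a ] ,
      (λ x → trans (app-table (from α) _) (trans (cong (from α) (app-table (to α) x)) (from-to α x))) ,
      (λ x → trans (app-table (to α) _) (trans (cong (to α) (app-table (from α) x)) (to-from α x))) ,
      (λ x y → trans (app-table (to α) _) (trans (to-⊕ α x y) (sym (cong₂ _⊕_ (app-table (to α) x) (app-table (to α) y))))) ,
      (λ t → trans (reduce (Unit.inv a) _) (trans (cong (Unit.inv a ·_) (reduce (Unit.val a) t)) (Unit.inv-val a t))) ,
      λ e t → trans (cong₂ (λ x s → T (x , s)) (app-table (to α) e) (reduce (Unit.val a) t)) (eq e t)

module OddPrime (n : ℕ) (pp : Prime (suc n)) (odd : suc n ≢ 2) where
  open CyclicGroup n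
  open GroupOps n 5
  open Colourings n 5
  open LinIso
  private
    p = suc n
    E = Vec (Fin 2) 5

  map₁ : (E → E) → G → G
  map₁ h (e , t) = h e , t

  module _ {S T : G → Bool} {f f⁻ : G → G} (l : ∀ g → f⁻ (f g) ≡ g) (r : ∀ g → f (f⁻ g) ≡ g) (iso : Iso S T f) where

    -- Induction along the sum of generators: at every base point, a step by a u with nontrivial row
    -- in S becomes a step by a u′ with nontrivial row in T, and these lie in the span described by
    -- `β`.
    shift-in-span : ∀ (d : ℕ) (β : LinIso 5) → (∀ u → ¬ Trivial T u → dropk d (to β u) ≡ 𝟎) →
      ∀ {x} → Span (λ u → ¬ Trivial S u) x → ∀ g → Σ E λ w → dropk d (to β w) ≡ 𝟎 × f ((x , zero) ∙ g) ≡ (w , zero) ∙ f g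
    shift-in-span d β small nil g = 𝟎 , trans (cong (dropk d) (to-𝟎 β)) (dropk-𝟎 d) , trans (cong f (0ᴳ-identity g)) (sym (0ᴳ-identity (f g)))
    shift-in-span d β small (add {x} {u} sp nt) g =
      let w , w0 , fw = shift-in-span d β small sp ((u , zero) ∙ g)
          u′ , nt′ , fu = WalkCount.iso-nontrivial n 5 pp odd S T f f⁻ l r iso g u nt
      in w ⊕ u′ , trans (cong (dropk d) (to-⊕ β w u′)) (trans (dropk-⊕ d (to β w) (to β u′)) (trans (cong₂ _⊕_ w0 (small u′ nt′)) (⊕-self 𝟎))) ,
         trans (cong f (assoc x u g)) (trans fw (trans (cong ((w , zero) ∙_) fu) (sym (assoc w u′ (f g)))))
      where
      assoc : ∀ x y g → (x ⊕ y , zero) ∙ g ≡ (x , zero) ∙ ((y , zero) ∙ g)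
      assoc x y (e , t) = cong₂ _,_ (⊕-assoc x y e) (cong (addC zero) (sym (addC-zeroˡ t)))

  equivalent : ∀ {S T : G → Bool} (f f⁻ : G → G) → (∀ g → f⁻ (f g) ≡ g) → (∀ g → f (f⁻ g) ≡ g) → Iso S T f → ¬ ¬ Equivalent S T
  equivalent {S} {T} f f⁻ l r iso ¬eqv = with-coordinates (span-coordinates (λ u → ¬ Trivial S u) (λ u → ¬? (Trivial? S u)))
                                                          (span-coordinates (λ u → ¬ Trivial T u) (λ u → ¬? (Trivial? T u)))
    where
    Coordinates : (G → Bool) → Set
    Coordinates S = Σ ℕ λ d → d ≤ 5 × Σ (LinIso 5) λ β →
      (∀ u → ¬ Trivial S u → dropk d (to β u) ≡ 𝟎) × (∀ x → dropk d (to β x) ≡ 𝟎 → Span (λ u → ¬ Trivial S u) x)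
    iso⁻ : Iso T S f⁻
    iso⁻ g h = trans (sym (cong₂ (λ x y → T (x ⊖ y)) (r h) (r g))) (sym (iso (f⁻ g) (f⁻ h)))
    outside : ∀ {S} d (β : LinIso 5) → (∀ u → ¬ Trivial S u → dropk d (to β u) ≡ 𝟎) → TrivialOutside d (twist β S)
    outside {S} d β small e ne = decidable-stable (Trivial? S (from β e))
      (λ nt → ne (trans (cong (dropk d) (sym (to-from β e))) (small (from β e) nt)))
    descends : ∀ {S T} {f f⁻ : G → G} → (∀ g → f⁻ (f g) ≡ g) → (∀ g → f (f⁻ g) ≡ g) → Iso S T f →
      ∀ d d′ (β β′ : LinIso 5) → (∀ u → ¬ Trivial T u → dropk d′ (to β′ u) ≡ 𝟎) → (∀ x → dropk d (to β x) ≡ 𝟎 → Span (λ u → ¬ Trivial S u) x) →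
      ∀ e e′ t → dropk d e ≡ dropk d e′ →
      Descent.quotient n 5 d′ pp (map₁ (to β′) (f (map₁ (from β) (e , t)))) ≡ Descent.quotient n 5 d′ pp (map₁ (to β′) (f (map₁ (from β) (e′ , t))))
    descends {f = f} l r iso d d′ β β′ small span e e′ t eq =
      let w , w0 , fw = shift-in-span l r iso d′ β′ small (span (from β (e ⊕ e′)) (trans (cong (dropk d) (to-from β _)) (dropk-≡⇒𝟎 d e e′ eq))) (from β e′ , t)
          y , s = f (from β e′ , t)
      in trans (cong (λ g → Descent.quotient n 5 d′ pp (map₁ (to β′) g)) (trans (cong f (cong₂ _,_ (sym
           (trans (cong (_⊕ from β e′) (from-⊕ β e e′)) (⊕-cancelʳ _ _))) (sym (addC-zeroˡ t)))) fw))
         (cong₂ _,_ (trans (cong (dropk d′) (to-⊕ β′ w y)) (trans (dropk-⊕ d′ (to β′ w) (to β′ y)) (trans (cong (_⊕ dropk d′ (to β′ y)) w0) (⊕-identityˡ _))))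
           (addC-zeroˡ s))
    with-coordinates : Coordinates S → Coordinates T → ⊥
    with-coordinates (d , d≤5 , β , smallS , spanS) (d′ , d′≤5 , β′ , smallT , spanT) = with-same-dimension d≡d′
      where
      F F⁻ : G → G
      F g = map₁ (to β′) (f (map₁ (from β) g))
      F⁻ g = map₁ (to β) (f⁻ (map₁ (from β′) g))
      F-left : ∀ g → F⁻ (F g) ≡ g
      F-left (e , t) = trans (cong (λ x → map₁ (to β) (f⁻ x)) (cong₂ _,_ (from-to β′ _) refl)) (trans (cong (map₁ (to β)) (l _)) (cong (_, t) (to-from β e)))
      F-right : ∀ g → F (F⁻ g) ≡ g
      F-right (e , t) = trans (cong (λ x → map₁ (to β′) (f x)) (cong₂ _,_ (from-to β _) refl)) (trans (cong (map₁ (to β′)) (r _)) (cong (_, t) (to-from β′ e)))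
      module Q = Descent n 5 d pp
      module Q′ = Descent n 5 d′ pp
      F-descends : ∀ g g′ → Q.quotient g ≡ Q.quotient g′ → Q′.quotient (F g) ≡ Q′.quotient (F g′)
      F-descends (e , t) (e′ , t′) eq with refl ← cong proj₂ eq = descends l r iso d d′ β β′ smallT spanS e e′ t (cong proj₁ eq)
      F⁻-descends : ∀ g g′ → Q′.quotient g ≡ Q′.quotient g′ → Q.quotient (F⁻ g) ≡ Q.quotient (F⁻ g′)
      F⁻-descends (e , t) (e′ , t′) eq with refl ← cong proj₂ eq = descends r l iso⁻ d′ d β′ β smallS spanT e e′ t (cong proj₁ eq)
      finite : ∀ d → (Vec (Fin 2) (5 ∸ d) × Fin p) ↔ Fin (2 ^ (5 ∸ d) * p)
      finite d = ↔-trans (Vec↔Fin (5 ∸ d) ×-↔ ↔-refl) (↔-sym *↔×)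
      quotients : Q.X ↔ Q′.X
      quotients = mk↔ₛ′ (λ x → Q′.quotient (F (Q.section x))) (λ x → Q.quotient (F⁻ (Q′.section x)))
        (λ x → trans (F-descends _ (F⁻ (Q′.section x)) (Q.quotient-section _)) (trans (cong Q′.quotient (F-right _)) (Q′.quotient-section x)))
        (λ x → trans (F⁻-descends _ (F (Q.section x)) (Q′.quotient-section _)) (trans (cong Q.quotient (F-left _)) (Q.quotient-section x)))
      -- `F` induces a bijection of the two quotients, whose sizes are p times 2 to the powers 5 - d
      -- and 5 - d′.
      d≡d′ : d ≡ d′
      d≡d′ = ∸-cancelˡ-≡ d≤5 d′≤5 (2^-injective (*-cancelʳ-≡ _ _ p (↔⇒≡ (↔-trans (↔-sym (finite d)) (↔-trans quotients (finite d′))))))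
      F-iso : Iso (twist β S) (twist β′ T) F
      F-iso (e , t) (e′ , t′) = trans (cong (λ x → S (x , subC t′ t)) (from-⊕ β e′ e)) (trans (iso (from β e , t) (from β e′ , t′))
        (cong (λ x → T (x , subC (proj₂ (f (from β e′ , t′))) (proj₂ (f (from β e , t))))) (sym (trans (from-⊕ β′ _ _) (cong₂ _⊕_ (from-to β′ _) (from-to β′ _))))))
      with-same-dimension : d ≡ d′ → ⊥
      with-same-dimension refl = Q.affine {twist β S} {twist β′ T} I trS trT λ (h , h⁻ , H , W , c , a , form) →
        let φ , φ⁻ , A = Q.admissible-of-affine odd H trS trT W c a form in
        -- The refinement starts at level 0, where preserving the flag only means respecting
        -- equality.
        FromFlag.equivalent-of-level n d 5 0 refl d≤5 A trS trT (λ { zero _ x y refl → refl }) (λ { zero _ x y refl → refl })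
          (λ eqv → ¬eqv (untwist β β′ {S} {T} eqv))
        where
        trS = outside {S} d β smallS
        trT = outside {T} d β′ smallT
        I : Q.CosetIso (twist β S) (twist β′ T) F F⁻
        I = record { leftInv = F-left ; rightInv = F-right ; iso = F-iso ; descends = F-descends ; descends⁻ = F⁻-descends }

  arc⇒ : ∀ {Q g h} → CayArc (opC2⁵×C p) Q g h → Q (h ⊖ g) ≡ true
  arc⇒ {Q} {g} (s , Qs , refl) = trans (cong Q (∙-⊖ s g)) Qs

  ⇒arc : ∀ {Q g h} → Q (h ⊖ g) ≡ true → CayArc (opC2⁵×C p) Q g h
  ⇒arc {Q} {g} {h} eq = h ⊖ g , eq , sym (⊖-∙ h g)

  iso-of-CayIso : ∀ {S T} ((f , _) : CayIso (opC2⁵×C p) S T) → Iso S T (Inverse.to f)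
  iso-of-CayIso {S} {T} (f , arcs) g h = agree (λ Sx → arc⇒ {T} (proj₁ (arcs g h) (⇒arc {S} Sx))) (λ Tx → arc⇒ {S} (proj₂ (arcs g h) (⇒arc {T} Tx)))
    where
    agree : ∀ {b c} → (b ≡ true → c ≡ true) → (c ≡ true → b ≡ true) → b ≡ c
    agree {true} {c} h h′ = sym (h refl)
    agree {false} {true} h h′ = h′ refl
    agree {false} {false} h h′ = refl

  isDCI : IsDCIGroup (opC2⁵×C p)
  isDCI S T cay@(f , _) = automorphism (decidable-stable (DecidableEquivalence.equivalent? n 5 S T)
      (equivalent {S} {T} (Inverse.to f) (Inverse.from f) (Inverse.strictlyInverseʳ f) (Inverse.strictlyInverseˡ f) (iso-of-CayIso cay)))
    where
    automorphism : Equivalent S T → CayleyIsomorphic (opC2⁵×C p) S T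
    automorphism (α , a , eq) = mk↔ₛ′ (λ (e , t) → to α e , Unit.val a · t) (λ (e , t) → from α e , Unit.inv a · t)
        (λ (e , t) → cong₂ _,_ (to-from α e) (Unit.val-inv a t)) (λ (e , t) → cong₂ _,_ (from-to α e) (Unit.inv-val a t)) ,
      (λ (u , s) (v , t) → cong₂ _,_ (to-⊕ α u v) (·-addC (Unit.val a) s t)) , λ (e , t) → eq e t

theorem1p1 : (p : ℕ) → Prime p → (IsDCIGroup (opC2⁵×C p) ⇔ p ≢ 2)
theorem1p1 zero pp = ⊥-elim (¬prime[0] pp)
theorem1p1 (suc n) pp = mk⇔ (λ { dci refl → SixDimensional.C₂⁶-not-DCI dci }) (λ odd → OddPrime.isDCI n pp odd)
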